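{- For any prime $p>5$, $$\sum_{k=1}^{p-1}\frac{2^k}{k^3}\equiv-\frac13q^3_p(2)+\frac74X+\frac5{12}pq^4_p(2)+\frac{7p}6q_p(2)B_{p-3}-\frac{3p}8\sum_{k=1}^{\frac{p-1}2}\frac{H_k}{k^3}\pmod{p^2},$$ where $q_p(2)=(2^{p-1}-1)/p$ and $X=\frac{B_{p-3}}{p-3}-\frac{B_{2p-4}}{4p-8}$.
   Context: $B_n$ are the Bernoulli numbers ($B_0=1$, $\sum_{k=0}^{n-1}\binom nk B_k=0$ for $n\ge2$). $H_k=\sum_{j=1}^k 1/j$. Congruences are between $p$-integral rational numbers. -}

module Defs where

open import Data.Nat as ℕ using (ℕ; zero; suc; _∸_)
open import Data.Nat.Divisibility using (_∣_)
open import Data.Nat.Combinatorics using (_C_)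
open import Data.Integer as ℤ using (ℤ; +_)
open import Data.Fin as F using (Fin; toℕ)
open import Data.Vec using (Vec; []; _∷_; _∷ʳ_; lookup; last)
open import Data.Rational using (ℚ; _/_; _+_; _-_; _*_; -_; 0ℚ; 1ℚ; ↧ₙ_)
open import Relation.Nullary using (¬_)

fromℕ : ℕ → ℚ
fromℕ n = (+ n) / 1

-- 1/n for n ≥ 1 (convention inv 0 = 0; only ever used with n ≥ 1)
inv : ℕ → ℚ
inv zero = 0ℚ
inv (suc n) = (+ 1) / suc n

sumTo : ℕ → (ℕ → ℚ) → ℚ
sumTo zero f = 0ℚ
sumTo (suc n) f = sumTo n f + f (suc n)

sumFin : (n : ℕ) → (Fin n → ℚ) → ℚ
sumFin zero f = 0ℚ
sumFin (suc n) f = f F.zero + sumFin n (λ i → f (F.suc i))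

-- [B_0, …, B_n], using B_0 = 1 and Σ_{k=0}^{m-1} C(m,k) B_k = 0 for m ≥ 2,
-- i.e. B_{m-1} = -(1/m) Σ_{k=0}^{m-2} C(m,k) B_k.
bernoulliVec : (n : ℕ) → Vec ℚ (suc n)
bernoulliVec zero = 1ℚ ∷ []
bernoulliVec (suc n) = v ∷ʳ next
  where
  v : Vec ℚ (suc n)
  v = bernoulliVec n
  next : ℚ
  next = - (inv (suc (suc n)) * sumFin (suc n) (λ k → fromℕ (suc (suc n) C toℕ k) * lookup v k))

B : ℕ → ℚ
B n = last (bernoulliVec n)

H : ℕ → ℚ
H k = sumTo k inv

q2 : ℕ → ℚ
q2 p = (fromℕ (2 ℕ.^ (p ∸ 1)) - 1ℚ) * inv p

pIntegral : ℕ → ℚ → Set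
pIntegral p x = ¬ (p ∣ ↧ₙ x)

_≡_[mod_^_] : ℚ → ℚ → ℕ → ℕ → Set
a ≡ b [mod p ^ k ] = pIntegral p ((a - b) * inv (p ℕ.^ k))

_^ℚ_ : ℚ → ℕ → ℚ
x ^ℚ zero = 1ℚ
x ^ℚ suc n = x * (x ^ℚ n)

{-# OPTIONS --safe #-}
-- Write q = q_p(2), n = (p-1)/2, T = Σ_{k≤n} 1/k³ and λ_a = Σ_{k<p} 2ᵏ/kᵃ.
-- The sum Σ_{0<j<p} (-2)^{j-1} C(p-1,j-1) f(j) has an exact value for f(j) = 1/j, for f(j) = 1/j² and for f(j) = 1/(2p-j),
-- the last one because 4^{p-1} = Σ_{k<p} C(2p-1,k) has an expansion into partial fractions. Expanding 1/(2p-j) in powers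
-- of p, and inserting H_n modulo p⁴, which is the logarithm of Π_{j≤n} (1 - p/j) = 2^{p-1} Π_{j≤n} (1 - p/(2j)),
-- one obtains λ_3 modulo p² up to p Σ 2ᵏ H_{k-1}/k³ and p λ_4. These two are needed only modulo p: binomial duality
-- turns 2ᵏ into (-1)ᵏ, and the reflection k ↦ p - k, the parity of k and partial fractions reduce everything to q, T
-- and Σ_{k≤n} H_k/k³. Finally 12 X ≡ T (mod p²) and 2 B_{p-3} ≡ -T (mod p), since comparing Σ_{k<p} kᵐ folded at p/2
-- with its splitting into even and odd k gives (2^{1-m} - 2) B_m/m ≡ Σ_{k≤n} k^{m-1} (mod p²) for m = p-3 and m = 2p-4.
module Submission where

open import Algebra.Bundles using (CommutativeRing; RawRing)
open import Algebra.Morphism.Structures using (module RingMorphisms)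
import Algebra.Morphism.RingMonomorphism as RingMonomorphism
import Algebra.Properties.CommutativeSemiring.Exp as Exp
open import Algebra.Properties.CommutativeSemigroup using (interchange)
import Algebra.Properties.Ring as RingProperties
import Algebra.Solver.Ring as RingSolver
open import Algebra.Solver.Ring.AlmostCommutativeRing using (fromCommutativeRing; _-Raw-AlmostCommutative⟶_)
open import Algebra.Structures using (IsCommutativeRing)
open import Data.Empty using (⊥-elim; ⊥-elim-irr)
open import Data.Fin as Fin using (Fin; toℕ)
open import Data.Fin.Properties using (toℕ-fromℕ; toℕ-inject₁)
open import Data.Fin.Relation.Unary.Top using (view; ‵fromℕ; ‵inject₁)
open import Data.Integer as ℤ using (ℤ; -[1+_])
open import Data.Integer.Properties as ℤ using ()
open import Data.Maybe using (Maybe; just; nothing)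
open import Data.Nat as ℕ using (ℕ; zero; suc; _∸_; _≤_; _<_; z≤n; s≤s)
open import Data.Nat.Combinatorics using (_C_; nCk+nC[k+1]≡[n+1]C[k+1]; nCn≡1; k>n⇒nCk≡0; nCk≡nC[n∸k]; nC1≡n)
open import Data.Nat.DivMod using (_%_; m≡m%n+[m/n]*n; m%n<n; m*n/n≡m)
open import Data.Nat.Divisibility using (_∣_; _∣?_; divides; ∣-trans; >⇒∤; ∣m+n∣m⇒∣n; ∣-refl; _∣0)
open import Data.Nat.Induction using (<-rec)
open import Data.Nat.Primality using (Prime; euclidsLemma; prime⇒nonTrivial; prime⇒irreducible)
open import Data.Nat.Properties as ℕ using ()
open import Data.Product using (Σ; _,_; _×_; proj₁; proj₂)
open import Data.Rational as ℚ using (ℚ; 0ℚ; 1ℚ; ↧ₙ_; toℚᵘ; +-*-rawRing)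
open import Data.Rational.Properties as ℚ using (toℚᵘ-injective; toℚᵘ-homo-+; toℚᵘ-homo-*; toℚᵘ-fromℚᵘ)
open import Data.Rational.Unnormalised as ℚᵘ using (mkℚᵘ; *≡*)
open import Data.Rational.Unnormalised.Properties as ℚᵘ using ()
open import Data.Sum using (_⊎_; inj₁; inj₂)
open import Data.Vec using (Vec; []; _∷_; _∷ʳ_; lookup)
open import Data.Vec.Properties using (last-∷ʳ)
open import Function using (_∘_)
open import Level using (0ℓ)
open import Relation.Binary.Bundles using (Setoid)
open import Relation.Binary.Definitions using (tri<; tri≈; tri>)
open import Relation.Binary.PropositionalEquality using (_≡_; _≢_; refl; sym; trans; cong; cong₂; subst; subst₂; module ≡-Reasoning)
import Relation.Binary.Reasoning.Setoid as SetoidReasoning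
open import Relation.Nullary using (¬_; yes; no)

-- Let w_a be the sum of W_j / j^a over 0 < j < p, where W_j = (-2)^(j-1) C(p-1,j-1). The expansion
-- of 1/(2p-j) yields w_1 + 2p w_2 + 4p² w_3 + 8p³ w_4, and this enters with a further factor p, so
-- λ_3 is visible only through p³ w_3. The evaluations at 1/j and 1/j² have to be exact because
-- three divisions by p follow. For the same reason the computation starts modulo p⁵, and H_n is
-- needed modulo p⁴ and C(2p-1,p-1) modulo p⁵. Division by p is cancellation of a nonzerodivisor. A
-- congruence stores its quotient, so a quotient by p is again an element to compute with. Most
-- congruences are then one polynomial identity: the difference of the two sides is a combination of
-- quantities already known to vanish modulo a power of p. The integers cleared along the way have
-- no prime factor above 5, apart from p-3 and 2p-4; this is where p > 5 enters.

record CommutativeRing≡ : Set₁ where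
  infixl 6 _+_
  infixl 7 _*_
  infix 8 -_
  field
    Carrier : Set
    _+_ _*_ : Carrier → Carrier → Carrier
    -_ : Carrier → Carrier
    0# 1# : Carrier
    isCommutativeRing : IsCommutativeRing _≡_ _+_ _*_ -_ 0# 1#

-- Numerals and ring solving in an abstract commutative ring

module RingTheory (R≡ : CommutativeRing≡) where

  open CommutativeRing≡ R≡ public renaming (Carrier to A)

  R : CommutativeRing 0ℓ 0ℓ
  R = record { isCommutativeRing = isCommutativeRing }

  open CommutativeRing R public using (_-_; +-assoc; +-comm; *-assoc; *-comm; +-identityˡ; +-identityʳ; *-identityˡ; *-identityʳ; zeroˡ; zeroʳ; distribˡ; distribʳ; -‿inverseʳ)
  open Exp (CommutativeRing.commutativeSemiring R) public using (_^_; ^-homo-*; ^-distrib-*)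
  open RingProperties (CommutativeRing.ring R) using (-0#≈0#; -‿distribˡ-*; -‿distribʳ-*; -‿+-comm; -‿involutive)

  infix 10 ⌊_⌋
  -- The case `1` is separate so that `⌊ 1 ⌋` is `1#` itself and not `1# + 0#`; numerals in
  -- statements then agree with the constants of the solver.
  ⌊_⌋ : ℕ → A
  ⌊ 0 ⌋ = 0#
  ⌊ 1 ⌋ = 1#
  ⌊ suc (suc n) ⌋ = 1# + ⌊ suc n ⌋

  ⌊suc⌋ : ∀ n → ⌊ suc n ⌋ ≡ 1# + ⌊ n ⌋
  ⌊suc⌋ zero = sym (+-identityʳ 1#)
  ⌊suc⌋ (suc n) = refl

  ⌊+⌋ : ∀ m n → ⌊ m ℕ.+ n ⌋ ≡ ⌊ m ⌋ + ⌊ n ⌋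
  ⌊+⌋ zero n = sym (+-identityˡ _)
  ⌊+⌋ (suc m) n = trans (⌊suc⌋ (m ℕ.+ n)) (trans (cong (1# +_) (⌊+⌋ m n)) (trans (sym (+-assoc _ _ _)) (cong (_+ ⌊ n ⌋) (sym (⌊suc⌋ m)))))

  ⌊*⌋ : ∀ m n → ⌊ m ℕ.* n ⌋ ≡ ⌊ m ⌋ * ⌊ n ⌋
  ⌊*⌋ zero n = sym (zeroˡ _)
  ⌊*⌋ (suc m) n = trans (⌊+⌋ n (m ℕ.* n)) (trans (cong₂ _+_ (sym (*-identityˡ _)) (⌊*⌋ m n))
      (trans (sym (distribʳ _ _ _)) (cong (_* ⌊ n ⌋) (sym (⌊suc⌋ m)))))

  ⌊^⌋ : ∀ m k → ⌊ m ℕ.^ k ⌋ ≡ ⌊ m ⌋ ^ k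
  ⌊^⌋ m zero = refl
  ⌊^⌋ m (suc k) = trans (⌊*⌋ m (m ℕ.^ k)) (cong (⌊ m ⌋ *_) (⌊^⌋ m k))

  1^ : ∀ a → 1# ^ a ≡ 1#
  1^ zero = refl
  1^ (suc a) = trans (*-identityˡ _) (1^ a)

  private
    fromℤ : ℤ → A
    fromℤ (ℤ.+ n) = ⌊ n ⌋
    fromℤ -[1+ n ] = - ⌊ suc n ⌋

    fromℤ-⊖ : ∀ m n → fromℤ (m ℤ.⊖ n) ≡ ⌊ m ⌋ - ⌊ n ⌋
    fromℤ-⊖ m zero = sym (trans (cong (⌊ m ⌋ +_) -0#≈0#) (+-identityʳ _))
    fromℤ-⊖ zero (suc n) = sym (+-identityˡ _)
    fromℤ-⊖ (suc m) (suc n) = trans (cong fromℤ (ℤ.[1+m]⊖[1+n]≡m⊖n m n)) (trans (fromℤ-⊖ m n) (sym (trans (cong₂ _-_ (⌊suc⌋ m) (⌊suc⌋ n)) cancel)))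
      where
      cancel : (1# + ⌊ m ⌋) - (1# + ⌊ n ⌋) ≡ ⌊ m ⌋ - ⌊ n ⌋
      cancel = trans (cong ((1# + ⌊ m ⌋) +_) (sym (-‿+-comm _ _))) (trans (cong (_+ (- 1# + - ⌊ n ⌋)) (+-comm _ _))
          (trans (+-assoc _ _ _) (cong (⌊ m ⌋ +_) (trans (sym (+-assoc _ _ _)) (trans (cong (_+ - ⌊ n ⌋) (-‿inverseʳ _)) (+-identityˡ _))))))

    fromℤ-+ : ∀ i j → fromℤ (i ℤ.+ j) ≡ fromℤ i + fromℤ j
    fromℤ-+ (ℤ.+ m) (ℤ.+ n) = ⌊+⌋ m n
    fromℤ-+ (ℤ.+ m) -[1+ n ] = fromℤ-⊖ m (suc n)
    fromℤ-+ -[1+ m ] (ℤ.+ n) = trans (fromℤ-⊖ n (suc m)) (+-comm _ _)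
    fromℤ-+ -[1+ m ] -[1+ n ] = trans (cong (λ k → - ⌊ k ⌋) (sym (cong suc (ℕ.+-suc m n))))
        (trans (cong -_ (⌊+⌋ (suc m) (suc n))) (sym (-‿+-comm _ _)))

    fromℤ-neg : ∀ i → fromℤ (ℤ.- i) ≡ - fromℤ i
    fromℤ-neg (ℤ.+ zero) = sym -0#≈0#
    fromℤ-neg (ℤ.+ suc n) = refl
    fromℤ-neg -[1+ n ] = sym (-‿involutive _)

    fromℤ-*⁺ : ∀ m j → fromℤ (ℤ.+ m ℤ.* j) ≡ ⌊ m ⌋ * fromℤ j
    fromℤ-*⁺ m (ℤ.+ n) = trans (cong fromℤ (sym (ℤ.pos-* m n))) (⌊*⌋ m n)
    fromℤ-*⁺ m -[1+ n ] = trans (cong fromℤ (sym (ℤ.neg-distribʳ-* (ℤ.+ m) (ℤ.+ suc n))))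
        (trans (fromℤ-neg (ℤ.+ m ℤ.* ℤ.+ suc n)) (trans (cong -_ (fromℤ-*⁺ m (ℤ.+ suc n))) (-‿distribʳ-* _ _)))

    fromℤ-* : ∀ i j → fromℤ (i ℤ.* j) ≡ fromℤ i * fromℤ j
    fromℤ-* (ℤ.+ m) j = fromℤ-*⁺ m j
    fromℤ-* -[1+ m ] j = trans (cong fromℤ (sym (ℤ.neg-distribˡ-* (ℤ.+ suc m) j)))
        (trans (fromℤ-neg (ℤ.+ suc m ℤ.* j)) (trans (cong -_ (fromℤ-*⁺ (suc m) j)) (-‿distribˡ-* _ _)))

    fromℤ-morphism : ℤ.+-*-rawRing -Raw-AlmostCommutative⟶ fromCommutativeRing R
    fromℤ-morphism = record { ⟦_⟧ = fromℤ ; +-homo = fromℤ-+ ; *-homo = fromℤ-* ; -‿homo = fromℤ-neg ; 0-homo = refl ; 1-homo = refl }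

    coefficient≟ : ∀ i j → Maybe (fromℤ i ≡ fromℤ j)
    coefficient≟ i j with i ℤ.≟ j
    ... | yes i≡j = just (cong fromℤ i≡j)
    ... | no _ = nothing

  open RingSolver ℤ.+-*-rawRing (fromCommutativeRing R) fromℤ-morphism coefficient≟ public
    using (Polynomial; solve; con; _:+_; _:*_; _:-_; :-_; _:^_; _:=_)

  infix 10 #_
  #_ : ∀ {m} → ℕ → Polynomial m
  # k = con (ℤ.+ k)

-- Finite sums

module FiniteSums (R≡ : CommutativeRing≡) where
  open RingTheory R≡ public
  open ≡-Reasoning

  ∑ : ℕ → (ℕ → A) → A
  ∑ zero f = 0#
  ∑ (suc n) f = ∑ n f + f (suc n)

  ∑-cong : ∀ n {f g : ℕ → A} → (∀ k → 1 ≤ k → k ≤ n → f k ≡ g k) → ∑ n f ≡ ∑ n g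
  ∑-cong zero eq = refl
  ∑-cong (suc n) eq = cong₂ _+_ (∑-cong n λ k 1≤k k≤n → eq k 1≤k (ℕ.m≤n⇒m≤1+n k≤n)) (eq (suc n) (s≤s z≤n) ℕ.≤-refl)

  ∑-zero : ∀ n {f : ℕ → A} → (∀ k → 1 ≤ k → k ≤ n → f k ≡ 0#) → ∑ n f ≡ 0#
  ∑-zero zero eq = refl
  ∑-zero (suc n) eq = trans (cong₂ _+_ (∑-zero n λ k 1≤k k≤n → eq k 1≤k (ℕ.m≤n⇒m≤1+n k≤n)) (eq (suc n) (s≤s z≤n) ℕ.≤-refl)) (+-identityʳ 0#)

  ∑-+ : ∀ n f g → ∑ n (λ k → f k + g k) ≡ ∑ n f + ∑ n g
  ∑-+ zero f g = sym (+-identityʳ 0#)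
  ∑-+ (suc n) f g = trans (cong (_+ (f (suc n) + g (suc n))) (∑-+ n f g))
    (solve 4 (λ a b c d → a :+ b :+ (c :+ d) := a :+ c :+ (b :+ d)) refl (∑ n f) (∑ n g) (f (suc n)) (g (suc n)))

  ∑-*ˡ : ∀ n c f → ∑ n (λ k → c * f k) ≡ c * ∑ n f
  ∑-*ˡ zero c f = sym (zeroʳ c)
  ∑-*ˡ (suc n) c f = trans (cong (_+ c * f (suc n)) (∑-*ˡ n c f)) (sym (distribˡ c _ _))

  ∑-*ʳ : ∀ n c f → ∑ n (λ k → f k * c) ≡ ∑ n f * c
  ∑-*ʳ n c f = trans (∑-cong n λ k _ _ → *-comm (f k) c) (trans (∑-*ˡ n c f) (*-comm c _))

  ∑-neg : ∀ n f → ∑ n (λ k → - f k) ≡ - ∑ n f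
  ∑-neg zero f = solve 0 (# 0 := :- # 0) refl
  ∑-neg (suc n) f = trans (cong (_+ - f (suc n)) (∑-neg n f)) (solve 2 (λ a b → :- a :+ :- b := :- (a :+ b)) refl _ _)

  ∑-minus : ∀ n f g → ∑ n (λ k → f k - g k) ≡ ∑ n f - ∑ n g
  ∑-minus n f g = trans (∑-+ n f (λ k → - g k)) (cong (∑ n f +_) (∑-neg n g))

  ∑-swap : ∀ m n (f : ℕ → ℕ → A) → ∑ m (λ i → ∑ n (f i)) ≡ ∑ n (λ j → ∑ m (λ i → f i j))
  ∑-swap zero n f = sym (∑-zero n λ _ _ _ → refl)
  ∑-swap (suc m) n f = trans (cong (_+ ∑ n (f (suc m))) (∑-swap m n f)) (sym (∑-+ n (λ j → ∑ m (λ i → f i j)) (f (suc m))))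

  ∑-split : ∀ a b f → ∑ (a ℕ.+ b) f ≡ ∑ a f + ∑ b (λ i → f (a ℕ.+ i))
  ∑-split a zero f = trans (cong (λ m → ∑ m f) (ℕ.+-identityʳ a)) (sym (+-identityʳ _))
  ∑-split a (suc b) f = begin
    ∑ (a ℕ.+ suc b) f                                         ≡⟨ cong (λ m → ∑ m f) (ℕ.+-suc a b) ⟩
    ∑ (a ℕ.+ b) f + f (suc (a ℕ.+ b))                         ≡⟨ cong₂ _+_ (∑-split a b f) (cong f (sym (ℕ.+-suc a b))) ⟩
    ∑ a f + ∑ b (λ i → f (a ℕ.+ i)) + f (a ℕ.+ suc b)         ≡⟨ +-assoc _ _ _ ⟩
    ∑ a f + (∑ b (λ i → f (a ℕ.+ i)) + f (a ℕ.+ suc b))       ∎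

  ∑-first : ∀ n f → ∑ (suc n) f ≡ f 1 + ∑ n (λ k → f (suc k))
  ∑-first n f = trans (∑-split 1 n f) (cong (_+ ∑ n (λ k → f (suc k))) (+-identityˡ (f 1)))

  -- The last `m` terms are listed downwards. For `n` = p - 1 this is the substitution k = p - i
  -- that prepares every reflection.
  ∑-upper : ∀ n m f → m ≤ n → ∑ n f ≡ ∑ (n ∸ m) f + ∑ m (λ i → f (suc n ∸ i))
  ∑-upper n zero f _ = sym (+-identityʳ _)
  ∑-upper n (suc m) f m<n = begin
    ∑ n f                                                             ≡⟨ ∑-upper n m f (ℕ.<⇒≤ m<n) ⟩
    ∑ (n ∸ m) f + ∑ m (λ i → f (suc n ∸ i))                           ≡⟨ cong (λ k → ∑ k f + ∑ m (λ i → f (suc n ∸ i))) n∸m ⟩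
    ∑ (n ∸ suc m) f + f (suc (n ∸ suc m)) + ∑ m (λ i → f (suc n ∸ i)) ≡⟨ cong (λ k → ∑ (n ∸ suc m) f + f k + ∑ m (λ i → f (suc n ∸ i))) (sym n∸m) ⟩
    ∑ (n ∸ suc m) f + f (n ∸ m) + ∑ m (λ i → f (suc n ∸ i))           ≡⟨ solve 3 (λ a b c → a :+ b :+ c := a :+ (c :+ b)) refl _ _ _ ⟩
    ∑ (n ∸ suc m) f + (∑ m (λ i → f (suc n ∸ i)) + f (n ∸ m))         ∎
    where
    n∸m : n ∸ m ≡ suc (n ∸ suc m)
    n∸m = ℕ.+-∸-assoc 1 m<n

  ∑-reverse : ∀ n f → ∑ n f ≡ ∑ n (λ i → f (suc n ∸ i))
  ∑-reverse n f = trans (∑-upper n n f ℕ.≤-refl) (trans (cong (λ k → ∑ k f + ∑ n (λ i → f (suc n ∸ i))) (ℕ.n∸n≡0 n)) (+-identityˡ _))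

  -- The pairs (j, i) with j + i ≤ n are grouped by m = j + i; raising `n` by one adds exactly one
  -- antidiagonal.
  ∑-triangle : ∀ n (f : ℕ → ℕ → A) → ∑ n (λ j → ∑ (n ∸ j) (f j)) ≡ ∑ n (λ m → ∑ (m ∸ 1) (λ j → f j (m ∸ j)))
  ∑-triangle zero f = refl
  ∑-triangle (suc n) f = begin
    ∑ n (λ j → ∑ (suc n ∸ j) (f j)) + ∑ (n ∸ n) (f (suc n))
      ≡⟨ cong₂ _+_ (∑-cong n λ j _ j≤n → trans (cong (λ k → ∑ k (f j)) (ℕ.+-∸-assoc 1 j≤n))
          (cong (λ k → ∑ (n ∸ j) (f j) + f j k) (sym (ℕ.+-∸-assoc 1 j≤n)))) (cong (λ k → ∑ k (f (suc n))) (ℕ.n∸n≡0 n)) ⟩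
    ∑ n (λ j → ∑ (n ∸ j) (f j) + f j (suc n ∸ j)) + 0#
      ≡⟨ trans (+-identityʳ _) (∑-+ n _ _) ⟩
    ∑ n (λ j → ∑ (n ∸ j) (f j)) + ∑ n (λ j → f j (suc n ∸ j))
      ≡⟨ cong (_+ ∑ n (λ j → f j (suc n ∸ j))) (∑-triangle n f) ⟩
    ∑ n (λ m → ∑ (m ∸ 1) (λ j → f j (m ∸ j))) + ∑ n (λ j → f j (suc n ∸ j)) ∎

  -- The odd indices are listed in descending order, because for 2n + 1 = p they then have the form
  -- p - 2j and can be reflected onto the even ones.
  ∑-even-odd : ∀ n f → ∑ (n ℕ.+ n) f ≡ ∑ n (λ j → f (j ℕ.+ j)) + ∑ n (λ j → f (suc (n ℕ.+ n) ∸ (j ℕ.+ j)))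
  ∑-even-odd n f = trans (evens-odds n) (cong (∑ n (λ j → f (j ℕ.+ j)) +_) (trans (∑-reverse n _) (∑-cong n λ j _ j≤n → cong f (reflect j j≤n))))
    where
    evens-odds : ∀ n → ∑ (n ℕ.+ n) f ≡ ∑ n (λ j → f (j ℕ.+ j)) + ∑ n (λ j → f (j ℕ.+ j ∸ 1))
    evens-odds zero = sym (+-identityʳ 0#)
    evens-odds (suc n) = trans (cong (λ m → ∑ m f + f (suc m)) (ℕ.+-suc n n))
      (trans (cong (λ x → x + f (suc (n ℕ.+ n)) + f (suc (suc (n ℕ.+ n)))) (evens-odds n))
      (trans (solve 4 (λ a b c d → a :+ b :+ c :+ d := a :+ d :+ (b :+ c)) refl _ _ _ _)
        (cong (λ m → (∑ n (λ j → f (j ℕ.+ j)) + f (suc m)) + (∑ n (λ j → f (j ℕ.+ j ∸ 1)) + f m)) (sym (ℕ.+-suc n n)))))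
    reflect : ∀ j → j ≤ n → (suc n ∸ j) ℕ.+ (suc n ∸ j) ∸ 1 ≡ suc (n ℕ.+ n) ∸ (j ℕ.+ j)
    reflect j j≤n = begin
      (suc n ∸ j) ℕ.+ (suc n ∸ j) ∸ 1                 ≡⟨ cong (λ k → k ℕ.+ k ∸ 1) (ℕ.+-∸-assoc 1 j≤n) ⟩
      d ℕ.+ suc d                                     ≡⟨ ℕ.+-suc d d ⟩
      suc (d ℕ.+ d)                                   ≡⟨ ℕ.m+n∸n≡m (suc (d ℕ.+ d)) (j ℕ.+ j) ⟨
      suc (d ℕ.+ d ℕ.+ (j ℕ.+ j)) ∸ (j ℕ.+ j)         ≡⟨ cong (λ k → suc k ∸ (j ℕ.+ j)) (interchange ℕ.+-commutativeSemigroup d d j j) ⟩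
      suc (d ℕ.+ j ℕ.+ (d ℕ.+ j)) ∸ (j ℕ.+ j)         ≡⟨ cong (λ k → suc (k ℕ.+ k) ∸ (j ℕ.+ j)) (ℕ.m∸n+n≡m j≤n) ⟩
      suc (n ℕ.+ n) ∸ (j ℕ.+ j)                       ∎
      where
      d = n ∸ j

-- Binomial coefficients and binomial transforms

nC0≡1 : ∀ n → n C 0 ≡ 1
nC0≡1 n = trans (nCk≡nC[n∸k] (z≤n {n})) (nCn≡1 n)

[1+k]*[1+n]C[1+k] : ∀ n k → suc k ℕ.* (suc n C suc k) ≡ suc n ℕ.* (n C k)
[1+k]*[1+n]C[1+k] zero zero = refl
[1+k]*[1+n]C[1+k] zero (suc k) = trans (cong (suc (suc k) ℕ.*_) (k>n⇒nCk≡0 (s≤s (s≤s (z≤n {k})))))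
  (trans (ℕ.*-zeroʳ k) (sym (trans (ℕ.+-identityʳ (0 C suc k)) (k>n⇒nCk≡0 (s≤s (z≤n {k}))))))
[1+k]*[1+n]C[1+k] (suc n) zero = trans (ℕ.*-identityˡ _) (trans (sym (nCk+nC[k+1]≡[n+1]C[k+1] (suc n) 0))
  (trans (cong₂ ℕ._+_ (nC0≡1 (suc n)) (trans (sym (ℕ.*-identityˡ _)) (trans ([1+k]*[1+n]C[1+k] n zero)
      (trans (cong (suc n ℕ.*_) (nC0≡1 n)) (ℕ.*-identityʳ (suc n))))))
    (sym (trans (cong (suc (suc n) ℕ.*_) (nC0≡1 (suc n))) (ℕ.*-identityʳ (suc (suc n)))))))
[1+k]*[1+n]C[1+k] (suc n) (suc k) = begin
  suc (suc k) ℕ.* (suc (suc n) C suc (suc k))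
    ≡⟨ cong (suc (suc k) ℕ.*_) (nCk+nC[k+1]≡[n+1]C[k+1] (suc n) (suc k)) ⟨
  suc (suc k) ℕ.* (a ℕ.+ (suc n C suc (suc k)))
    ≡⟨ ℕ.*-distribˡ-+ (suc (suc k)) a _ ⟩
  (a ℕ.+ suc k ℕ.* a) ℕ.+ suc (suc k) ℕ.* (suc n C suc (suc k))
    ≡⟨ cong₂ (λ x y → (a ℕ.+ x) ℕ.+ y) ([1+k]*[1+n]C[1+k] n k) ([1+k]*[1+n]C[1+k] n (suc k)) ⟩
  (a ℕ.+ suc n ℕ.* (n C k)) ℕ.+ suc n ℕ.* (n C suc k)
    ≡⟨ ℕ.+-assoc a _ _ ⟩
  a ℕ.+ (suc n ℕ.* (n C k) ℕ.+ suc n ℕ.* (n C suc k))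
    ≡⟨ cong (a ℕ.+_) (ℕ.*-distribˡ-+ (suc n) (n C k) (n C suc k)) ⟨
  a ℕ.+ suc n ℕ.* ((n C k) ℕ.+ (n C suc k))
    ≡⟨ cong (λ x → a ℕ.+ suc n ℕ.* x) (nCk+nC[k+1]≡[n+1]C[k+1] n k) ⟩
  a ℕ.+ suc n ℕ.* a ∎
  where
  open ≡-Reasoning
  a = suc n C suc k

module BinomialSums (R≡ : CommutativeRing≡) where
  open FiniteSums R≡ public
  open ≡-Reasoning

  pascal : ∀ n k → ⌊ suc n C suc k ⌋ ≡ ⌊ n C k ⌋ + ⌊ n C suc k ⌋
  pascal n k = trans (cong ⌊_⌋ (sym (nCk+nC[k+1]≡[n+1]C[k+1] n k))) (⌊+⌋ (n C k) (n C suc k))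

  absorb : ∀ n k → ⌊ suc k ⌋ * ⌊ suc n C suc k ⌋ ≡ ⌊ suc n ⌋ * ⌊ n C k ⌋
  absorb n k = trans (sym (⌊*⌋ (suc k) (suc n C suc k))) (trans (cong ⌊_⌋ ([1+k]*[1+n]C[1+k] n k)) (⌊*⌋ (suc n) (n C k)))

  ⌊nC0⌋ : ∀ n → ⌊ n C 0 ⌋ ≡ 1#
  ⌊nC0⌋ n = cong ⌊_⌋ (nC0≡1 n)

  ⌊nCn⌋ : ∀ n → ⌊ n C n ⌋ ≡ 1#
  ⌊nCn⌋ n = cong ⌊_⌋ (nCn≡1 n)

  ⌊nC1+n⌋ : ∀ n → ⌊ n C suc n ⌋ ≡ 0#
  ⌊nC1+n⌋ n = cong ⌊_⌋ (k>n⇒nCk≡0 (ℕ.n<1+n n))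

  next-binomial : ∀ n k → ⌊ suc k ⌋ * ⌊ n C suc k ⌋ ≡ (⌊ n ⌋ - ⌊ k ⌋) * ⌊ n C k ⌋
  next-binomial n k = begin
    ⌊ suc k ⌋ * ⌊ n C suc k ⌋
      ≡⟨ solve 3 (λ s a b → s :* b := s :* (a :+ b) :- s :* a) refl ⌊ suc k ⌋ ⌊ n C k ⌋ ⌊ n C suc k ⌋ ⟩
    ⌊ suc k ⌋ * (⌊ n C k ⌋ + ⌊ n C suc k ⌋) - ⌊ suc k ⌋ * ⌊ n C k ⌋
      ≡⟨ cong (_- ⌊ suc k ⌋ * ⌊ n C k ⌋) (trans (cong (⌊ suc k ⌋ *_) (sym (pascal n k))) (absorb n k)) ⟩
    ⌊ suc n ⌋ * ⌊ n C k ⌋ - ⌊ suc k ⌋ * ⌊ n C k ⌋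
      ≡⟨ cong₂ (λ x y → x * ⌊ n C k ⌋ - y * ⌊ n C k ⌋) (⌊suc⌋ n) (⌊suc⌋ k) ⟩
    (1# + ⌊ n ⌋) * ⌊ n C k ⌋ - (1# + ⌊ k ⌋) * ⌊ n C k ⌋
      ≡⟨ solve 3 (λ n k c → (# 1 :+ n) :* c :- (# 1 :+ k) :* c := (n :- k) :* c) refl ⌊ n ⌋ ⌊ k ⌋ ⌊ n C k ⌋ ⟩
    (⌊ n ⌋ - ⌊ k ⌋) * ⌊ n C k ⌋ ∎

  binomial-transform : A → (ℕ → A) → ℕ → A
  binomial-transform x b n = ∑ n (λ k → ⌊ n C k ⌋ * (x ^ k * b k))

  transform-pascal : ∀ n (t : ℕ → A) → ∑ (suc n) (λ k → ⌊ suc n C k ⌋ * t k) ≡ ∑ n (λ k → ⌊ n C k ⌋ * t k) + ∑ (suc n) (λ k → ⌊ n C (k ∸ 1) ⌋ * t k)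
  transform-pascal n t = begin
    ∑ (suc n) (λ k → ⌊ suc n C k ⌋ * t k)
      ≡⟨ ∑-cong (suc n) (λ { (suc k) _ _ → trans (cong (_* t (suc k)) (pascal n k))
          (solve 3 (λ a b c → (a :+ b) :* c := b :* c :+ a :* c) refl _ _ _) }) ⟩
    ∑ (suc n) (λ k → ⌊ n C k ⌋ * t k + ⌊ n C (k ∸ 1) ⌋ * t k)
      ≡⟨ ∑-+ (suc n) _ _ ⟩
    (∑ n (λ k → ⌊ n C k ⌋ * t k) + ⌊ n C suc n ⌋ * t (suc n)) + ∑ (suc n) (λ k → ⌊ n C (k ∸ 1) ⌋ * t k)
      ≡⟨ cong (_+ ∑ (suc n) (λ k → ⌊ n C (k ∸ 1) ⌋ * t k)) (trans (cong (λ z → ∑ n (λ k → ⌊ n C k ⌋ * t k) + z * t (suc n)) (⌊nC1+n⌋ n))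
          (trans (cong (∑ n (λ k → ⌊ n C k ⌋ * t k) +_) (zeroˡ _)) (+-identityʳ _))) ⟩
    ∑ n (λ k → ⌊ n C k ⌋ * t k) + ∑ (suc n) (λ k → ⌊ n C (k ∸ 1) ⌋ * t k) ∎

  -- The binomial theorem; the term k = 0 is subtracted because sums start at 1.
  transform-one : ∀ x n → ∑ n (λ k → ⌊ n C k ⌋ * x ^ k) ≡ (1# + x) ^ n - 1#
  transform-one x zero = solve 0 (# 0 := # 1 :- # 1) refl
  transform-one x (suc n) = begin
    ∑ (suc n) (λ k → ⌊ suc n C k ⌋ * x ^ k)
      ≡⟨ transform-pascal n (x ^_) ⟩
    G + ∑ (suc n) (λ k → ⌊ n C (k ∸ 1) ⌋ * x ^ k)
      ≡⟨ cong (G +_) (∑-first n _) ⟩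
    G + (⌊ n C 0 ⌋ * x ^ 1 + ∑ n (λ k → ⌊ n C k ⌋ * x ^ suc k))
      ≡⟨ cong₂ (λ a b → G + (a * x ^ 1 + b)) (⌊nC0⌋ n) (trans (∑-cong n λ k _ _ → solve 3
          (λ c x y → c :* (x :* y) := x :* (c :* y)) refl ⌊ n C k ⌋ x (x ^ k)) (∑-*ˡ n x _)) ⟩
    G + (1# * x ^ 1 + x * G)
      ≡⟨ cong (λ g → g + (1# * x ^ 1 + x * g)) (transform-one x n) ⟩
    ((1# + x) ^ n - 1#) + (1# * x ^ 1 + x * ((1# + x) ^ n - 1#))
      ≡⟨ solve 2 (λ x y → (y :- # 1) :+ (# 1 :* x :^ 1 :+ x :* (y :- # 1)) := (# 1 :+ x) :* y :- # 1) refl x ((1# + x) ^ n) ⟩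
    (1# + x) * (1# + x) ^ n - 1# ∎
    where
    G = ∑ n (λ k → ⌊ n C k ⌋ * x ^ k)

  module _ (ι : ℕ → A) where

    -- Pascal's rule splits off C(n,k-1), and absorption turns C(n,k-1)/k into C(n+1,k)/(n+1), which
    -- no longer involves the factor 1/k.
    transform-step : ∀ x b n → (∀ k → 1 ≤ k → k ≤ suc n → ⌊ k ⌋ * ι k ≡ 1#) →
      binomial-transform x (λ k → ι k * b k) (suc n) ≡ binomial-transform x (λ k → ι k * b k) n + ι (suc n) * binomial-transform x b (suc n)
    transform-step x b n inverse = begin
      ∑ (suc n) (λ k → ⌊ suc n C k ⌋ * t k)
        ≡⟨ transform-pascal n t ⟩
      ∑ n (λ k → ⌊ n C k ⌋ * t k) + ∑ (suc n) (λ k → ⌊ n C (k ∸ 1) ⌋ * t k)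
        ≡⟨ cong (∑ n (λ k → ⌊ n C k ⌋ * t k) +_) (trans (∑-cong (suc n) pointwise) (∑-*ˡ (suc n) (ι (suc n)) _)) ⟩
      ∑ n (λ k → ⌊ n C k ⌋ * t k) + ι (suc n) * binomial-transform x b (suc n) ∎
      where
      t : ℕ → A
      t k = x ^ k * (ι k * b k)
      pointwise : ∀ k → 1 ≤ k → k ≤ suc n → ⌊ n C (k ∸ 1) ⌋ * t k ≡ ι (suc n) * (⌊ suc n C k ⌋ * (x ^ k * b k))
      pointwise (suc k) 1≤k k≤n = begin
        c * (y * (i * b (suc k)))
          ≡⟨ solve 4 (λ c y i b → c :* (y :* (i :* b)) := # 1 :* c :* i :* (y :* b)) refl c y i (b (suc k)) ⟩
        1# * c * i * (y * b (suc k))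
          ≡⟨ cong (λ z → z * c * i * (y * b (suc k))) (sym (inverse (suc n) (s≤s z≤n) ℕ.≤-refl)) ⟩
        ⌊ suc n ⌋ * ι (suc n) * c * i * (y * b (suc k))
          ≡⟨ solve 5 (λ m j c i w → m :* j :* c :* i :* w := j :* (m :* c :* i :* w)) refl ⌊ suc n ⌋ (ι (suc n)) c i (y * b (suc k)) ⟩
        ι (suc n) * (⌊ suc n ⌋ * c * i * (y * b (suc k)))
          ≡⟨ cong (λ z → ι (suc n) * (z * i * (y * b (suc k)))) (sym (absorb n k)) ⟩
        ι (suc n) * (⌊ suc k ⌋ * c′ * i * (y * b (suc k)))
          ≡⟨ solve 5 (λ j s c′ i w → j :* (s :* c′ :* i :* w) := j :* (s :* i :* (c′ :* w))) refl (ι (suc n)) ⌊ suc k ⌋ c′ i (y * b (suc k)) ⟩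
        ι (suc n) * (⌊ suc k ⌋ * i * (c′ * (y * b (suc k))))
          ≡⟨ cong (λ z → ι (suc n) * (z * (c′ * (y * b (suc k))))) (inverse (suc k) 1≤k k≤n) ⟩
        ι (suc n) * (1# * (c′ * (y * b (suc k))))
          ≡⟨ cong (ι (suc n) *_) (*-identityˡ _) ⟩
        ι (suc n) * (c′ * (y * b (suc k))) ∎
        where
        c = ⌊ n C k ⌋
        c′ = ⌊ suc n C suc k ⌋
        y = x ^ suc k
        i = ι (suc k)

    -- Summing against binomials turns a factor 1/k into a partial sum.
    transform-ι : ∀ x b n → (∀ k → 1 ≤ k → k ≤ n → ⌊ k ⌋ * ι k ≡ 1#) →
      binomial-transform x (λ k → ι k * b k) n ≡ ∑ n (λ m → ι m * binomial-transform x b m)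
    transform-ι x b zero _ = refl
    transform-ι x b (suc n) inverse = trans (transform-step x b n inverse)
      (cong (_+ ι (suc n) * binomial-transform x b (suc n)) (transform-ι x b n λ k 1≤k k≤n → inverse k 1≤k (ℕ.m≤n⇒m≤1+n k≤n)))

-- Binomial convolution and Faulhaber's formula

module BinomialConvolution (R≡ : CommutativeRing≡) where
  open BinomialSums R≡ public
  open ≡-Reasoning

  -- The sequence of the product of two exponential generating functions, defined by the Leibniz rule.
  infixl 7 _⋆_
  _⋆_ : (ℕ → A) → (ℕ → A) → ℕ → A
  (a ⋆ b) zero = a 0 * b 0
  (a ⋆ b) (suc m) = ((a ∘ suc) ⋆ b) m + (a ⋆ (b ∘ suc)) m

  ⋆-cong : ∀ {a a′ b b′} → (∀ m → a m ≡ a′ m) → (∀ m → b m ≡ b′ m) → ∀ m → (a ⋆ b) m ≡ (a′ ⋆ b′) m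
  ⋆-cong p q zero = cong₂ _*_ (p 0) (q 0)
  ⋆-cong p q (suc m) = cong₂ _+_ (⋆-cong (p ∘ suc) q m) (⋆-cong p (q ∘ suc) m)

  ⋆-comm : ∀ a b m → (a ⋆ b) m ≡ (b ⋆ a) m
  ⋆-comm a b zero = *-comm _ _
  ⋆-comm a b (suc m) = trans (cong₂ _+_ (⋆-comm (a ∘ suc) b m) (⋆-comm a (b ∘ suc) m)) (+-comm _ _)

  ⋆-distribˡ-+ : ∀ a b c m → (a ⋆ (λ i → b i + c i)) m ≡ (a ⋆ b) m + (a ⋆ c) m
  ⋆-distribˡ-+ a b c zero = distribˡ _ _ _
  ⋆-distribˡ-+ a b c (suc m) = trans (cong₂ _+_ (⋆-distribˡ-+ (a ∘ suc) b c m) (⋆-distribˡ-+ a (b ∘ suc) (c ∘ suc) m))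
    (solve 4 (λ x y z w → x :+ y :+ (z :+ w) := x :+ z :+ (y :+ w)) refl _ _ _ _)

  ⋆-distribʳ-+ : ∀ a b c m → ((λ i → a i + b i) ⋆ c) m ≡ (a ⋆ c) m + (b ⋆ c) m
  ⋆-distribʳ-+ a b c m = trans (⋆-comm _ c m) (trans (⋆-distribˡ-+ c a b m) (cong₂ _+_ (⋆-comm c a m) (⋆-comm c b m)))

  ⋆-*ˡ : ∀ x a b m → ((λ i → x * a i) ⋆ b) m ≡ x * (a ⋆ b) m
  ⋆-*ˡ x a b zero = *-assoc _ _ _
  ⋆-*ˡ x a b (suc m) = trans (cong₂ _+_ (⋆-*ˡ x (a ∘ suc) b m) (⋆-*ˡ x a (b ∘ suc) m)) (sym (distribˡ _ _ _))

  ⋆-*ʳ : ∀ x a b m → (a ⋆ (λ i → x * b i)) m ≡ x * (a ⋆ b) m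
  ⋆-*ʳ x a b m = trans (⋆-comm a _ m) (trans (⋆-*ˡ x b a m) (cong (x *_) (⋆-comm b a m)))

  -- Both sides obey the Leibniz rule for three factors, so the induction only shifts one factor at
  -- a time and no double binomial sum appears.
  ⋆-assoc : ∀ a b c m → ((a ⋆ b) ⋆ c) m ≡ (a ⋆ (b ⋆ c)) m
  ⋆-assoc a b c zero = *-assoc _ _ _
  ⋆-assoc a b c (suc m) = begin
    ((λ i → ((a ∘ suc) ⋆ b) i + (a ⋆ (b ∘ suc)) i) ⋆ c) m + ((a ⋆ b) ⋆ (c ∘ suc)) m
      ≡⟨ cong₂ _+_ (⋆-distribʳ-+ ((a ∘ suc) ⋆ b) (a ⋆ (b ∘ suc)) c m) (⋆-assoc a b (c ∘ suc) m) ⟩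
    (((a ∘ suc) ⋆ b) ⋆ c) m + ((a ⋆ (b ∘ suc)) ⋆ c) m + (a ⋆ (b ⋆ (c ∘ suc))) m
      ≡⟨ cong₂ (λ x y → x + y + (a ⋆ (b ⋆ (c ∘ suc))) m) (⋆-assoc (a ∘ suc) b c m) (⋆-assoc a (b ∘ suc) c m) ⟩
    ((a ∘ suc) ⋆ (b ⋆ c)) m + (a ⋆ ((b ∘ suc) ⋆ c)) m + (a ⋆ (b ⋆ (c ∘ suc))) m
      ≡⟨ +-assoc _ _ _ ⟩
    ((a ∘ suc) ⋆ (b ⋆ c)) m + ((a ⋆ ((b ∘ suc) ⋆ c)) m + (a ⋆ (b ⋆ (c ∘ suc))) m)
      ≡⟨ cong (((a ∘ suc) ⋆ (b ⋆ c)) m +_) (sym (⋆-distribˡ-+ a ((b ∘ suc) ⋆ c) (b ⋆ (c ∘ suc)) m)) ⟩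
    ((a ∘ suc) ⋆ (b ⋆ c)) m + (a ⋆ (λ i → ((b ∘ suc) ⋆ c) i + (b ⋆ (c ∘ suc)) i)) m ∎

  ⋆-zeroˡ : ∀ {a} b → (∀ m → a m ≡ 0#) → ∀ m → (a ⋆ b) m ≡ 0#
  ⋆-zeroˡ b a≡0 zero = trans (cong (_* b 0) (a≡0 0)) (zeroˡ _)
  ⋆-zeroˡ b a≡0 (suc m) = trans (cong₂ _+_ (⋆-zeroˡ b (a≡0 ∘ suc) m) (⋆-zeroˡ (b ∘ suc) a≡0 m)) (+-identityˡ 0#)

  ⋆-power : ∀ x y m → ((x ^_) ⋆ (y ^_)) m ≡ (x + y) ^ m
  ⋆-power x y zero = *-identityˡ 1#
  ⋆-power x y (suc m) = trans (cong₂ _+_ (⋆-*ˡ x (x ^_) (y ^_) m) (⋆-*ʳ y (x ^_) (y ^_) m))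
    (trans (sym (distribʳ _ x y)) (cong ((x + y) *_) (⋆-power x y m)))

  ⋆-expand : ∀ a b m → (a ⋆ b) m ≡ a 0 * b m + ∑ m (λ j → ⌊ m C j ⌋ * (a j * b (m ∸ j)))
  ⋆-expand a b zero = sym (+-identityʳ _)
  ⋆-expand a b (suc m) = begin
    ((a ∘ suc) ⋆ b) m + (a ⋆ (b ∘ suc)) m
      ≡⟨ cong₂ _+_ (⋆-expand (a ∘ suc) b m) (⋆-expand a (b ∘ suc) m) ⟩
    a 1 * b m + ∑ m (λ j → ⌊ m C j ⌋ * (a (suc j) * b (m ∸ j))) + (a 0 * b (suc m) + ∑ m (λ j → ⌊ m C j ⌋ * (a j * b (suc (m ∸ j)))))
      ≡⟨ solve 4 (λ x y z w → x :+ y :+ (z :+ w) := z :+ (w :+ (x :+ y))) refl _ _ _ _ ⟩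
    a 0 * b (suc m) + (∑ m (λ j → ⌊ m C j ⌋ * (a j * b (suc (m ∸ j)))) + (a 1 * b m + ∑ m (λ j → ⌊ m C j ⌋ * (a (suc j) * b (m ∸ j)))))
      ≡⟨ cong (a 0 * b (suc m) +_) (cong₂ _+_ (∑-cong m λ j _ j≤m → cong (λ k → ⌊ m C j ⌋ * (a j * b k)) (sym (ℕ.+-∸-assoc 1 j≤m))) shifted) ⟩
    a 0 * b (suc m) + (∑ m (λ j → ⌊ m C j ⌋ * t j) + ∑ (suc m) (λ j → ⌊ m C (j ∸ 1) ⌋ * t j))
      ≡⟨ cong (a 0 * b (suc m) +_) (sym (transform-pascal m t)) ⟩
    a 0 * b (suc m) + ∑ (suc m) (λ j → ⌊ suc m C j ⌋ * t j) ∎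
    where
    t : ℕ → A
    t j = a j * b (suc m ∸ j)
    shifted : a 1 * b m + ∑ m (λ j → ⌊ m C j ⌋ * (a (suc j) * b (m ∸ j))) ≡ ∑ (suc m) (λ j → ⌊ m C (j ∸ 1) ⌋ * t j)
    shifted = sym (trans (∑-first m (λ j → ⌊ m C (j ∸ 1) ⌋ * t j)) (cong (_+ ∑ m (λ j → ⌊ m C j ⌋ * t (suc j)))
        (trans (cong (_* t 1) (⌊nC0⌋ m)) (*-identityˡ _))))

  -- The sequence of the exponential generating function t.
  δ₁ : ℕ → A
  δ₁ 1 = 1#
  δ₁ _ = 0#

  ⋆-identityˡ : ∀ b m → ((0# ^_) ⋆ b) m ≡ b m
  ⋆-identityˡ b zero = *-identityˡ _
  ⋆-identityˡ b (suc m) = trans (cong₂ _+_ (⋆-zeroˡ b (λ i → zeroˡ (0# ^ i)) m) (⋆-identityˡ (b ∘ suc) m)) (+-identityˡ _)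

  δ₁-⋆ : ∀ b m → (δ₁ ⋆ b) (suc m) ≡ ⌊ suc m ⌋ * b m
  δ₁-⋆ b zero = trans (cong₂ _+_ (*-identityˡ _) (zeroˡ _)) (trans (+-identityʳ _) (sym (*-identityˡ _)))
  δ₁-⋆ b (suc m) = trans (cong₂ _+_ (trans (⋆-cong shift (λ _ → refl) (suc m)) (⋆-identityˡ b (suc m))) (δ₁-⋆ (b ∘ suc) m))
    (solve 2 (λ x y → x :+ y :* x := (# 1 :+ y) :* x) refl (b (suc m)) ⌊ suc m ⌋)
    where
    shift : ∀ i → δ₁ (suc i) ≡ 0# ^ i
    shift zero = refl
    shift (suc i) = sym (zeroˡ _)

  -- The index k = 0 is included, with 0⁰ = 1, so that the generating function is exactly the
  -- geometric sum of the e^(kt) for k < M.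
  power-sum : ℕ → ℕ → A
  power-sum zero m = 0#
  power-sum (suc M) m = power-sum M m + ⌊ M ⌋ ^ m

  -- The sequence of e^t - 1; the powers of `0#` form the unit of `_⋆_`.
  Δ : ℕ → A
  Δ m = 1# ^ m - 0# ^ m

  ⋆-Δ : ∀ a m → (a ⋆ Δ) m ≡ (a ⋆ (1# ^_)) m - a m
  ⋆-Δ a m = trans (⋆-distribˡ-+ a (1# ^_) (λ i → - (0# ^ i)) m) (cong ((a ⋆ (1# ^_)) m +_)
    (trans (⋆-cong (λ _ → refl) (λ i → solve 1 (λ x → :- x := (:- # 1) :* x) refl (0# ^ i)) m)
    (trans (⋆-*ʳ (- 1#) a (0# ^_) m) (trans (cong (- 1# *_) (trans (⋆-comm a (0# ^_) m) (⋆-identityˡ a m)))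
        (solve 1 (λ x → (:- # 1) :* x := :- x) refl (a m))))))

  power-sum-⋆-Δ : ∀ M m → (power-sum M ⋆ Δ) m ≡ ⌊ M ⌋ ^ m - 0# ^ m
  power-sum-⋆-Δ zero m = trans (⋆-zeroˡ Δ (λ _ → refl) m) (solve 1 (λ x → # 0 := x :- x) refl (0# ^ m))
  power-sum-⋆-Δ (suc M) m = begin
    ((λ i → power-sum M i + ⌊ M ⌋ ^ i) ⋆ Δ) m
      ≡⟨ ⋆-distribʳ-+ (power-sum M) (⌊ M ⌋ ^_) Δ m ⟩
    (power-sum M ⋆ Δ) m + ((⌊ M ⌋ ^_) ⋆ Δ) m
      ≡⟨ cong₂ _+_ (power-sum-⋆-Δ M m) (trans (⋆-Δ (⌊ M ⌋ ^_) m) (cong (_- ⌊ M ⌋ ^ m)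
          (trans (⋆-power ⌊ M ⌋ 1# m) (cong (_^ m) (trans (+-comm _ _) (sym (⌊suc⌋ M))))))) ⟩
    (⌊ M ⌋ ^ m - 0# ^ m) + (⌊ suc M ⌋ ^ m - ⌊ M ⌋ ^ m)
      ≡⟨ solve 3 (λ x y z → (x :- y) :+ (z :- x) := z :- y) refl _ _ _ ⟩
    ⌊ suc M ⌋ ^ m - 0# ^ m ∎

  -- With generating functions: b (eᵗ - 1) = t and u t = e^{Mt} - 1 give Σ_{k<M} e^{kt} = b u.
  faulhaber : ∀ M (b u : ℕ → A) → (∀ m → (b ⋆ Δ) m ≡ δ₁ m) → (∀ m → ⌊ suc m ⌋ * u m ≡ ⌊ M ⌋ ^ suc m) →
    ∀ m → ⌊ suc m ⌋ * power-sum M m ≡ ⌊ suc m ⌋ * (b ⋆ u) m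
  faulhaber M b u b⋆Δ u-spec m = begin
    ⌊ suc m ⌋ * power-sum M m              ≡⟨ sym (δ₁-⋆ (power-sum M) m) ⟩
    (δ₁ ⋆ power-sum M) (suc m)             ≡⟨ ⋆-cong (λ i → sym (b⋆Δ i)) (λ _ → refl) (suc m) ⟩
    ((b ⋆ Δ) ⋆ power-sum M) (suc m)        ≡⟨ ⋆-assoc b Δ (power-sum M) (suc m) ⟩
    (b ⋆ (Δ ⋆ power-sum M)) (suc m)        ≡⟨ ⋆-cong (λ _ → refl) Δ-power-sum (suc m) ⟩
    (b ⋆ (δ₁ ⋆ u)) (suc m)                 ≡⟨ sym (⋆-assoc b δ₁ u (suc m)) ⟩
    ((b ⋆ δ₁) ⋆ u) (suc m)                 ≡⟨ ⋆-cong (⋆-comm b δ₁) (λ _ → refl) (suc m) ⟩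
    ((δ₁ ⋆ b) ⋆ u) (suc m)                 ≡⟨ ⋆-assoc δ₁ b u (suc m) ⟩
    (δ₁ ⋆ (b ⋆ u)) (suc m)                 ≡⟨ δ₁-⋆ (b ⋆ u) m ⟩
    ⌊ suc m ⌋ * (b ⋆ u) m                  ∎
    where
    Δ-power-sum : ∀ i → (Δ ⋆ power-sum M) i ≡ (δ₁ ⋆ u) i
    Δ-power-sum i = trans (⋆-comm Δ _ i) (trans (power-sum-⋆-Δ M i) (sym (shifted i)))
      where
      shifted : ∀ i → (δ₁ ⋆ u) i ≡ ⌊ M ⌋ ^ i - 0# ^ i
      shifted zero = trans (zeroˡ _) (solve 0 (# 0 := # 1 :- # 1) refl)
      shifted (suc i) = trans (δ₁-⋆ u i) (trans (u-spec i) (solve 2 (λ x y → x := x :- # 0 :* y) refl _ (0# ^ i)))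

  -- Initial sums of a row of binomial coefficients as partial fractions

  initial-binomial-sum : ℕ → ℕ → A
  initial-binomial-sum N m = 1# + ∑ N (λ k → ⌊ m C k ⌋)

  -- Under Pascal's rule each C(m,k) with k < N is counted twice, and C(m,N) only once.
  initial-binomial-sum-pascal : ∀ N m → initial-binomial-sum N (suc m) + ⌊ m C N ⌋ ≡ ⌊ 2 ⌋ * initial-binomial-sum N m
  initial-binomial-sum-pascal zero m = trans (cong (1# + 0# +_) (⌊nC0⌋ m)) (solve 0 (# 1 :+ # 0 :+ # 1 := # 2 :* (# 1 :+ # 0)) refl)
  initial-binomial-sum-pascal (suc N) m = begin
    (1# + (s′ + ⌊ suc m C suc N ⌋)) + b        ≡⟨ cong (λ x → (1# + (s′ + x)) + b) (pascal m N) ⟩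
    (1# + (s′ + (a + b))) + b                  ≡⟨ solve 3 (λ s a b → (# 1 :+ (s :+ (a :+ b))) :+ b := (# 1 :+ s :+ a) :+ # 2 :* b) refl s′ a b ⟩
    (1# + s′ + a) + ⌊ 2 ⌋ * b                  ≡⟨ cong (_+ ⌊ 2 ⌋ * b) (initial-binomial-sum-pascal N m) ⟩
    ⌊ 2 ⌋ * (1# + s) + ⌊ 2 ⌋ * b               ≡⟨ solve 2 (λ s b → # 2 :* (# 1 :+ s) :+ # 2 :* b := # 2 :* (# 1 :+ (s :+ b))) refl s b ⟩
    ⌊ 2 ⌋ * (1# + (s + b))                     ∎
    where
    a = ⌊ m C N ⌋
    b = ⌊ m C suc N ⌋
    s = ∑ N (λ k → ⌊ m C k ⌋)
    s′ = ∑ N (λ k → ⌊ suc m C k ⌋)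

  -- This is half of the row 2N + 1. Two Pascal steps lead from that row to the row 2N + 3, and the
  -- symmetry C(M,N) = C(M,N+1) makes the boundary terms cancel, so nothing is divided by 2.
  initial-binomial-sum-half : ∀ N → initial-binomial-sum N (suc (N ℕ.+ N)) ≡ ⌊ 4 ⌋ ^ N
  initial-binomial-sum-half zero = +-identityʳ 1#
  initial-binomial-sum-half (suc N) = begin
    initial-binomial-sum (suc N) (suc (suc N ℕ.+ suc N))
      ≡⟨ cong (λ k → initial-binomial-sum (suc N) (suc k)) (cong suc (ℕ.+-suc N N)) ⟩
    Φ‴
      ≡⟨ solve 2 (λ x y → x := x :+ y :- y) refl Φ‴ ⌊ suc M C suc N ⌋ ⟩
    Φ‴ + ⌊ suc M C suc N ⌋ - ⌊ suc M C suc N ⌋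
      ≡⟨ cong₂ _-_ (initial-binomial-sum-pascal (suc N) (suc M)) (trans (pascal M N) (cong (_+ c) symmetric)) ⟩
    ⌊ 2 ⌋ * Φ″ - (c + c)
      ≡⟨ solve 2 (λ x c → # 2 :* x :- (c :+ c) := # 2 :* (x :+ c) :- # 4 :* c) refl Φ″ c ⟩
    ⌊ 2 ⌋ * (Φ″ + c) - ⌊ 4 ⌋ * c
      ≡⟨ cong (λ x → ⌊ 2 ⌋ * x - ⌊ 4 ⌋ * c) (initial-binomial-sum-pascal (suc N) M) ⟩
    ⌊ 2 ⌋ * (⌊ 2 ⌋ * (1# + (s + c))) - ⌊ 4 ⌋ * c
      ≡⟨ solve 2 (λ s c → # 2 :* (# 2 :* (# 1 :+ (s :+ c))) :- # 4 :* c := # 4 :* (# 1 :+ s)) refl s c ⟩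
    ⌊ 4 ⌋ * (1# + s)
      ≡⟨ cong (⌊ 4 ⌋ *_) (initial-binomial-sum-half N) ⟩
    ⌊ 4 ⌋ * ⌊ 4 ⌋ ^ N ∎
    where
    M = suc (N ℕ.+ N)
    c = ⌊ M C suc N ⌋
    s = ∑ N (λ k → ⌊ M C k ⌋)
    Φ″ = initial-binomial-sum (suc N) (suc M)
    Φ‴ = initial-binomial-sum (suc N) (suc (suc M))
    symmetric : ⌊ M C N ⌋ ≡ c
    symmetric = cong ⌊_⌋ (trans (nCk≡nC[n∸k] {N} {M} (ℕ.m≤n⇒m≤1+n (ℕ.m≤m+n N N)))
        (cong (M C_) (trans (ℕ.+-∸-assoc 1 (ℕ.m≤m+n N N)) (cong suc (ℕ.m+n∸n≡m N N)))))

  module _ (ψ : ℕ → A) where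

    -- The operator (1 - 2E)^N applied to `ψ`, where E lowers the argument by one. The recursive
    -- form is the one on which the partial fraction induction runs.
    alternating-2-transform : ℕ → ℕ → A
    alternating-2-transform zero m = ψ m
    alternating-2-transform (suc N) m = alternating-2-transform N m - ⌊ 2 ⌋ * alternating-2-transform N (m ∸ 1)

    alternating-2-transform-expand : ∀ N m → alternating-2-transform N m ≡ ψ m + ∑ N (λ i → ⌊ N C i ⌋ * ((- ⌊ 2 ⌋) ^ i * ψ (m ∸ i)))
    alternating-2-transform-expand zero m = sym (+-identityʳ _)
    alternating-2-transform-expand (suc N) m = begin
      alternating-2-transform N m - ⌊ 2 ⌋ * alternating-2-transform N (m ∸ 1)
        ≡⟨ cong₂ (λ x y → x - ⌊ 2 ⌋ * y) (alternating-2-transform-expand N m) (alternating-2-transform-expand N (m ∸ 1)) ⟩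
      (ψ m + ∑ N (λ i → ⌊ N C i ⌋ * t i)) - ⌊ 2 ⌋ * (ψ (m ∸ 1) + ∑ N (λ i → ⌊ N C i ⌋ * ((- ⌊ 2 ⌋) ^ i * ψ (m ∸ 1 ∸ i))))
        ≡⟨ solve 4 (λ a b c d → (a :+ b) :- # 2 :* (c :+ d) := a :+ (b :+ (# 1 :* ((:- # 2) :* # 1 :* c) :+ (:- # 2) :* d))) refl _ _ _ _ ⟩
      ψ m + (∑ N (λ i → ⌊ N C i ⌋ * t i) + (1# * t 1 + (- ⌊ 2 ⌋) * ∑ N (λ i → ⌊ N C i ⌋ * ((- ⌊ 2 ⌋) ^ i * ψ (m ∸ 1 ∸ i)))))
        ≡⟨ cong (λ x → ψ m + (∑ N (λ i → ⌊ N C i ⌋ * t i) + x)) (sym (trans (∑-first N (λ i → ⌊ N C (i ∸ 1) ⌋ * t i))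
            (cong₂ _+_ (cong (_* t 1) (⌊nC0⌋ N)) (trans (∑-cong N pointwise) (∑-*ˡ N (- ⌊ 2 ⌋) _))))) ⟩
      ψ m + (∑ N (λ i → ⌊ N C i ⌋ * t i) + ∑ (suc N) (λ i → ⌊ N C (i ∸ 1) ⌋ * t i))
        ≡⟨ cong (ψ m +_) (sym (transform-pascal N t)) ⟩
      ψ m + ∑ (suc N) (λ i → ⌊ suc N C i ⌋ * t i) ∎
      where
      t : ℕ → A
      t i = (- ⌊ 2 ⌋) ^ i * ψ (m ∸ i)
      pointwise : ∀ i → 1 ≤ i → i ≤ N → ⌊ N C i ⌋ * t (suc i) ≡ - ⌊ 2 ⌋ * (⌊ N C i ⌋ * ((- ⌊ 2 ⌋) ^ i * ψ (m ∸ 1 ∸ i)))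
      pointwise i _ _ = trans (cong (λ k → ⌊ N C i ⌋ * ((- ⌊ 2 ⌋) ^ suc i * ψ k)) (sym (ℕ.∸-+-assoc m 1 i)))
        (solve 4 (λ c y w t → c :* (t :* y :* w) := t :* (c :* (y :* w))) refl ⌊ N C i ⌋ ((- ⌊ 2 ⌋) ^ i) (ψ (m ∸ 1 ∸ i)) (- ⌊ 2 ⌋))

    -- Σ_{k≤N} C(m,k) = (m-N) C(m,N) Σ_i (-1)^{N-i} C(N,i) 2^i / (m-i), with ψ i standing for c / i.
    initial-binomial-sum-fractions : ∀ (c : A) (ι : ℕ → A) N m → (∀ k → 1 ≤ k → k ≤ N → ⌊ k ⌋ * ι k ≡ 1#) → N < m →
      (∀ i → m ∸ N ≤ i → i ≤ m → ⌊ i ⌋ * ψ i ≡ c) →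
      c * initial-binomial-sum N m ≡ (- 1#) ^ N * ((⌊ m ⌋ - ⌊ N ⌋) * ⌊ m C N ⌋ * alternating-2-transform N m)
    initial-binomial-sum-fractions c ι zero m inverse 0<m ψ-spec = begin
      c * (1# + 0#)                                   ≡⟨ cong (_* (1# + 0#)) (sym (ψ-spec m ℕ.≤-refl ℕ.≤-refl)) ⟩
      ⌊ m ⌋ * ψ m * (1# + 0#)                         ≡⟨ solve 2 (λ m x → m :* x :* (# 1 :+ # 0) := # 1 :* ((m :- # 0) :* # 1 :* x)) refl ⌊
          m ⌋ (ψ m) ⟩
      1# * ((⌊ m ⌋ - 0#) * 1# * ψ m)                  ≡⟨ cong (λ x → 1# * ((⌊ m ⌋ - 0#) * x * ψ m)) (sym (⌊nC0⌋ m)) ⟩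
      1# * ((⌊ m ⌋ - 0#) * ⌊ m C 0 ⌋ * ψ m)           ∎
    initial-binomial-sum-fractions c ι (suc N) (suc m) inverse (s≤s N<m) ψ-spec = begin
      c * (1# + (∑ N (λ k → ⌊ suc m C k ⌋) + e))
        ≡⟨ solve 3 (λ c s e → c :* (# 1 :+ (s :+ e)) := # 1 :* (c :* (# 1 :+ s) :+ c :* e)) refl c (∑ N (λ k → ⌊ suc m C k ⌋)) e ⟩
      1# * (c * Φ′ + c * e)
        ≡⟨ cong (_* (c * Φ′ + c * e)) (sym (inverse (suc N) (s≤s z≤n) ℕ.≤-refl)) ⟩
      ⌊ suc N ⌋ * i * (c * Φ′ + c * e)
        ≡⟨ solve 5 (λ n i c x e → n :* i :* (c :* x :+ c :* e) := i :* (n :* (c :* x) :+ c :* (n :* e))) refl ⌊ suc N ⌋ i c Φ′ e ⟩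
      i * (⌊ suc N ⌋ * (c * Φ′) + c * (⌊ suc N ⌋ * e))
        ≡⟨ cong (λ x → i * (⌊ suc N ⌋ * (c * Φ′) + c * x)) (absorb m N) ⟩
      i * (⌊ suc N ⌋ * (c * Φ′) + c * (⌊ suc m ⌋ * d))
        ≡⟨ solve 6 (λ i n c x m d → i :* (n :* (c :* x) :+ c :* (m :* d)) := i :* (m :* (c :* (x :+ d)) :- (m :- n) :* (c :* x))) refl i ⌊
            suc N ⌋ c Φ′ ⌊ suc m ⌋ d ⟩
      i * (⌊ suc m ⌋ * (c * (Φ′ + d)) - (⌊ suc m ⌋ - ⌊ suc N ⌋) * (c * Φ′))
        ≡⟨ cong (λ x → i * (⌊ suc m ⌋ * (c * x) - (⌊ suc m ⌋ - ⌊ suc N ⌋) * (c * Φ′))) (initial-binomial-sum-pascal N m) ⟩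
      i * (⌊ suc m ⌋ * (c * (⌊ 2 ⌋ * Φ)) - (⌊ suc m ⌋ - ⌊ suc N ⌋) * (c * Φ′))
        ≡⟨ cong₂ (λ x y → i * (x - (⌊ suc m ⌋ - ⌊ suc N ⌋) * y)) (solve 3
            (λ m c x → m :* (c :* (# 2 :* x)) := m :* (# 2 :* (c :* x))) refl ⌊ suc m ⌋ c Φ) ih′ ⟩
      i * (⌊ suc m ⌋ * (⌊ 2 ⌋ * (c * Φ)) - (⌊ suc m ⌋ - ⌊ suc N ⌋) * (σ * ((⌊ suc m ⌋ - ⌊ N ⌋) * ⌊ suc m C N ⌋ * J′)))
        ≡⟨ cong₂ (λ x y → i * (⌊ suc m ⌋ * (⌊ 2 ⌋ * x) - (⌊ suc m ⌋ - ⌊ suc N ⌋) * (σ * (y * J′)))) ih (sym (next-binomial (suc m) N)) ⟩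
      i * (⌊ suc m ⌋ * (⌊ 2 ⌋ * (σ * ((⌊ m ⌋ - ⌊ N ⌋) * d * J))) - (⌊ suc m ⌋ - ⌊ suc N ⌋) * (σ * (⌊ suc N ⌋ * e * J′)))
        ≡⟨ cong (λ x → i * (x - (⌊ suc m ⌋ - ⌊ suc N ⌋) * (σ * (⌊ suc N ⌋ * e * J′))))
            (solve 5 (λ m s δ d j → m :* (# 2 :* (s :* (δ :* d :* j))) := # 2 :* (s :* (δ :* (m :* d) :* j))) refl ⌊ suc m ⌋ σ (⌊ m ⌋ - ⌊ N ⌋) d J) ⟩
      i * (⌊ 2 ⌋ * (σ * ((⌊ m ⌋ - ⌊ N ⌋) * (⌊ suc m ⌋ * d) * J)) - (⌊ suc m ⌋ - ⌊ suc N ⌋) * (σ * (⌊ suc N ⌋ * e * J′)))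
        ≡⟨ cong₂ (λ x y → i * (⌊ 2 ⌋ * (σ * (x * y * J)) - (⌊ suc m ⌋ - ⌊ suc N ⌋) * (σ * (⌊ suc N ⌋ * e * J′)))) difference (sym (absorb m N)) ⟩
      i * (⌊ 2 ⌋ * (σ * ((⌊ suc m ⌋ - ⌊ suc N ⌋) * (⌊ suc N ⌋ * e) * J)) - (⌊ suc m ⌋ - ⌊ suc N ⌋) * (σ * (⌊ suc N ⌋ * e * J′)))
        ≡⟨ solve 7 (λ i s δ n e j j′ → i :* (# 2 :* (s :* (δ :* (n :* e) :* j)) :- δ :* (s :* (n :* e :* j′)))
            := n :* i :* ((:- # 1) :* s :* (δ :* e :* (j′ :- # 2 :* j)))) refl i σ (⌊ suc m ⌋ - ⌊ suc N ⌋) ⌊ suc N ⌋ e J J′ ⟩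
      ⌊ suc N ⌋ * i * ((- 1#) * σ * ((⌊ suc m ⌋ - ⌊ suc N ⌋) * e * (J′ - ⌊ 2 ⌋ * J)))
        ≡⟨ trans (cong (_* ((- 1#) * σ * ((⌊ suc m ⌋ - ⌊ suc N ⌋) * e * (J′ - ⌊ 2 ⌋ * J)))) (inverse (suc N) (s≤s z≤n) ℕ.≤-refl)) (*-identityˡ _) ⟩
      (- 1#) * σ * ((⌊ suc m ⌋ - ⌊ suc N ⌋) * e * (J′ - ⌊ 2 ⌋ * J)) ∎
      where
      i = ι (suc N)
      e = ⌊ suc m C suc N ⌋
      d = ⌊ m C N ⌋
      σ = (- 1#) ^ N
      J = alternating-2-transform N m
      J′ = alternating-2-transform N (suc m)
      Φ = initial-binomial-sum N m
      Φ′ = initial-binomial-sum N (suc m)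
      inverse′ : ∀ k → 1 ≤ k → k ≤ N → ⌊ k ⌋ * ι k ≡ 1#
      inverse′ k 1≤k k≤N = inverse k 1≤k (ℕ.m≤n⇒m≤1+n k≤N)
      ih : c * Φ ≡ σ * ((⌊ m ⌋ - ⌊ N ⌋) * d * J)
      ih = initial-binomial-sum-fractions c ι N m inverse′ N<m (λ j lo hi → ψ-spec j lo (ℕ.m≤n⇒m≤1+n hi))
      ih′ : c * Φ′ ≡ σ * ((⌊ suc m ⌋ - ⌊ N ⌋) * ⌊ suc m C N ⌋ * J′)
      ih′ = initial-binomial-sum-fractions c ι N (suc m) inverse′ (ℕ.m≤n⇒m≤1+n N<m)
          (λ j lo hi → ψ-spec j (ℕ.≤-trans (ℕ.∸-monoʳ-≤ (suc m) (ℕ.n≤1+n N)) lo) hi)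
      difference : ⌊ m ⌋ - ⌊ N ⌋ ≡ ⌊ suc m ⌋ - ⌊ suc N ⌋
      difference = sym (trans (cong₂ _-_ (⌊suc⌋ m) (⌊suc⌋ N)) (solve 2 (λ a b → (# 1 :+ a) :- (# 1 :+ b) := a :- b) refl ⌊ m ⌋ ⌊ N ⌋))

-- Congruences modulo powers of an element

module Congruences (R≡ : CommutativeRing≡) (P : CommutativeRing≡.Carrier R≡) where
  open BinomialConvolution R≡ public

  infix 4 _≈[_]_
  -- The quotient is data and not mere existence: the cofactor of p³ in C(2p-1,p-1) and the
  -- Bernoulli numbers themselves are later read off as such quotients.
  record _≈[_]_ (a : A) (k : ℕ) (b : A) : Set where
    constructor _by_
    field
      quotient : A
      equation : a ≡ b + P ^ k * quotient
  open _≈[_]_ public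

  module _ {k : ℕ} where

    ≈-reflexive : ∀ {a b} → a ≡ b → a ≈[ k ] b
    ≈-reflexive {b = b} eq = 0# by trans eq (solve 2 (λ b p → b := b :+ p :* # 0) refl b (P ^ k))

    ≈-refl : ∀ {a} → a ≈[ k ] a
    ≈-refl = ≈-reflexive refl

    ≈-sym : ∀ {a b} → a ≈[ k ] b → b ≈[ k ] a
    ≈-sym {a} {b} (c by eq) = (- c) by trans (solve 3 (λ b p c → b := (b :+ p :* c) :+ p :* :- c) refl b (P ^ k) c) (cong (_+ P ^ k * - c) (sym eq))

    ≈-trans : ∀ {a b c} → a ≈[ k ] b → b ≈[ k ] c → a ≈[ k ] c
    ≈-trans {c = c} (x by eq) (y by eq′) = (x + y) by trans eq (trans (cong (_+ P ^ k * x) eq′)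
      (solve 4 (λ c p x y → (c :+ p :* y) :+ p :* x := c :+ p :* (x :+ y)) refl c (P ^ k) x y))

    ≈-+ : ∀ {a b c d} → a ≈[ k ] b → c ≈[ k ] d → a + c ≈[ k ] b + d
    ≈-+ {b = b} {d = d} (x by eq) (y by eq′) = (x + y) by trans (cong₂ _+_ eq eq′)
      (solve 5 (λ b d p x y → (b :+ p :* x) :+ (d :+ p :* y) := b :+ d :+ p :* (x :+ y)) refl b d (P ^ k) x y)

    ≈-* : ∀ {a b c d} → a ≈[ k ] b → c ≈[ k ] d → a * c ≈[ k ] b * d
    ≈-* {b = b} {d = d} (x by eq) (y by eq′) = (x * d + b * y + P ^ k * x * y) by trans (cong₂ _*_ eq eq′)
      (solve 5 (λ b d p x y → (b :+ p :* x) :* (d :+ p :* y) := b :* d :+ p :* (x :* d :+ b :* y :+ p :* x :* y)) refl b d (P ^ k) x y)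

    ≈-*ˡ : ∀ c {a b} → a ≈[ k ] b → c * a ≈[ k ] c * b
    ≈-*ˡ c = ≈-* (≈-refl {c})

    ≈-neg : ∀ {a b} → a ≈[ k ] b → - a ≈[ k ] - b
    ≈-neg {b = b} (x by eq) = (- x) by trans (cong -_ eq) (solve 3 (λ b p x → :- (b :+ p :* x) := :- b :+ p :* :- x) refl b (P ^ k) x)

    ≈-minus : ∀ {a b c d} → a ≈[ k ] b → c ≈[ k ] d → a - c ≈[ k ] b - d
    ≈-minus h h′ = ≈-+ h (≈-neg h′)

    ≈-^ : ∀ {a b} → a ≈[ k ] b → ∀ n → a ^ n ≈[ k ] b ^ n
    ≈-^ h zero = ≈-refl
    ≈-^ h (suc n) = ≈-* h (≈-^ h n)

    ≈-∑ : ∀ n {f g : ℕ → A} → (∀ i → 1 ≤ i → i ≤ n → f i ≈[ k ] g i) → ∑ n f ≈[ k ] ∑ n g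
    ≈-∑ zero h = ≈-refl
    ≈-∑ (suc n) h = ≈-+ (≈-∑ n λ i 1≤i i≤n → h i 1≤i (ℕ.m≤n⇒m≤1+n i≤n)) (h (suc n) (s≤s z≤n) ℕ.≤-refl)

    ≈-drop : ∀ {a b} → a ≈[ suc k ] b → a ≈[ k ] b
    ≈-drop {b = b} (x by eq) = (P * x) by trans eq (solve 4 (λ b q p x → b :+ q :* p :* x := b :+ p :* (q :* x)) refl b P (P ^ k) x)

    ≈-setoid : Setoid 0ℓ 0ℓ
    ≈-setoid = record { Carrier = A ; _≈_ = _≈[ k ]_ ; isEquivalence = record { refl = ≈-refl ; sym = ≈-sym ; trans = ≈-trans } }

    difference : ∀ {a b} → a ≈[ k ] b → a - b ≈[ k ] 0#
    difference {a} {b} (x by eq) = x by trans (cong (_- b) eq) (solve 3 (λ b p x → (b :+ p :* x) :- b := # 0 :+ p :* x) refl b (P ^ k) x)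

    -- The standard form of a proof below: `x` is a linear combination of quantities known to
    -- vanish, and the equation is a polynomial identity left to the solver.
    combine : ∀ {a b x} → x ≈[ k ] 0# → a - b ≡ x → a ≈[ k ] b
    combine {a} {b} {x} (c by eq) eq′ = c by trans (solve 2 (λ a b → a := b :+ (a :- b)) refl a b)
        (cong (b +_) (trans eq′ (trans eq (+-identityˡ _))))

    null-+ : ∀ {x y} → x ≈[ k ] 0# → y ≈[ k ] 0# → x + y ≈[ k ] 0#
    null-+ h h′ = ≈-trans (≈-+ h h′) (≈-reflexive (+-identityˡ 0#))

    null-* : ∀ c {x} → x ≈[ k ] 0# → c * x ≈[ k ] 0#
    null-* c h = ≈-trans (≈-*ˡ c h) (≈-reflexive (zeroʳ c))

    null-*ʳ : ∀ {x} c → x ≈[ k ] 0# → x * c ≈[ k ] 0#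
    null-*ʳ {x} c h = ≈-trans (≈-reflexive (*-comm x c)) (null-* c h)

    null-∑ : ∀ n {f : ℕ → A} → (∀ i → 1 ≤ i → i ≤ n → f i ≈[ k ] 0#) → ∑ n f ≈[ k ] 0#
    null-∑ n h = ≈-trans (≈-∑ n h) (≈-reflexive (∑-zero n λ _ _ _ → refl))

    multiple : ∀ w → P ^ k * w ≈[ k ] 0#
    multiple w = w by sym (+-identityˡ _)

    null-P : ∀ j {x} → x ≈[ k ] 0# → P ^ j * x ≈[ j ℕ.+ k ] 0#
    null-P j {x} (c by eq) = c by trans (cong (P ^ j *_) (trans eq (+-identityˡ _)))
        (trans (sym (*-assoc _ _ _)) (trans (cong (_* c) (sym (^-homo-* P j k))) (sym (+-identityˡ _))))

    cancel-unit : ∀ {u c x} → u * c ≡ 1# → c * x ≈[ k ] 0# → x ≈[ k ] 0#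
    cancel-unit {u} {c} {x} u*c h = ≈-trans (≈-reflexive (trans (sym (*-identityˡ x)) (trans (cong (_* x) (sym u*c)) (*-assoc u c x)))) (null-* u h)

    -- `P` is a nonzerodivisor, so one factor at a time can be removed from the equation behind the
    -- congruence; the modulus drops accordingly.
    cancel-P : (∀ {x} → P * x ≡ 0# → x ≡ 0#) → ∀ j {x} → P ^ j * x ≈[ j ℕ.+ k ] 0# → x ≈[ k ] 0#
    cancel-P regular zero {x} h = ≈-trans (≈-reflexive (sym (*-identityˡ x))) h
    cancel-P regular (suc j) {x} (c by eq) = cancel-P regular j (c by trans
      (solve 2 (λ a b → a := b :+ (a :- b)) refl (P ^ j * x) (P ^ (j ℕ.+ k) * c))
      (trans (cong (P ^ (j ℕ.+ k) * c +_) (regular (trans (solve 5 (λ q a x b c → q :* (a :* x :- b :* c) := q :* a :* x :- q :* b :* c)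
          refl P (P ^ j) x (P ^ (j ℕ.+ k)) c)
        (trans (cong (_- P * P ^ (j ℕ.+ k) * c) eq) (solve 1 (λ y → (# 0 :+ y) :- y := # 0) refl (P * P ^ (j ℕ.+ k) * c)))))) (+-comm _ _)))

-- The part of the structure of ℤ localised at p that the argument uses.
record LocalRing (p : ℕ) : Set₁ where
  field
    ring : CommutativeRing≡
  open RingTheory ring
  field
    ι : ℕ → A
    ι-inverse : ∀ k → ¬ p ∣ k → ⌊ k ⌋ * ι k ≡ 1#
    regular : ∀ {x} → ⌊ p ⌋ * x ≡ 0# → x ≡ 0#

3≤half : ∀ n → 5 < suc (n ℕ.+ n) → 3 ≤ n
3≤half 0 (s≤s ())
3≤half 1 (s≤s (s≤s (s≤s ())))
3≤half 2 (s≤s (s≤s (s≤s (s≤s (s≤s ())))))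
3≤half (suc (suc (suc n))) _ = s≤s (s≤s (s≤s z≤n))

-- Harmonic power sums modulo powers of p

module HarmonicSums (n : ℕ) (p-prime : Prime (suc (n ℕ.+ n))) (5<p : 5 < suc (n ℕ.+ n)) (L : LocalRing (suc (n ℕ.+ n))) where

  N = n ℕ.+ n
  p = suc N

  open LocalRing L public
  open Congruences ring (RingTheory.⌊_⌋ ring p) public
  open ≡-Reasoning

  P : A
  P = ⌊ p ⌋

  p∤ : ∀ k → 1 ≤ k → k ≤ N → ¬ p ∣ k
  p∤ (suc k) _ k≤N = >⇒∤ (s≤s k≤N)

  p∤2 : ¬ p ∣ 2
  p∤2 = p∤ 2 (s≤s z≤n) (ℕ.≤-trans (s≤s (s≤s z≤n)) (ℕ.≤-pred 5<p))

  p∤3 : ¬ p ∣ 3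
  p∤3 = p∤ 3 (s≤s z≤n) (ℕ.≤-trans (s≤s (s≤s (s≤s z≤n))) (ℕ.≤-pred 5<p))

  p∤5 : ¬ p ∣ 5
  p∤5 = p∤ 5 (s≤s z≤n) (ℕ.≤-pred 5<p)

  p∤* : ∀ {a b} → ¬ p ∣ a → ¬ p ∣ b → ¬ p ∣ a ℕ.* b
  p∤* {a} {b} p∤a p∤b p∣ab with euclidsLemma a b p-prime p∣ab
  ... | inj₁ p∣a = p∤a p∣a
  ... | inj₂ p∣b = p∤b p∣b

  p∤4 : ¬ p ∣ 4
  p∤4 = p∤* {2} {2} p∤2 p∤2

  p∤8 : ¬ p ∣ 8
  p∤8 = p∤* {2} {4} p∤2 p∤4

  p∤6 : ¬ p ∣ 6
  p∤6 = p∤* {2} {3} p∤2 p∤3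

  p∤24 : ¬ p ∣ 24
  p∤24 = p∤* {4} {6} p∤4 p∤6

  n≤N : n ≤ N
  n≤N = ℕ.m≤m+n n n

  ι-inverse′ : ∀ k → 1 ≤ k → k ≤ N → ⌊ k ⌋ * ι k ≡ 1#
  ι-inverse′ k 1≤k k≤N = ι-inverse k (p∤ k 1≤k k≤N)

  cancel : ∀ c {k x} → ¬ p ∣ c → ⌊ c ⌋ * x ≈[ k ] 0# → x ≈[ k ] 0#
  cancel c p∤c = cancel-unit {u = ι c} (trans (*-comm _ _) (ι-inverse c p∤c))

  unique-inverse : ∀ {a x y} → a * x ≡ 1# → a * y ≡ 1# → x ≡ y
  unique-inverse {a} {x} {y} ax ay = begin
    x             ≡⟨ sym (*-identityʳ x) ⟩
    x * 1#        ≡⟨ cong (x *_) (sym ay) ⟩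
    x * (a * y)   ≡⟨ solve 3 (λ x a y → x :* (a :* y) := a :* x :* y) refl x a y ⟩
    a * x * y     ≡⟨ cong (_* y) ax ⟩
    1# * y        ≡⟨ *-identityˡ y ⟩
    y             ∎

  ½ : A
  ½ = ι 2

  2*½ : ⌊ 2 ⌋ * ½ ≡ 1#
  2*½ = ι-inverse 2 p∤2

  double≤ : ∀ {j} → j ≤ n → j ℕ.+ j ≤ N
  double≤ j≤n = ℕ.+-mono-≤ j≤n j≤n

  1≤double : ∀ {j} → 1 ≤ j → 1 ≤ j ℕ.+ j
  1≤double {j} 1≤j = ℕ.≤-trans 1≤j (ℕ.m≤m+n j j)

  ι-double : ∀ j → 1 ≤ j → j ≤ n → ι (j ℕ.+ j) ≡ ½ * ι j
  ι-double j 1≤j j≤n = unique-inverse (ι-inverse′ (j ℕ.+ j) (1≤double 1≤j) (double≤ j≤n)) (begin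
    ⌊ j ℕ.+ j ⌋ * (½ * ι j)            ≡⟨ cong (_* (½ * ι j)) (⌊+⌋ j j) ⟩
    (⌊ j ⌋ + ⌊ j ⌋) * (½ * ι j)        ≡⟨ solve 3 (λ a h u → (a :+ a) :* (h :* u) := # 2 :* h :* (a :* u)) refl ⌊ j ⌋ ½ (ι j) ⟩
    ⌊ 2 ⌋ * ½ * (⌊ j ⌋ * ι j)          ≡⟨ cong₂ _*_ 2*½ (ι-inverse′ j 1≤j (ℕ.≤-trans j≤n n≤N)) ⟩
    1# * 1#                            ≡⟨ *-identityˡ 1# ⟩
    1#                                 ∎)

  ⌊∸⌋ : ∀ m k → k ≤ m → ⌊ m ∸ k ⌋ ≡ ⌊ m ⌋ - ⌊ k ⌋
  ⌊∸⌋ m k k≤m = trans (solve 2 (λ a b → a := (a :+ b) :- b) refl ⌊ m ∸ k ⌋ ⌊ k ⌋)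
      (cong (_- ⌊ k ⌋) (trans (sym (⌊+⌋ (m ∸ k) k)) (cong ⌊_⌋ (ℕ.m∸n+n≡m k≤m))))

  1≤p∸ : ∀ {k} → k ≤ N → 1 ≤ p ∸ k
  1≤p∸ k≤N = ℕ.m<n⇒0<n∸m (s≤s k≤N)

  p∸≤ : ∀ {k} → 1 ≤ k → p ∸ k ≤ N
  p∸≤ {suc k} _ = ℕ.m∸n≤m N k

  -- One step of the geometric series 1/(c-a) = -1/a + (c/a) · 1/(c-a), with exact remainder. It
  -- serves for c = p and c = 2p.
  reflected-inverse : ∀ {a c u v} → a * u ≡ 1# → (c - a) * v ≡ 1# → v ≡ - u + c * (u * v)
  reflected-inverse {a} {c} {u} {v} au cv = begin
    v                             ≡⟨ sym (*-identityˡ v) ⟩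
    1# * v                        ≡⟨ cong (_* v) (sym au) ⟩
    a * u * v                     ≡⟨ solve 4 (λ a c u v → a :* u :* v := :- (u :* ((c :- a) :* v)) :+ c :* (u :* v)) refl a c u v ⟩
    - (u * ((c - a) * v)) + c * (u * v)   ≡⟨ cong (λ x → - (u * x) + c * (u * v)) cv ⟩
    - (u * 1#) + c * (u * v)      ≡⟨ cong (λ x → - x + c * (u * v)) (*-identityʳ u) ⟩
    - u + c * (u * v)             ∎

  reflected-inverse-expand : ∀ {c u v} → v ≡ - u + c * (u * v) → v ≡ - (u + c * u ^ 2 + c ^ 2 * u ^ 3 + c ^ 3 * u ^ 4) + c ^ 4 * (u ^ 4 * v)
  reflected-inverse-expand {c} {u} {v} eq = trans (step (step (step eq))) (solve 3 (λ c u v →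
      :- u :+ c :* (u :* (:- u :+ c :* (u :* (:- u :+ c :* (u :* (:- u :+ c :* (u :* v)))))))
      := :- (u :+ c :* u :^ 2 :+ c :^ 2 :* u :^ 3 :+ c :^ 3 :* u :^ 4) :+ c :^ 4 :* (u :^ 4 :* v)) refl c u v)
    where
    step : ∀ {w} → v ≡ w → v ≡ - u + c * (u * w)
    step eq′ = trans eq (cong (λ x → - u + c * (u * x)) eq′)

  module _ (k : ℕ) (1≤k : 1 ≤ k) (k≤N : k ≤ N) where
    private
      u v : A
      u = ι k
      v = ι (p ∸ k)
      eq : v ≡ - u + P * (u * v)
      eq = reflected-inverse (ι-inverse′ k 1≤k k≤N) (trans (cong (_* v) (sym (⌊∸⌋ p k (ℕ.m≤n⇒m≤1+n k≤N)))) (ι-inverse′ (p ∸ k) (1≤p∸ k≤N) (p∸≤ 1≤k)))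

    ι-reflect : ι (p ∸ k) ≈[ 1 ] - ι k
    ι-reflect = (u * v) by trans eq (cong (λ x → - u + x * (u * v)) (sym (*-identityʳ P)))

    ι-reflect₃ : ι (p ∸ k) ≈[ 3 ] - (ι k + P * ι k ^ 2 + P ^ 2 * ι k ^ 3)
    ι-reflect₃ = (- u ^ 4 + P * (u ^ 4 * v)) by trans (reflected-inverse-expand eq) (solve 3 (λ c u v →
      :- (u :+ c :* u :^ 2 :+ c :^ 2 :* u :^ 3 :+ c :^ 3 :* u :^ 4) :+ c :^ 4 :* (u :^ 4 :* v)
          := :- (u :+ c :* u :^ 2 :+ c :^ 2 :* u :^ 3) :+ c :^ 3 :* (:- u :^ 4 :+ c :* (u :^ 4 :* v))) refl P u v)

    ι²-reflect : ι (p ∸ k) ^ 2 ≈[ 3 ] ι k ^ 2 + ⌊ 2 ⌋ * P * ι k ^ 3 + ⌊ 3 ⌋ * P ^ 2 * ι k ^ 4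
    ι²-reflect = ≈-trans (≈-^ ι-reflect₃ 2) ((P * u ^ 6 + ⌊ 2 ⌋ * u ^ 5) by
      solve 2 (λ P u → (:- (u :+ P :* u :^ 2 :+ P :^ 2 :* u :^ 3)) :^ 2
          := u :^ 2 :+ # 2 :* P :* u :^ 3 :+ # 3 :* P :^ 2 :* u :^ 4 :+ P :^ 3 :* (P :* u :^ 6 :+ # 2 :* u :^ 5)) refl P u)

    ι³-reflect : ι (p ∸ k) ^ 3 ≈[ 2 ] - (ι k ^ 3 + ⌊ 3 ⌋ * P * ι k ^ 4)
    ι³-reflect = ≈-trans (≈-^ (≈-drop ι-reflect₃) 3) (_ by
      solve 2 (λ P u → (:- (u :+ P :* u :^ 2 :+ P :^ 2 :* u :^ 3)) :^ 3
          := :- (u :^ 3 :+ # 3 :* P :* u :^ 4) :+ P :^ 2 :* ((:- # 7) :* P :* u :^ 6 :- # 6 :* P :^ 2 :* u :^ 7 :- # 3 :* P :^ 3 :* u :^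
          8 :- P :^ 4 :* u :^ 9 :- # 6 :* u :^ 5)) refl P u)

    ι⁴-reflect : ι (p ∸ k) ^ 4 ≈[ 1 ] ι k ^ 4
    ι⁴-reflect = ≈-trans (≈-^ ι-reflect 4) (≈-reflexive (solve 1 (λ u → (:- u) :^ 4 := u :^ 4) refl u))

  H : ℕ → ℕ → A
  H a m = ∑ m (λ k → ι k ^ a)

  S h : ℕ → A
  S a = H a N
  h a = H a n

  N∸n : N ∸ n ≡ n
  N∸n = ℕ.m+n∸n≡m n n

  ∑-fold : ∀ f → ∑ N f ≡ ∑ n f + ∑ n (λ j → f (p ∸ j))
  ∑-fold f = trans (∑-upper N n f n≤N) (cong (λ m → ∑ m f + ∑ n (λ j → f (p ∸ j))) N∸n)

  ∑-linear₂ : ∀ m a b f g → ∑ m (λ k → a * f k + b * g k) ≡ a * ∑ m f + b * ∑ m g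
  ∑-linear₂ m a b f g = trans (∑-+ m _ _) (cong₂ _+_ (∑-*ˡ m a f) (∑-*ˡ m b g))

  ∑-linear₃ : ∀ m a b c f g e → ∑ m (λ k → a * f k + b * g k + c * e k) ≡ a * ∑ m f + b * ∑ m g + c * ∑ m e
  ∑-linear₃ m a b c f g e = trans (∑-+ m _ _) (cong₂ _+_ (∑-linear₂ m a b f g) (∑-*ˡ m c e))

  H-double : ∀ a → ∑ n (λ j → ι (j ℕ.+ j) ^ a) ≡ ½ ^ a * h a
  H-double a = trans (∑-cong n λ j 1≤j j≤n → trans (cong (_^ a) (ι-double j 1≤j j≤n)) (^-distrib-* ½ (ι j) a)) (∑-*ˡ n (½ ^ a) _)

  scale-½ : ∀ c a b {x} → ⌊ c ⌋ ≡ ⌊ b ⌋ * ⌊ 2 ⌋ ^ a → ⌊ c ⌋ * (½ ^ a * x) ≡ ⌊ b ⌋ * x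
  scale-½ c a b {x} eq = begin
    ⌊ c ⌋ * (½ ^ a * x)                 ≡⟨ cong (_* (½ ^ a * x)) eq ⟩
    ⌊ b ⌋ * ⌊ 2 ⌋ ^ a * (½ ^ a * x)     ≡⟨ solve 4 (λ b t h x → b :* t :* (h :* x) := b :* ((t :* h) :* x)) refl ⌊ b ⌋ (⌊ 2 ⌋ ^ a) (½ ^ a) x ⟩
    ⌊ b ⌋ * (⌊ 2 ⌋ ^ a * ½ ^ a * x)     ≡⟨ cong (λ y → ⌊ b ⌋ * (y * x)) (trans (sym (^-distrib-* ⌊ 2 ⌋ ½ a)) (trans (cong (_^ a) 2*½) (1^ a))) ⟩
    ⌊ b ⌋ * (1# * x)                    ≡⟨ cong (⌊ b ⌋ *_) (*-identityˡ x) ⟩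
    ⌊ b ⌋ * x                           ∎

  S₄-fold : S 4 ≈[ 1 ] h 4 + h 4
  S₄-fold = ≈-trans (≈-reflexive (∑-fold _)) (≈-+ ≈-refl (≈-∑ n λ j 1≤j j≤n → ι⁴-reflect j 1≤j (ℕ.≤-trans j≤n n≤N)))

  S₄-even-odd : ⌊ 16 ⌋ * S 4 ≈[ 1 ] ⌊ 2 ⌋ * h 4
  S₄-even-odd = ≈-trans (≈-*ˡ ⌊ 16 ⌋ (≈-trans (≈-reflexive (∑-even-odd n _))
      (≈-+ ≈-refl (≈-∑ n λ j 1≤j j≤n → ι⁴-reflect (j ℕ.+ j) (1≤double 1≤j) (double≤ j≤n)))))
    (≈-reflexive (trans (cong₂ (λ x y → ⌊ 16 ⌋ * (x + y)) (H-double 4) (H-double 4))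
        (trans (distribˡ _ _ _) (trans (cong (λ x → x + x) (scale-½ 16 4 1 (solve 0 (# 16 := # 1 :* # 2 :^ 4) refl)))
        (solve 1 (λ x → # 1 :* x :+ # 1 :* x := # 2 :* x) refl (h 4))))))

  -- Folding at p/2 gives S_4 ≡ 2 h_4, the even and odd terms give 16 S_4 ≡ 2 h_4. Hence 30 h_4 ≡ 0,
  -- and 30 is a unit since p > 5.
  h₄-null : h 4 ≈[ 1 ] 0#
  h₄-null = cancel 30 (p∤* {5} {6} p∤5 p∤6) (combine (null-+ (null-* (- ⌊ 16 ⌋) (difference S₄-fold)) (difference S₄-even-odd))
    (solve 2 (λ s h → # 30 :* h :- # 0 := (:- # 16) :* (s :- (h :+ h)) :+ (# 16 :* s :- # 2 :* h)) refl (S 4) (h 4)))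

  S₄-null : S 4 ≈[ 1 ] 0#
  S₄-null = ≈-trans S₄-fold (null-+ h₄-null h₄-null)

  T : A
  T = h 3

  S₂-fold : S 2 ≈[ 3 ] ⌊ 2 ⌋ * h 2 + ⌊ 2 ⌋ * P * T + ⌊ 3 ⌋ * P ^ 2 * h 4
  S₂-fold = ≈-trans (≈-reflexive (∑-fold _)) (≈-trans (≈-+ ≈-refl (≈-∑ n λ j 1≤j j≤n → ι²-reflect j 1≤j (ℕ.≤-trans j≤n n≤N)))
    (≈-reflexive (trans (cong (h 2 +_) (trans (∑-cong n λ j _ _ → cong (λ x → x + ⌊ 2 ⌋ * P * ι j ^ 3 + ⌊ 3 ⌋ * P ^ 2 * ι j ^ 4)
        (sym (*-identityˡ _))) (∑-linear₃ n 1# (⌊ 2 ⌋ * P) (⌊ 3 ⌋ * P ^ 2) _ _ _)))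
      (solve 4 (λ a b c P → a :+ (# 1 :* a :+ # 2 :* P :* b :+ # 3 :* P :^ 2 :* c) := # 2 :* a :+ # 2 :* P :* b :+ # 3 :* P :^ 2 :* c) refl
          (h 2) (h 3) (h 4) P))))

  S₂-even-odd : ⌊ 16 ⌋ * S 2 ≈[ 3 ] ⌊ 8 ⌋ * h 2 + ⌊ 4 ⌋ * P * T + ⌊ 3 ⌋ * P ^ 2 * h 4
  S₂-even-odd = ≈-trans (≈-*ˡ ⌊ 16 ⌋ (≈-trans (≈-reflexive (∑-even-odd n _))
      (≈-+ ≈-refl (≈-∑ n λ j 1≤j j≤n → ι²-reflect (j ℕ.+ j) (1≤double 1≤j) (double≤ j≤n)))))
    (≈-reflexive (begin
      ⌊ 16 ⌋ * (E 2 + ∑ n (λ j → ι (j ℕ.+ j) ^ 2 + ⌊ 2 ⌋ * P * ι (j ℕ.+ j) ^ 3 + ⌊ 3 ⌋ * P ^ 2 * ι (j ℕ.+ j) ^ 4))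
        ≡⟨ cong (λ x → ⌊ 16 ⌋ * (E 2 + x)) (trans (∑-cong n λ j _ _ → cong
            (λ x → x + ⌊ 2 ⌋ * P * ι (j ℕ.+ j) ^ 3 + ⌊ 3 ⌋ * P ^ 2 * ι (j ℕ.+ j) ^ 4) (sym (*-identityˡ _)))
            (∑-linear₃ n 1# (⌊ 2 ⌋ * P) (⌊ 3 ⌋ * P ^ 2) _ _ _)) ⟩
      ⌊ 16 ⌋ * (E 2 + (1# * E 2 + ⌊ 2 ⌋ * P * E 3 + ⌊ 3 ⌋ * P ^ 2 * E 4))
        ≡⟨ solve 4 (λ a b c P → # 16 :* (a :+ (# 1 :* a :+ # 2 :* P :* b :+ # 3 :* P :^ 2 :* c))
            := # 32 :* a :+ P :* (# 32 :* b) :+ # 3 :* P :^ 2 :* (# 16 :* c)) refl (E 2) (E 3) (E 4) P ⟩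
      ⌊ 32 ⌋ * E 2 + P * (⌊ 32 ⌋ * E 3) + ⌊ 3 ⌋ * P ^ 2 * (⌊ 16 ⌋ * E 4)
        ≡⟨ cong₂ (λ x y → x + P * y + ⌊ 3 ⌋ * P ^ 2 * (⌊ 16 ⌋ * E 4)) (trans (cong (⌊ 32 ⌋ *_) (H-double 2))
            (scale-½ 32 2 8 (solve 0 (# 32 := # 8 :* # 2 :^ 2) refl)))
            (trans (cong (⌊ 32 ⌋ *_) (H-double 3)) (scale-½ 32 3 4 (solve 0 (# 32 := # 4 :* # 2 :^ 3) refl))) ⟩
      ⌊ 8 ⌋ * h 2 + P * (⌊ 4 ⌋ * h 3) + ⌊ 3 ⌋ * P ^ 2 * (⌊ 16 ⌋ * E 4)
        ≡⟨ cong (λ x → ⌊ 8 ⌋ * h 2 + P * (⌊ 4 ⌋ * h 3) + ⌊ 3 ⌋ * P ^ 2 * x)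
            (trans (cong (⌊ 16 ⌋ *_) (H-double 4)) (scale-½ 16 4 1 (solve 0 (# 16 := # 1 :* # 2 :^ 4) refl))) ⟩
      ⌊ 8 ⌋ * h 2 + P * (⌊ 4 ⌋ * h 3) + ⌊ 3 ⌋ * P ^ 2 * (1# * h 4)
        ≡⟨ solve 4 (λ a b c P → # 8 :* a :+ P :* (# 4 :* b) :+ # 3 :* P :^ 2 :* (# 1 :* c)
            := # 8 :* a :+ # 4 :* P :* b :+ # 3 :* P :^ 2 :* c) refl (h 2) (h 3) (h 4) P ⟩
      ⌊ 8 ⌋ * h 2 + ⌊ 4 ⌋ * P * T + ⌊ 3 ⌋ * P ^ 2 * h 4 ∎))
    where
    E : ℕ → A
    E a = ∑ n (λ j → ι (j ℕ.+ j) ^ a)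

  -- The same two evaluations, now of S_2 modulo p³. Eliminating S_2 leaves 24 h_2 + 28 p T + 45 p²
  -- h_4 ≡ 0, whose last term vanishes.
  h₂-value : ⌊ 6 ⌋ * h 2 + ⌊ 7 ⌋ * P * T ≈[ 3 ] 0#
  h₂-value = cancel 4 p∤4 (combine (null-+ (null-+ (difference S₂-even-odd) (null-* (- ⌊ 16 ⌋) (difference S₂-fold)))
      (null-* (- ⌊ 45 ⌋) (null-P 2 h₄-null)))
    (solve 5 (λ s a b c P → # 4 :* (# 6 :* a :+ # 7 :* P :* b) :- # 0
      := (# 16 :* s :- (# 8 :* a :+ # 4 :* P :* b :+ # 3 :* P :^ 2 :* c)) :+ (:- # 16) :*
          (s :- (# 2 :* a :+ # 2 :* P :* b :+ # 3 :* P :^ 2 :* c)) :+ (:- # 45) :* (P :^ 2 :* c)) refl (S 2) (h 2) T (h 4) P))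

  S₂-value : ⌊ 3 ⌋ * S 2 + P * T ≈[ 3 ] 0#
  S₂-value = combine (null-+ (null-+ (null-* ⌊ 3 ⌋ (difference S₂-fold)) h₂-value) (null-* ⌊ 9 ⌋ (null-P 2 h₄-null)))
    (solve 5 (λ s a b c P → # 3 :* s :+ P :* b :- # 0
      := # 3 :* (s :- (# 2 :* a :+ # 2 :* P :* b :+ # 3 :* P :^ 2 :* c)) :+ (# 6 :* a :+ # 7 :* P :* b) :+ # 9 :* (P :^ 2 :* c)) refl (S 2)
          (h 2) T (h 4) P)

  -- The reflection k ↦ p - k gives 2 S_3 ≡ -3 p S_4, and S_4 is divisible by p.
  S₃-null : S 3 ≈[ 2 ] 0#
  S₃-null = cancel 2 p∤2 (combine (null-+ (difference reflected) (null-* (- ⌊ 3 ⌋) (null-P 1 S₄-null)))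
    (solve 3 (λ s f P → # 2 :* s :- # 0 := (s :- :- (s :+ # 3 :* P :* f)) :+ (:- # 3) :* (P :^ 1 :* f)) refl (S 3) (S 4) P))
    where
    reflected : S 3 ≈[ 2 ] - (S 3 + ⌊ 3 ⌋ * P * S 4)
    reflected = ≈-trans (≈-reflexive (∑-reverse N _)) (≈-trans (≈-∑ N ι³-reflect)
      (≈-reflexive (trans (∑-neg N _) (cong -_ (trans (∑-+ N _ _) (cong (S 3 +_) (∑-*ˡ N (⌊ 3 ⌋ * P) _)))))))

-- Products of 1 - p/k through a truncated logarithm

module TruncatedLogarithm (n : ℕ) (p-prime : Prime (suc (n ℕ.+ n))) (5<p : 5 < suc (n ℕ.+ n)) (L : LocalRing (suc (n ℕ.+ n))) where
  open HarmonicSums n p-prime 5<p L public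
  open ≡-Reasoning

  ∏ : ℕ → (ℕ → A) → A
  ∏ zero f = 1#
  ∏ (suc m) f = ∏ m f * f (suc m)

  ∏-cong : ∀ m {f g : ℕ → A} → (∀ k → 1 ≤ k → k ≤ m → f k ≡ g k) → ∏ m f ≡ ∏ m g
  ∏-cong zero eq = refl
  ∏-cong (suc m) eq = cong₂ _*_ (∏-cong m λ k 1≤k k≤m → eq k 1≤k (ℕ.m≤n⇒m≤1+n k≤m)) (eq (suc m) (s≤s z≤n) ℕ.≤-refl)

  ∏-* : ∀ m f g → ∏ m (λ k → f k * g k) ≡ ∏ m f * ∏ m g
  ∏-* zero f g = sym (*-identityˡ 1#)
  ∏-* (suc m) f g = trans (cong (_* (f (suc m) * g (suc m))) (∏-* m f g))
      (solve 4 (λ a b c d → a :* b :* (c :* d) := a :* c :* (b :* d)) refl _ _ _ _)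

  ∏-const : ∀ m c → ∏ m (λ _ → c) ≡ c ^ m
  ∏-const zero c = refl
  ∏-const (suc m) c = trans (cong (_* c) (∏-const m c)) (*-comm _ _)

  ∏-first : ∀ m f → ∏ (suc m) f ≡ f 1 * ∏ m (λ k → f (suc k))
  ∏-first zero f = *-comm _ _
  ∏-first (suc m) f = trans (cong (_* f (suc (suc m))) (∏-first m f)) (*-assoc _ _ _)

  ∏-reverse : ∀ m f → ∏ m f ≡ ∏ m (λ i → f (suc m ∸ i))
  ∏-reverse zero f = refl
  ∏-reverse (suc m) f = begin
    ∏ (suc m) f                                              ≡⟨ ∏-first m f ⟩
    f 1 * ∏ m (λ k → f (suc k))                              ≡⟨ cong (f 1 *_) (∏-reverse m (λ k → f (suc k))) ⟩
    f 1 * ∏ m (λ i → f (suc (suc m ∸ i)))                    ≡⟨ *-comm _ _ ⟩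
    ∏ m (λ i → f (suc (suc m ∸ i))) * f 1                    ≡⟨ cong₂ _*_
        (∏-cong m λ i _ i≤m → cong f (sym (ℕ.+-∸-assoc 1 (ℕ.m≤n⇒m≤1+n i≤m))))
        (cong f (sym (trans (ℕ.+-∸-assoc 1 (ℕ.≤-refl {m})) (cong suc (ℕ.n∸n≡0 m))))) ⟩
    ∏ m (λ i → f (suc (suc m) ∸ i)) * f (suc m ∸ m)          ∎

  -- 12 times the logarithm of 1 + x, truncated after x⁴.
  lg : A → A
  lg x = ⌊ 12 ⌋ * x - ⌊ 6 ⌋ * x ^ 2 + ⌊ 4 ⌋ * x ^ 3 - ⌊ 3 ⌋ * x ^ 4

  -- The logarithm is additive up to degree four, and with arguments divisible by `P` all remaining
  -- terms carry `P ^ 5`. The witness is this remainder divided by `P ^ 5`.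
  lg-product : ∀ X Y → lg (P * (X + Y + P * (X * Y))) ≈[ 5 ] lg (P * X) + lg (P * Y)
  lg-product X Y = _ by solve 3 (λ P X Y → # 12 :* (P :* (X :+ Y :+ P :* (X :* Y))) :- # 6 :*
      (P :* (X :+ Y :+ P :* (X :* Y))) :^ 2 :+ # 4 :* (P :* (X :+ Y :+ P :* (X :* Y))) :^ 3 :- # 3 :* (P :* (X :+ Y :+ P :* (X :* Y))) :^ 4
      := # 12 :* (P :* X) :- # 6 :* (P :* X) :^ 2 :+ # 4 :* (P :* X) :^ 3 :- # 3 :* (P :* X) :^ 4 :+
      (# 12 :* (P :* Y) :- # 6 :* (P :* Y) :^ 2 :+ # 4 :* (P :* Y) :^ 3 :- # 3 :* (P :* Y) :^ 4) :+ P :^ 5 :*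
      ((:- # 18) :* P :* X :^ 2 :* Y :^ 4 :- # 32 :* P :* X :^ 3 :* Y :^ 3 :- # 18 :* P :* X :^ 4 :* Y :^ 2 :- # 12 :* P :^ 2 :* X :^ 3 :*
      Y :^ 4 :- # 12 :* P :^ 2 :* X :^ 4 :* Y :^ 3 :- # 3 :* P :^ 3 :* X :^ 4 :* Y :^ 4 :- # 12 :* X :* Y :^ 4 :- # 24 :* X :^ 2 :* Y :^
      3 :- # 24 :* X :^ 3 :* Y :^ 2 :- # 12 :* X :^ 4 :* Y)) refl P X Y

  -- The product of the 1 + P y_k is 1 + P · `excess`. Splitting off `P` keeps the argument of `lg`
  -- visibly divisible by it.
  excess : (ℕ → A) → ℕ → A
  excess y zero = 0#
  excess y (suc m) = excess y m + y (suc m) + P * (excess y m * y (suc m))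

  excess-product : ∀ y m → ∏ m (λ k → 1# + P * y k) ≡ 1# + P * excess y m
  excess-product y zero = solve 1 (λ P → # 1 := # 1 :+ P :* # 0) refl P
  excess-product y (suc m) = trans (cong (_* (1# + P * y (suc m))) (excess-product y m))
    (solve 3 (λ P X Y → (# 1 :+ P :* X) :* (# 1 :+ P :* Y) := # 1 :+ P :* (X :+ Y :+ P :* (X :* Y))) refl P (excess y m) (y (suc m)))

  lg-0 : lg (P * 0#) ≡ 0#
  lg-0 = solve 1 (λ P → # 12 :* (P :* # 0) :- # 6 :* (P :* # 0) :^ 2 :+ # 4 :* (P :* # 0) :^ 3 :- # 3 :* (P :* # 0) :^ 4 := # 0) refl P

  lg-excess : ∀ y m → lg (P * excess y m) ≈[ 5 ] ∑ m (λ k → lg (P * y k))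
  lg-excess y zero = ≈-reflexive lg-0
  lg-excess y (suc m) = ≈-trans (lg-product (excess y m) (y (suc m))) (≈-+ (lg-excess y m) ≈-refl)

  -- The series of log(1 - cP/k) summed over k; the coefficients 12, 6, 4, 3 are 12/a for a = 1, 2,
  -- 3, 4.
  lg-harmonic : ∀ c m → lg (P * excess (λ k → - (c * ι k)) m) ≈[ 5 ] -
      (⌊ 12 ⌋ * P * (c ^ 1 * H 1 m) + ⌊ 6 ⌋ * P ^ 2 * (c ^ 2 * H 2 m) + ⌊ 4 ⌋ * P ^ 3 * (c ^ 3 * H 3 m) + ⌊ 3 ⌋ * P ^ 4 * (c ^ 4 * H 4 m))
  lg-harmonic c m = ≈-trans (lg-excess _ m) (≈-reflexive (begin
    ∑ m (λ k → lg (P * - (c * ι k)))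
      ≡⟨ ∑-cong m (λ k _ _ → solve 3 (λ P c u → # 12 :* (P :* (:- (c :* u))) :- # 6 :* (P :* (:- (c :* u))) :^ 2 :+ # 4 :*
          (P :* (:- (c :* u))) :^ 3 :- # 3 :* (P :* (:- (c :* u))) :^ 4
          := (:- (# 12 :* P :* c :^ 1 :* u :^ 1 :+ # 6 :* P :^ 2 :* c :^ 2 :* u :^ 2 :+ # 4 :* P :^ 3 :* c :^ 3 :* u :^ 3 :+ # 3 :* P :^
          4 :* c :^ 4 :* u :^ 4))) refl P c (ι k)) ⟩
    ∑ m (λ k → - (⌊ 12 ⌋ * P * c ^ 1 * ι k ^ 1 + ⌊ 6 ⌋ * P ^ 2 * c ^ 2 * ι k ^ 2 + ⌊ 4 ⌋ * P ^ 3 * c ^ 3 * ι k ^ 3 + ⌊ 3 ⌋ * P ^ 4 * c ^ 4 * ι k ^ 4))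
      ≡⟨ trans (∑-neg m _) (cong -_ (trans (∑-+ m _ _) (cong₂ _+_ (∑-linear₃ m (⌊ 12 ⌋ * P * c ^ 1) (⌊ 6 ⌋ * P ^ 2 * c ^ 2)
          (⌊ 4 ⌋ * P ^ 3 * c ^ 3) _ _ _) (∑-*ˡ m (⌊ 3 ⌋ * P ^ 4 * c ^ 4) _)))) ⟩
    - (⌊ 12 ⌋ * P * c ^ 1 * H 1 m + ⌊ 6 ⌋ * P ^ 2 * c ^ 2 * H 2 m + ⌊ 4 ⌋ * P ^ 3 * c ^ 3 * H 3 m + ⌊ 3 ⌋ * P ^ 4 * c ^ 4 * H 4 m)
      ≡⟨ cong -_ (cong₂ _+_ (cong₂ _+_ (cong₂ _+_ (*-assoc _ _ _) (*-assoc _ _ _)) (*-assoc _ _ _)) (*-assoc _ _ _)) ⟩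
    - (⌊ 12 ⌋ * P * (c ^ 1 * H 1 m) + ⌊ 6 ⌋ * P ^ 2 * (c ^ 2 * H 2 m) + ⌊ 4 ⌋ * P ^ 3 * (c ^ 3 * H 3 m) + ⌊ 3 ⌋ * P ^ 4 * (c ^ 4 * H 4 m)) ∎))

  signed-binomial-step : ∀ M k → 1 ≤ suc k → suc k ≤ N → (- 1#) ^ suc k * ⌊ M C suc k ⌋ ≡ (- 1#) ^ k * ⌊ M C k ⌋ * (1# - ⌊ suc M ⌋ * ι (suc k))
  signed-binomial-step M k 1≤k k≤N = begin
    - 1# * σ * b
      ≡⟨ solve 2 (λ σ b → (:- # 1) :* σ :* b := (:- # 1) :* σ :* (# 1 :* b)) refl σ b ⟩
    - 1# * σ * (1# * b)
      ≡⟨ cong (λ x → - 1# * σ * (x * b)) (sym k*u) ⟩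
    - 1# * σ * (⌊ suc k ⌋ * u * b)
      ≡⟨ solve 4 (λ σ k u b → (:- # 1) :* σ :* (k :* u :* b) := (:- # 1) :* σ :* (u :* (k :* b))) refl σ ⌊ suc k ⌋ u b ⟩
    - 1# * σ * (u * (⌊ suc k ⌋ * b))
      ≡⟨ cong (λ x → - 1# * σ * (u * x)) (next-binomial M k) ⟩
    - 1# * σ * (u * ((⌊ M ⌋ - ⌊ k ⌋) * a))
      ≡⟨ solve 5 (λ σ u M k a → (:- # 1) :* σ :* (u :* ((M :- k) :* a)) := σ :* a :* ((# 1 :+ k) :* u :- (# 1 :+ M) :* u)) refl σ u ⌊ M ⌋ ⌊ k ⌋ a ⟩
    σ * a * ((1# + ⌊ k ⌋) * u - (1# + ⌊ M ⌋) * u)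
      ≡⟨ cong₂ (λ x y → σ * a * (x - y * u)) (trans (cong (_* u) (sym (⌊suc⌋ k))) k*u) (sym (⌊suc⌋ M)) ⟩
    σ * a * (1# - ⌊ suc M ⌋ * u) ∎
    where
    σ = (- 1#) ^ k
    a = ⌊ M C k ⌋
    b = ⌊ M C suc k ⌋
    u = ι (suc k)
    k*u : ⌊ suc k ⌋ * u ≡ 1#
    k*u = ι-inverse′ (suc k) 1≤k k≤N

  -- Consecutive values have the ratio 1 - (M+1)/k. The cases used are M + 1 = p and M + 1 = 2p.
  signed-binomial : ∀ M c → ⌊ suc M ⌋ ≡ P * c → ∀ m → m ≤ N → (- 1#) ^ m * ⌊ M C m ⌋ ≡ 1# + P * excess (λ k → - (c * ι k)) m
  signed-binomial M c eq m m≤N = trans (product m m≤N) (excess-product _ m)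
    where
    product : ∀ m → m ≤ N → (- 1#) ^ m * ⌊ M C m ⌋ ≡ ∏ m (λ k → 1# + P * - (c * ι k))
    product zero _ = trans (*-identityˡ _) (⌊nC0⌋ M)
    product (suc m) m<N = trans (signed-binomial-step M m (s≤s z≤n) m<N) (cong₂ _*_ (product m (ℕ.<⇒≤ m<N))
      (trans (cong (λ x → 1# - x * ι (suc m)) eq) (solve 3 (λ P c u → # 1 :- P :* c :* u := # 1 :+ P :* (:- (c :* u))) refl P c (ι (suc m)))))

  ^-double : ∀ x m → x ^ (m ℕ.+ m) ≡ (x * x) ^ m
  ^-double x m = trans (^-homo-* x m m) (sym (^-distrib-* x x m))

  [-1]^N : (- 1#) ^ N ≡ 1#
  [-1]^N = trans (^-double (- 1#) n) (trans (cong (_^ n) (solve 0 ((:- # 1) :* (:- # 1) := # 1) refl)) (1^ n))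

  Q : A
  Q = ⌊ 2 ⌋ ^ N

  [-2]^N : (- ⌊ 2 ⌋) ^ N ≡ Q
  [-2]^N = trans (^-double (- ⌊ 2 ⌋) n) (trans (cong (_^ n) (solve 0 ((:- # 2) :* (:- # 2) := # 2 :* # 2) refl)) (sym (^-double ⌊ 2 ⌋ n)))

  -- Modulo p, 2 W_j is 2^j, which is how sums weighted by powers of two arise from binomial
  -- identities.
  W : ℕ → A
  W j = ⌊ N C (j ∸ 1) ⌋ * (- ⌊ 2 ⌋) ^ (j ∸ 1)

  w : ℕ → A
  w a = ∑ N (λ j → W j * ι j ^ a)

  -- The Fermat quotient, given as a sum because there is no division by p in the ring; `Q≡1+Pq`
  -- identifies it.
  q : A
  q = - w 1

  W-binomial : ∀ j → 1 ≤ j → j ≤ N → ⌊ p C j ⌋ * (- ⌊ 2 ⌋) ^ j ≡ - ⌊ 2 ⌋ * P * (W j * ι j)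
  W-binomial (suc j) 1≤j j≤N = begin
    b * (- ⌊ 2 ⌋ * y)                                ≡⟨ solve 2 (λ b y → b :* ((:- # 2) :* y) := (:- # 2) :* (# 1 :* b) :* y) refl b y ⟩
    - ⌊ 2 ⌋ * (1# * b) * y                           ≡⟨ cong (λ x → - ⌊ 2 ⌋ * (x * b) * y) (sym (ι-inverse′ (suc j) 1≤j j≤N)) ⟩
    - ⌊ 2 ⌋ * (⌊ suc j ⌋ * u * b) * y                ≡⟨ solve 4 (λ b y j u → (:- # 2) :* (j :* u :* b) :* y
        := (:- # 2) :* (u :* (j :* b)) :* y) refl b y ⌊ suc j ⌋ u ⟩
    - ⌊ 2 ⌋ * (u * (⌊ suc j ⌋ * b)) * y              ≡⟨ cong (λ x → - ⌊ 2 ⌋ * (u * x) * y) (absorb N j) ⟩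
    - ⌊ 2 ⌋ * (u * (P * a)) * y                      ≡⟨ solve 4 (λ u P a y → (:- # 2) :* (u :* (P :* a)) :* y
        := (:- # 2) :* P :* (a :* y :* u)) refl u P a y ⟩
    - ⌊ 2 ⌋ * P * (a * y * u)                        ∎
    where
    a = ⌊ N C j ⌋
    b = ⌊ p C suc j ⌋
    y = (- ⌊ 2 ⌋) ^ j
    u = ι (suc j)

  halve : ∀ {x y} → ⌊ 2 ⌋ * x ≡ ⌊ 2 ⌋ * y → x ≡ y
  halve {x} {y} eq = trans (undo x) (trans (cong (½ *_) eq) (sym (undo y)))
    where
    undo : ∀ z → z ≡ ½ * (⌊ 2 ⌋ * z)
    undo z = trans (sym (*-identityˡ z)) (trans (cong (_* z) (sym 2*½)) (solve 2 (λ h z → # 2 :* h :* z := h :* (# 2 :* z)) refl ½ z))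

  -- The expansion of (1 - 2)^p = -1: by absorption the inner terms are -2p W_j/j, and the last term
  -- is -2Q.
  Q≡1+Pq : Q ≡ 1# + P * q
  Q≡1+Pq = halve (begin
    ⌊ 2 ⌋ * Q                                  ≡⟨ solve 2 (λ x Q → # 2 :* Q := x :- (x :+ (:- # 2) :* Q)) refl X Q ⟩
    X - (X + - ⌊ 2 ⌋ * Q)                      ≡⟨ cong₂ _-_ X-value full ⟩
    - ⌊ 2 ⌋ * P * w 1 - - ⌊ 2 ⌋                ≡⟨ solve 2 (λ P w → (:- # 2) :* P :* w :- (:- # 2) := # 2 :* (# 1 :+ P :* (:- w))) refl P (w 1) ⟩
    ⌊ 2 ⌋ * (1# + P * q)                       ∎)
    where
    X = ∑ N (λ j → ⌊ p C j ⌋ * (- ⌊ 2 ⌋) ^ j)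
    X-value : X ≡ - ⌊ 2 ⌋ * P * w 1
    X-value = trans (∑-cong N W-binomial) (trans (∑-*ˡ N (- ⌊ 2 ⌋ * P) _)
        (cong (- ⌊ 2 ⌋ * P *_) (∑-cong N λ j _ _ → cong (W j *_) (sym (*-identityʳ (ι j))))))
    full : X + - ⌊ 2 ⌋ * Q ≡ - ⌊ 2 ⌋
    full = begin
      X + - ⌊ 2 ⌋ * Q                          ≡⟨ cong (X +_) (trans (cong (- ⌊ 2 ⌋ *_) (sym [-2]^N))
          (sym (trans (cong (_* (- ⌊ 2 ⌋) ^ p) (⌊nCn⌋ p)) (*-identityˡ _)))) ⟩
      ∑ p (λ j → ⌊ p C j ⌋ * (- ⌊ 2 ⌋) ^ j)    ≡⟨ transform-one (- ⌊ 2 ⌋) p ⟩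
      (1# + - ⌊ 2 ⌋) ^ p - 1#                  ≡⟨ cong (λ x → x ^ p - 1#) (solve 0 (# 1 :+ :- # 2 := :- # 1) refl) ⟩
      - 1# * (- 1#) ^ N - 1#                   ≡⟨ cong (λ x → - 1# * x - 1#) [-1]^N ⟩
      - 1# * 1# - 1#                           ≡⟨ solve 0 ((:- # 1) :* # 1 :- # 1 := :- # 2) refl ⟩
      - ⌊ 2 ⌋                                  ∎

  -- C(p-1,p-1) = 1 is the product of all 1 - p/k, so its logarithm gives 12 p S_1 + 6 p² S_2 + 4 p³
  -- S_3 + 3 p⁴ S_4 ≡ 0 modulo p⁵, where the last three sums are already known well enough.
  S₁-value : ⌊ 6 ⌋ * S 1 - P ^ 2 * T ≈[ 4 ] 0#
  S₁-value = cancel 2 p∤2 (cancel-P regular 1 (combine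
    (null-+ (null-+ (null-+ (null-+ (difference (lg-harmonic 1# N)) (null-* (- 1#) (≈-reflexive lg-excess-0)))
        (null-* (- ⌊ 2 ⌋) (null-P 2 S₂-value))) (null-* (- ⌊ 4 ⌋) (null-P 3 S₃-null))) (null-* (- ⌊ 3 ⌋) (null-P 4 S₄-null)))
    (solve 7 (λ P z a b c d T → P :^ 1 :* (# 2 :* (# 6 :* a :- P :^ 2 :* T)) :- # 0
        := z :- (:- (# 12 :* P :* (# 1 :^ 1 :* a) :+ # 6 :* P :^ 2 :* (# 1 :^ 2 :* b) :+ # 4 :* P :^ 3 :*
        (# 1 :^ 3 :* c) :+ # 3 :* P :^ 4 :* (# 1 :^ 4 :* d))) :+ (:- # 1) :* z :+ (:- # 2) :* (P :^ 2 :* (# 3 :* b :+ P :* T)) :+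
        (:- # 4) :* (P :^ 3 :* c) :+ (:- # 3) :* (P :^ 4 :* d)) refl P (lg (P * excess y N)) (S 1) (S 2) (S 3) (S 4) T)))
    where
    y : ℕ → A
    y k = - (1# * ι k)
    excess-0 : excess y N ≡ 0#
    excess-0 = regular (begin
      P * excess y N                           ≡⟨ solve 2 (λ P x → P :* x := # 1 :+ P :* x :- # 1) refl P (excess y N) ⟩
      1# + P * excess y N - 1#                 ≡⟨ cong (_- 1#) (sym (signed-binomial N 1# (sym (*-identityʳ P)) N ℕ.≤-refl)) ⟩
      (- 1#) ^ N * ⌊ N C N ⌋ - 1#              ≡⟨ cong₂ (λ a b → a * b - 1#) [-1]^N (⌊nCn⌋ N) ⟩
      1# * 1# - 1#                             ≡⟨ solve 0 (# 1 :* # 1 :- # 1 := # 0) refl ⟩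
      0#                                       ∎)
    lg-excess-0 : lg (P * excess y N) ≡ 0#
    lg-excess-0 = trans (cong (λ x → lg (P * x)) excess-0) lg-0

  C₂ₚ : A
  C₂ₚ = ⌊ (p ℕ.+ N) C N ⌋

  -- C(2p-1,p-1) is the product of all 1 - 2p/k, and twelve times its logarithm is 4 p³ T modulo p⁵.
  -- Once the binomial coefficient is known to be 1 modulo p³, the higher powers in `lg` vanish
  -- modulo p⁵ and Y can be read off.
  C₂ₚ-value : Σ A λ Y → (C₂ₚ ≡ 1# + P ^ 3 * Y) × (⌊ 3 ⌋ * Y - T ≈[ 2 ] 0#)
  C₂ₚ-value = quotient divided₂ , C₂ₚ≡ , third
    where
    y : ℕ → A
    y k = - (⌊ 2 ⌋ * ι k)
    Y₀ : A
    Y₀ = excess y N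
    C₂ₚ≡₀ : C₂ₚ ≡ 1# + P * Y₀
    C₂ₚ≡₀ = trans (sym (trans (cong (_* C₂ₚ) [-1]^N) (*-identityˡ _)))
        (signed-binomial (p ℕ.+ N) ⌊ 2 ⌋ (trans (cong ⌊_⌋ (sym (ℕ.+-suc p N)))
        (trans (⌊+⌋ p p) (solve 1 (λ P → P :+ P := P :* # 2) refl P))) N ℕ.≤-refl)
    lg-Y₀ : lg (P * Y₀) - ⌊ 4 ⌋ * P ^ 3 * T ≈[ 5 ] 0#
    lg-Y₀ = combine (null-+ (null-+ (null-+ (null-+ (difference (lg-harmonic ⌊ 2 ⌋ N)) (null-* (- ⌊ 4 ⌋) (null-P 1 S₁-value)))
        (null-* (- ⌊ 8 ⌋) (null-P 2 S₂-value))) (null-* (- ⌊ 32 ⌋) (null-P 3 S₃-null))) (null-* (- ⌊ 48 ⌋) (null-P 4 S₄-null)))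
      (solve 7 (λ P z a b c d T → z :- # 4 :* P :^ 3 :* T :- # 0 := z :-
          (:- (# 12 :* P :* (# 2 :^ 1 :* a) :+ # 6 :* P :^ 2 :* (# 2 :^ 2 :* b) :+ # 4 :* P :^ 3 :* (# 2 :^ 3 :* c) :+ # 3 :* P :^ 4 :*
          (# 2 :^ 4 :* d))) :+ (:- # 4) :* (P :^ 1 :* (# 6 :* a :- P :^ 2 :* T)) :+ (:- # 8) :* (P :^ 2 :* (# 3 :* b :+ P :* T)) :+
          (:- # 32) :* (P :^ 3 :* c) :+ (:- # 48) :* (P :^ 4 :* d)) refl P (lg (P * Y₀)) (S 1) (S 2) (S 3) (S 4) T)
    p∤12 = p∤* {2} {6} p∤2 p∤6
    -- Since `lg` x is 12 x up to terms of order x², each pass gains one more factor `P`.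
    divided₁ : Y₀ ≈[ 1 ] 0#
    divided₁ = cancel 12 p∤12 (cancel-P regular 1 (combine (null-+ (≈-drop (≈-drop (≈-drop lg-Y₀))) (multiple _))
      (solve 3 (λ P Y T → P :^ 1 :* (# 12 :* Y) :- # 0 := # 12 :* (P :* Y) :- # 6 :* (P :* Y) :^ 2 :+ # 4 :* (P :* Y) :^ 3 :- # 3 :*
          (P :* Y) :^ 4 :- # 4 :* P :^ 3 :* T :+ P :^ 2 :* (# 4 :* P :* T :+ # 6 :* Y :^ 2 :- # 4 :* P :* Y :^ 3 :+ # 3 :* P :^ 2 :* Y :^
          4)) refl P Y₀ T)))
    Y₁ = quotient divided₁
    Y₀≡ : Y₀ ≡ P * Y₁
    Y₀≡ = trans (equation divided₁) (solve 2 (λ P Y → # 0 :+ P :^ 1 :* Y := P :* Y) refl P Y₁)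
    lg-Y₁ : lg (P * (P * Y₁)) - ⌊ 4 ⌋ * P ^ 3 * T ≈[ 5 ] 0#
    lg-Y₁ = subst (λ z → lg (P * z) - ⌊ 4 ⌋ * P ^ 3 * T ≈[ 5 ] 0#) Y₀≡ lg-Y₀
    divided₂ : Y₁ ≈[ 1 ] 0#
    divided₂ = cancel 12 p∤12 (cancel-P regular 2 (combine (null-+ (≈-drop (≈-drop lg-Y₁)) (multiple _))
      (solve 3 (λ P Y T → P :^ 2 :* (# 12 :* Y) :- # 0 := # 12 :* (P :* (P :* Y)) :- # 6 :* (P :* (P :* Y)) :^ 2 :+ # 4 :*
          (P :* (P :* Y)) :^ 3 :- # 3 :* (P :* (P :* Y)) :^ 4 :- # 4 :* P :^ 3 :* T :+ P :^ 3 :*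
          (# 4 :* T :+ # 6 :* P :* Y :^ 2 :- # 4 :* P :^ 3 :* Y :^ 3 :+ # 3 :* P :^ 5 :* Y :^ 4)) refl P Y₁ T)))
    Y₂ = quotient divided₂
    Y₁≡ : Y₁ ≡ P * Y₂
    Y₁≡ = trans (equation divided₂) (solve 2 (λ P Y → # 0 :+ P :^ 1 :* Y := P :* Y) refl P Y₂)
    third : ⌊ 3 ⌋ * Y₂ - T ≈[ 2 ] 0#
    third = cancel 4 p∤4 (cancel-P regular 3 (combine (null-+ (subst (λ z → lg (P * (P * z)) - ⌊ 4 ⌋ * P ^ 3 * T ≈[ 5 ] 0#) Y₁≡ lg-Y₁) (multiple _))
      (solve 3 (λ P Y T → P :^ 3 :* (# 4 :* (# 3 :* Y :- T)) :- # 0 := # 12 :* (P :* (P :* (P :* Y))) :- # 6 :*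
          (P :* (P :* (P :* Y))) :^ 2 :+ # 4 :* (P :* (P :* (P :* Y))) :^ 3 :- # 3 :*
          (P :* (P :* (P :* Y))) :^ 4 :- # 4 :* P :^ 3 :* T :+ P :^ 5 :*
          (# 6 :* P :* Y :^ 2 :- # 4 :* P :^ 4 :* Y :^ 3 :+ # 3 :* P :^ 7 :* Y :^ 4)) refl P Y₂ T)))
    C₂ₚ≡ : C₂ₚ ≡ 1# + P ^ 3 * Y₂
    C₂ₚ≡ = trans C₂ₚ≡₀ (trans (cong (λ z → 1# + P * z) (trans Y₀≡ (cong (P *_) Y₁≡)))
        (solve 2 (λ P Y → # 1 :+ P :* (P :* (P :* Y)) := # 1 :+ P :^ 3 :* Y) refl P Y₂))

  central-binomial-step : ∀ m → ⌊ suc m ⌋ * ⌊ (suc m ℕ.+ suc m) C suc m ⌋ ≡ ⌊ 2 ⌋ * (⌊ suc (m ℕ.+ m) ⌋ * ⌊ (m ℕ.+ m) C m ⌋)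
  central-binomial-step m = begin
    ⌊ suc m ⌋ * ⌊ (suc m ℕ.+ suc m) C suc m ⌋        ≡⟨ absorb (m ℕ.+ suc m) m ⟩
    ⌊ suc m ℕ.+ suc m ⌋ * ⌊ (m ℕ.+ suc m) C m ⌋      ≡⟨ cong₂ (λ x k → x * ⌊ k C m ⌋) (⌊+⌋ (suc m) (suc m)) (ℕ.+-suc m m) ⟩
    (⌊ suc m ⌋ + ⌊ suc m ⌋) * ⌊ M C m ⌋              ≡⟨ cong ((⌊ suc m ⌋ + ⌊ suc m ⌋) *_) (cong ⌊_⌋ symmetric) ⟩
    (⌊ suc m ⌋ + ⌊ suc m ⌋) * ⌊ M C suc m ⌋          ≡⟨ solve 2 (λ a b → (a :+ a) :* b := # 2 :* (a :* b)) refl ⌊ suc m ⌋ ⌊ M C suc m ⌋ ⟩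
    ⌊ 2 ⌋ * (⌊ suc m ⌋ * ⌊ M C suc m ⌋)              ≡⟨ cong (⌊ 2 ⌋ *_) (absorb (m ℕ.+ m) m) ⟩
    ⌊ 2 ⌋ * (⌊ M ⌋ * ⌊ (m ℕ.+ m) C m ⌋)              ∎
    where
    M = suc (m ℕ.+ m)
    symmetric : M C m ≡ M C suc m
    symmetric = trans (nCk≡nC[n∸k] {m} {M} (ℕ.m≤n⇒m≤1+n (ℕ.m≤m+n m m))) (cong (M C_) (trans (ℕ.+-∸-assoc 1 (ℕ.m≤m+n m m)) (cong suc (ℕ.m+n∸n≡m m m))))

  central-binomial : ∀ m → ⌊ (m ℕ.+ m) C m ⌋ * ∏ m ⌊_⌋ ≡ ⌊ 2 ⌋ ^ m * ∏ m (λ j → ⌊ j ℕ.+ j ⌋ - 1#)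
  central-binomial zero = refl
  central-binomial (suc m) = begin
    ⌊ (suc m ℕ.+ suc m) C suc m ⌋ * (∏ m ⌊_⌋ * ⌊ suc m ⌋)
      ≡⟨ solve 3 (λ c d s → c :* (d :* s) := s :* c :* d) refl ⌊ (suc m ℕ.+ suc m) C suc m ⌋ (∏ m ⌊_⌋) ⌊ suc m ⌋ ⟩
    ⌊ suc m ⌋ * ⌊ (suc m ℕ.+ suc m) C suc m ⌋ * ∏ m ⌊_⌋
      ≡⟨ cong (_* ∏ m ⌊_⌋) (central-binomial-step m) ⟩
    ⌊ 2 ⌋ * (⌊ suc (m ℕ.+ m) ⌋ * ⌊ (m ℕ.+ m) C m ⌋) * ∏ m ⌊_⌋
      ≡⟨ solve 3 (λ s c d → # 2 :* (s :* c) :* d := # 2 :* (c :* d) :* s) refl ⌊ suc (m ℕ.+ m) ⌋ ⌊ (m ℕ.+ m) C m ⌋ (∏ m ⌊_⌋) ⟩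
    ⌊ 2 ⌋ * (⌊ (m ℕ.+ m) C m ⌋ * ∏ m ⌊_⌋) * ⌊ suc (m ℕ.+ m) ⌋
      ≡⟨ cong₂ (λ x y → ⌊ 2 ⌋ * x * y) (central-binomial m) odd ⟩
    ⌊ 2 ⌋ * (⌊ 2 ⌋ ^ m * ∏ m (λ j → ⌊ j ℕ.+ j ⌋ - 1#)) * (⌊ suc m ℕ.+ suc m ⌋ - 1#)
      ≡⟨ solve 3 (λ t d s → # 2 :* (t :* d) :* s := # 2 :* t :* (d :* s)) refl (⌊ 2 ⌋ ^ m) (∏ m (λ j → ⌊ j ℕ.+ j ⌋ - 1#)) (⌊ suc m ℕ.+ suc m ⌋ - 1#) ⟩
    ⌊ 2 ⌋ * ⌊ 2 ⌋ ^ m * (∏ m (λ j → ⌊ j ℕ.+ j ⌋ - 1#) * (⌊ suc m ℕ.+ suc m ⌋ - 1#)) ∎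
    where
    odd : ⌊ suc (m ℕ.+ m) ⌋ ≡ ⌊ suc m ℕ.+ suc m ⌋ - 1#
    odd = trans (solve 1 (λ x → x := # 1 :+ x :- # 1) refl ⌊ suc (m ℕ.+ m) ⌋)
        (cong (_- 1#) (trans (sym (⌊suc⌋ (suc (m ℕ.+ m)))) (cong ⌊_⌋ (cong suc (sym (ℕ.+-suc m m))))))

  -- Both sides are (-1)ⁿ C(2n,n).
  product-1-p/j : 1# + P * excess (λ k → - (1# * ι k)) n ≡ Q * (1# + P * excess (λ k → - (½ * ι k)) n)
  product-1-p/j = begin
    1# + P * excess (λ k → - (1# * ι k)) n
      ≡⟨ sym (signed-binomial N 1# (sym (*-identityʳ P)) n n≤N) ⟩
    (- 1#) ^ n * c
      ≡⟨ cong ((- 1#) ^ n *_) c-value ⟩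
    (- 1#) ^ n * (⌊ 2 ⌋ ^ n * ((- ⌊ 2 ⌋) ^ n * b))
      ≡⟨ solve 4 (λ a c d b → a :* (c :* (d :* b)) := c :* (a :* d) :* b) refl ((- 1#) ^ n) (⌊ 2 ⌋ ^ n) ((- ⌊ 2 ⌋) ^ n) b ⟩
    ⌊ 2 ⌋ ^ n * ((- 1#) ^ n * (- ⌊ 2 ⌋) ^ n) * b
      ≡⟨ cong (λ x → ⌊ 2 ⌋ ^ n * x * b) (trans (sym (^-distrib-* (- 1#) (- ⌊ 2 ⌋) n)) (cong (_^ n) (solve 0 ((:- # 1) :* (:- # 2) := # 2) refl))) ⟩
    ⌊ 2 ⌋ ^ n * ⌊ 2 ⌋ ^ n * b
      ≡⟨ cong₂ _*_ (sym (^-homo-* ⌊ 2 ⌋ n n)) (excess-product (λ k → - (½ * ι k)) n) ⟩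
    Q * (1# + P * excess (λ k → - (½ * ι k)) n) ∎
    where
    c = ⌊ N C n ⌋
    b = ∏ n (λ k → 1# + P * - (½ * ι k))
    D = ∏ n ⌊_⌋
    D⁻¹ = ∏ n ι
    D-unit : D * D⁻¹ ≡ 1#
    D-unit = trans (sym (∏-* n ⌊_⌋ ι)) (trans (∏-cong n λ k 1≤k k≤n → ι-inverse′ k 1≤k (ℕ.≤-trans k≤n n≤N)) (trans (∏-const n 1#) (1^ n)))
    odd-reflect : ∀ j → j ≤ n → (suc n ∸ j) ℕ.+ (suc n ∸ j) ≡ suc (p ∸ (j ℕ.+ j))
    odd-reflect j j≤n = begin
      (suc n ∸ j) ℕ.+ (suc n ∸ j)               ≡⟨ ℕ.m+n∸n≡m _ (j ℕ.+ j) ⟨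
      (suc n ∸ j) ℕ.+ (suc n ∸ j) ℕ.+ (j ℕ.+ j) ∸ (j ℕ.+ j)   ≡⟨ cong (_∸ (j ℕ.+ j))
          (interchange ℕ.+-commutativeSemigroup (suc n ∸ j) (suc n ∸ j) j j) ⟩
      ((suc n ∸ j) ℕ.+ j) ℕ.+ ((suc n ∸ j) ℕ.+ j) ∸ (j ℕ.+ j)   ≡⟨ cong (λ k → k ℕ.+ k ∸ (j ℕ.+ j)) (ℕ.m∸n+n≡m (ℕ.m≤n⇒m≤1+n j≤n)) ⟩
      suc (n ℕ.+ suc n) ∸ (j ℕ.+ j)             ≡⟨ cong (λ k → suc k ∸ (j ℕ.+ j)) (ℕ.+-suc n n) ⟩
      suc p ∸ (j ℕ.+ j)                         ≡⟨ ℕ.+-∸-assoc 1 (ℕ.m≤n⇒m≤1+n (double≤ j≤n)) ⟩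
      suc (p ∸ (j ℕ.+ j))                       ∎
    -- The odd number 2(n+1-j) - 1 is p - 2j = -2j (1 - p/(2j)); listing the odd factors downwards
    -- thus produces the half-step product.
    reflected : ∀ j → 1 ≤ j → j ≤ n → ⌊ (suc n ∸ j) ℕ.+ (suc n ∸ j) ⌋ - 1# ≡ - ⌊ 2 ⌋ * (⌊ j ⌋ * (1# + P * - (½ * ι j)))
    reflected j 1≤j j≤n = begin
      ⌊ (suc n ∸ j) ℕ.+ (suc n ∸ j) ⌋ - 1#      ≡⟨ cong (λ k → ⌊ k ⌋ - 1#) (odd-reflect j j≤n) ⟩
      ⌊ suc (p ∸ (j ℕ.+ j)) ⌋ - 1#              ≡⟨ cong (_- 1#) (trans (⌊suc⌋ (p ∸ (j ℕ.+ j)))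
          (cong (1# +_) (trans (⌊∸⌋ p (j ℕ.+ j) (ℕ.m≤n⇒m≤1+n (double≤ j≤n))) (cong (λ x → P - x) (⌊+⌋ j j))))) ⟩
      1# + (P - (⌊ j ⌋ + ⌊ j ⌋)) - 1#           ≡⟨ solve 2 (λ P j → # 1 :+ (P :- (j :+ j)) :- # 1 := P :* # 1 :* # 1 :- # 2 :* j) refl P ⌊ j ⌋ ⟩
      P * 1# * 1# - ⌊ 2 ⌋ * ⌊ j ⌋               ≡⟨ cong₂ (λ x y → P * x * y - ⌊ 2 ⌋ * ⌊ j ⌋) (sym 2*½) (sym (ι-inverse′ j 1≤j (ℕ.≤-trans j≤n n≤N))) ⟩
      P * (⌊ 2 ⌋ * ½) * (⌊ j ⌋ * ι j) - ⌊ 2 ⌋ * ⌊ j ⌋   ≡⟨ solve 4 (λ P h j u → P :* (# 2 :* h) :* (j :* u) :- # 2 :* j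
          := (:- # 2) :* (j :* (# 1 :+ P :* (:- (h :* u))))) refl P ½ ⌊ j ⌋ (ι j) ⟩
      - ⌊ 2 ⌋ * (⌊ j ⌋ * (1# + P * - (½ * ι j)))        ∎
    odds : ∏ n (λ j → ⌊ j ℕ.+ j ⌋ - 1#) ≡ (- ⌊ 2 ⌋) ^ n * (D * b)
    odds = trans (∏-reverse n _) (trans (∏-cong n reflected) (trans (∏-* n _ _) (cong₂ _*_ (∏-const n (- ⌊ 2 ⌋)) (∏-* n _ _))))
    c-value : c ≡ ⌊ 2 ⌋ ^ n * ((- ⌊ 2 ⌋) ^ n * b)
    c-value = begin
      c                                                        ≡⟨ sym (*-identityʳ c) ⟩
      c * 1#                                                   ≡⟨ cong (c *_) (sym D-unit) ⟩
      c * (D * D⁻¹)                                            ≡⟨ sym (*-assoc _ _ _) ⟩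
      c * D * D⁻¹                                              ≡⟨ cong (_* D⁻¹) (trans (central-binomial n) (cong (⌊ 2 ⌋ ^ n *_) odds)) ⟩
      ⌊ 2 ⌋ ^ n * ((- ⌊ 2 ⌋) ^ n * (D * b)) * D⁻¹              ≡⟨ solve 5
          (λ x y d b i → x :* (y :* (d :* b)) :* i := x :* (y :* b) :* (d :* i)) refl (⌊ 2 ⌋ ^ n) ((- ⌊ 2 ⌋) ^ n) D b D⁻¹ ⟩
      ⌊ 2 ⌋ ^ n * ((- ⌊ 2 ⌋) ^ n * b) * (D * D⁻¹)              ≡⟨ cong (⌊ 2 ⌋ ^ n * ((- ⌊ 2 ⌋) ^ n * b) *_) D-unit ⟩
      ⌊ 2 ⌋ ^ n * ((- ⌊ 2 ⌋) ^ n * b) * 1#                     ≡⟨ *-identityʳ _ ⟩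
      ⌊ 2 ⌋ ^ n * ((- ⌊ 2 ⌋) ^ n * b)                          ∎

  -- The logarithm of `product-1-p/j` with Q = 1 + pq. The sums of 1/(2j)^a are h_a/2^a, cleared by
  -- the factor 16; h_2 is then expressed by T and h_4 drops out, so that h_1 remains modulo p⁴.
  h₁-value : ⌊ 24 ⌋ * h 1 - ⌊ 7 ⌋ * P ^ 2 * T + ⌊ 48 ⌋ * q - ⌊ 24 ⌋ * P * q ^ 2 + ⌊ 16 ⌋ * P ^ 2 * q ^ 3 - ⌊ 12 ⌋ * P ^ 3 * q ^ 4 ≈[ 4 ] 0#
  h₁-value = cancel 4 p∤4 (cancel-P regular 1 (combine
    (null-+ (null-+ (null-+ (null-+ (null-+ (null-* (- ⌊ 16 ⌋) (difference additive)) (null-* ⌊ 16 ⌋ (difference (lg-harmonic 1# n))))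
        (null-* (- ⌊ 16 ⌋) (difference (lg-harmonic ½ n)))) (null-* (- ⌊ 12 ⌋) (null-P 2 h₂-value))) (null-* (- ⌊ 45 ⌋) (null-P 4 h₄-null)))
        (≈-reflexive halves))
    (solve 12 (λ P A B a b c d e f g i q → P :^ 1 :* (# 4 :* (# 24 :* a :- # 7 :* P :^ 2 :* c :+ # 48 :* q :- # 24 :* P :* q :^ 2 :+ # 16 :*
        P :^ 2 :* q :^ 3 :- # 12 :* P :^ 3 :* q :^ 4)) :- # 0 := (:- # 16) :*
        (A :- (# 12 :* (P :* q) :- # 6 :* (P :* q) :^ 2 :+ # 4 :* (P :* q) :^ 3 :- # 3 :* (P :* q) :^ 4 :+ B)) :+ # 16 :*
        (A :- (:- (# 12 :* P :* (# 1 :^ 1 :* a) :+ # 6 :* P :^ 2 :* (# 1 :^ 2 :* b) :+ # 4 :* P :^ 3 :* (# 1 :^ 3 :* c) :+ # 3 :* P :^ 4 :*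
        (# 1 :^ 4 :* d)))) :+ (:- # 16) :* (B :- (:- (# 12 :* P :* e :+ # 6 :* P :^ 2 :* f :+ # 4 :* P :^ 3 :* g :+ # 3 :* P :^ 4 :* i))) :+
        (:- # 12) :* (P :^ 2 :* (# 6 :* b :+ # 7 :* P :* c)) :+ (:- # 45) :* (P :^ 4 :* d) :+
        (# 12 :* P :* (# 16 :* e :- # 8 :* a) :+ # 6 :* P :^ 2 :* (# 16 :* f :- # 4 :* b) :+ # 4 :* P :^ 3 :*
        (# 16 :* g :- # 2 :* c) :+ # 3 :* P :^ 4 :* (# 16 :* i :- # 1 :* d))) refl P (lg (P * Y)) (lg (P * Z)) (h 1) (h 2) (h 3) (h 4)
        (½ ^ 1 * h 1) (½ ^ 2 * h 2) (½ ^ 3 * h 3) (½ ^ 4 * h 4) q)))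
    where
    Y Z : A
    Y = excess (λ k → - (1# * ι k)) n
    Z = excess (λ k → - (½ * ι k)) n
    PY≡ : P * Y ≡ P * (q + Z + P * (q * Z))
    PY≡ = begin
      P * Y                                    ≡⟨ solve 2 (λ P Y → P :* Y := # 1 :+ P :* Y :- # 1) refl P Y ⟩
      (1# + P * Y) - 1#                        ≡⟨ cong (_- 1#) (trans product-1-p/j (cong (_* (1# + P * Z)) Q≡1+Pq)) ⟩
      (1# + P * q) * (1# + P * Z) - 1#         ≡⟨ solve 3 (λ P q Z → (# 1 :+ P :* q) :* (# 1 :+ P :* Z) :- # 1
          := P :* (q :+ Z :+ P :* (q :* Z))) refl P q Z ⟩
      P * (q + Z + P * (q * Z))                ∎
    additive : lg (P * Y) ≈[ 5 ] lg (P * q) + lg (P * Z)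
    additive = ≈-trans (≈-reflexive (cong lg PY≡)) (lg-product q Z)
    scaled : ∀ c a b → ⌊ c ⌋ ≡ ⌊ b ⌋ * ⌊ 2 ⌋ ^ a → ⌊ c ⌋ * (½ ^ a * h a) - ⌊ b ⌋ * h a ≡ 0#
    scaled c a b eq = trans (cong (_- ⌊ b ⌋ * h a) (scale-½ c a b eq)) (solve 1 (λ x → x :- x := # 0) refl (⌊ b ⌋ * h a))
    halves : ⌊ 12 ⌋ * P * (⌊ 16 ⌋ * (½ ^ 1 * h 1) - ⌊ 8 ⌋ * h 1) + ⌊ 6 ⌋ * P ^ 2 * (⌊ 16 ⌋ * (½ ^ 2 * h 2) - ⌊ 4 ⌋ * h 2) + ⌊ 4 ⌋ * P ^ 3 *
        (⌊ 16 ⌋ * (½ ^ 3 * h 3) - ⌊ 2 ⌋ * h 3) + ⌊ 3 ⌋ * P ^ 4 * (⌊ 16 ⌋ * (½ ^ 4 * h 4) - ⌊ 1 ⌋ * h 4) ≡ 0#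
    halves = trans (cong₂ _+_ (cong₂ _+_ (cong₂ _+_
        (cong (⌊ 12 ⌋ * P *_) (scaled 16 1 8 (solve 0 (# 16 := # 8 :* # 2 :^ 1) refl)))
        (cong (⌊ 6 ⌋ * P ^ 2 *_) (scaled 16 2 4 (solve 0 (# 16 := # 4 :* # 2 :^ 2) refl))))
        (cong (⌊ 4 ⌋ * P ^ 3 *_) (scaled 16 3 2 (solve 0 (# 16 := # 2 :* # 2 :^ 3) refl))))
        (cong (⌊ 3 ⌋ * P ^ 4 *_) (scaled 16 4 1 (solve 0 (# 16 := # 1 :* # 2 :^ 4) refl))))
      (solve 1 (λ P → # 12 :* P :* # 0 :+ # 6 :* P :^ 2 :* # 0 :+ # 4 :* P :^ 3 :* # 0 :+ # 3 :* P :^ 4 :* # 0 := # 0) refl P)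

-- Sums weighted by powers of two

module PowersOfTwo (n : ℕ) (p-prime : Prime (suc (n ℕ.+ n))) (5<p : 5 < suc (n ℕ.+ n)) (L : LocalRing (suc (n ℕ.+ n))) where
  open TruncatedLogarithm n p-prime 5<p L public
  open ≡-Reasoning

  [-1]^double : ∀ j → (- 1#) ^ (j ℕ.+ j) ≡ 1#
  [-1]^double j = trans (^-double (- 1#) j) (trans (cong (_^ j) (solve 0 ((:- # 1) :* (:- # 1) := # 1) refl)) (1^ j))

  [-1]^p∸ : ∀ k → k ≤ p → (- 1#) ^ (p ∸ k) ≡ - (- 1#) ^ k
  [-1]^p∸ k k≤p = begin
    (- 1#) ^ (p ∸ k)                                     ≡⟨ sym (*-identityʳ _) ⟩
    (- 1#) ^ (p ∸ k) * 1#                                ≡⟨ cong ((- 1#) ^ (p ∸ k) *_) (sym (trans (sym (^-homo-* (- 1#) k k)) ([-1]^double k))) ⟩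
    (- 1#) ^ (p ∸ k) * ((- 1#) ^ k * (- 1#) ^ k)         ≡⟨ sym (*-assoc _ _ _) ⟩
    (- 1#) ^ (p ∸ k) * (- 1#) ^ k * (- 1#) ^ k           ≡⟨ cong (_* (- 1#) ^ k)
        (trans (sym (^-homo-* (- 1#) (p ∸ k) k)) (cong ((- 1#) ^_) (ℕ.m∸n+n≡m k≤p))) ⟩
    - 1# * (- 1#) ^ N * (- 1#) ^ k                       ≡⟨ cong (λ x → - 1# * x * (- 1#) ^ k) [-1]^N ⟩
    - 1# * 1# * (- 1#) ^ k                               ≡⟨ solve 1 (λ x → (:- # 1) :* # 1 :* x := (:- x)) refl ((- 1#) ^ k) ⟩
    - (- 1#) ^ k                                         ∎

  ∑-alternating : ∀ (f : ℕ → A) → ∑ N (λ k → (- 1#) ^ k * f k) ≡ ∑ n (λ j → f (j ℕ.+ j)) - ∑ n (λ j → f (p ∸ (j ℕ.+ j)))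
  ∑-alternating f = trans (∑-even-odd n _) (cong₂ _+_
    (∑-cong n λ j _ _ → trans (cong (_* f (j ℕ.+ j)) ([-1]^double j)) (*-identityˡ _))
    (trans (∑-cong n λ j _ j≤n → trans (cong (_* f (p ∸ (j ℕ.+ j))) (trans ([-1]^p∸ (j ℕ.+ j) (ℕ.m≤n⇒m≤1+n (double≤ j≤n)))
        (cong -_ ([-1]^double j)))) (solve 1 (λ x → (:- # 1) :* x := (:- x)) refl (f (p ∸ (j ℕ.+ j))))) (∑-neg n _)))

  ∑-alternating-ι : ∑ N (λ k → (- 1#) ^ k * ι k ^ 1) ≡ h 1 - S 1
  ∑-alternating-ι = begin
    ∑ N (λ k → (- 1#) ^ k * ι k ^ 1)       ≡⟨ ∑-alternating (λ k → ι k ^ 1) ⟩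
    E - O                                  ≡⟨ solve 2 (λ E O → E :- O := # 2 :* E :- (E :+ O)) refl E O ⟩
    ⌊ 2 ⌋ * E - (E + O)                    ≡⟨ cong₂ _-_ (trans (cong (⌊ 2 ⌋ *_) (H-double 1))
        (trans (scale-½ 2 1 1 (solve 0 (# 2 := # 1 :* # 2 :^ 1) refl)) (*-identityˡ _))) (sym (∑-even-odd n _)) ⟩
    h 1 - S 1                              ∎
    where
    E O : A
    E = ∑ n (λ j → ι (j ℕ.+ j) ^ 1)
    O = ∑ n (λ j → ι (p ∸ (j ℕ.+ j)) ^ 1)

  -- By absorption -2p W_j/j² is C(p,j) (-2)^j / j. Pascal's rule splits C(p,j): the part with
  -- C(p-1,j) becomes the sum of ((-1)^m - 1)/m by `transform-ι`, and the part with C(p-1,j-1) is -2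
  -- w_1.
  w₂-value : - ⌊ 2 ⌋ * P * w 2 ≡ h 1 - ⌊ 2 ⌋ * S 1 + ⌊ 2 ⌋ * q
  w₂-value = begin
    - ⌊ 2 ⌋ * P * w 2
      ≡⟨ sym (∑-*ˡ N (- ⌊ 2 ⌋ * P) _) ⟩
    ∑ N (λ j → - ⌊ 2 ⌋ * P * (W j * ι j ^ 2))
      ≡⟨ ∑-cong N (λ j 1≤j j≤N → trans (solve 3 (λ P W u → (:- # 2) :* P :* (W :* u :^ 2) := (:- # 2) :* P :* (W :* u) :* u) refl P (W j)
          (ι j)) (cong (_* ι j) (sym (W-binomial j 1≤j j≤N)))) ⟩
    ∑ N (λ j → ⌊ p C j ⌋ * (- ⌊ 2 ⌋) ^ j * ι j)
      ≡⟨ ∑-cong N (λ { (suc j) _ _ → trans (cong (λ x → x * (- ⌊ 2 ⌋) ^ suc j * ι (suc j)) (pascal N j))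
          (solve 4 (λ a b y u → (a :+ b) :* ((:- # 2) :* y) :* u := b :* ((:- # 2) :* y :* (u :* # 1)) :+ (:- # 2) :* (a :* y :* u :^ 1))
          refl ⌊ N C j ⌋ ⌊ N C suc j ⌋ ((- ⌊ 2 ⌋) ^ j) (ι (suc j))) }) ⟩
    ∑ N (λ j → ⌊ N C j ⌋ * ((- ⌊ 2 ⌋) ^ j * (ι j * 1#)) + - ⌊ 2 ⌋ * (W j * ι j ^ 1))
      ≡⟨ trans (∑-+ N _ _) (cong₂ _+_ (transform-ι ι (- ⌊ 2 ⌋) (λ _ → 1#) N ι-inverse′) (∑-*ˡ N (- ⌊ 2 ⌋) _)) ⟩
    ∑ N (λ m → ι m * binomial-transform (- ⌊ 2 ⌋) (λ _ → 1#) m) + - ⌊ 2 ⌋ * w 1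
      ≡⟨ cong (_+ - ⌊ 2 ⌋ * w 1) (∑-cong N λ m _ _ → trans (cong (ι m *_) (signs m))
          (solve 2 (λ u s → u :* (s :- # 1) := s :* u :^ 1 :- u :^ 1) refl (ι m) ((- 1#) ^ m))) ⟩
    ∑ N (λ m → (- 1#) ^ m * ι m ^ 1 - ι m ^ 1) + - ⌊ 2 ⌋ * w 1
      ≡⟨ cong (_+ - ⌊ 2 ⌋ * w 1) (trans (∑-minus N _ _) (cong (_- S 1) ∑-alternating-ι)) ⟩
    h 1 - S 1 - S 1 + - ⌊ 2 ⌋ * w 1
      ≡⟨ solve 3 (λ h S w → h :- S :- S :+ (:- # 2) :* w := h :- # 2 :* S :+ # 2 :* (:- w)) refl (h 1) (S 1) (w 1) ⟩
    h 1 - ⌊ 2 ⌋ * S 1 + ⌊ 2 ⌋ * q ∎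
    where
    signs : ∀ m → binomial-transform (- ⌊ 2 ⌋) (λ _ → 1#) m ≡ (- 1#) ^ m - 1#
    signs m = trans (∑-cong m λ k _ _ → cong (⌊ m C k ⌋ *_) (*-identityʳ _))
        (trans (transform-one (- ⌊ 2 ⌋) m) (cong (λ x → x ^ m - 1#) (solve 0 (# 1 :+ :- # 2 := :- # 1) refl)))

  p∤between : ∀ k → p < k → k ≤ p ℕ.+ N → ¬ p ∣ k
  p∤between k p<k k≤ p∣k = p∤ (k ∸ p) (ℕ.m<n⇒0<n∸m p<k) (ℕ.≤-trans (ℕ.∸-monoˡ-≤ p k≤) (ℕ.≤-reflexive (ℕ.m+n∸m≡n p N)))
    (∣m+n∣m⇒∣n (subst (p ∣_) (sym (ℕ.m+[n∸m]≡n (ℕ.<⇒≤ p<k))) p∣k) ∣-refl)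

  private
    -- The quotient p/k as an element of the ring. At k = p it is 1, which cannot be written as `P`
    -- times an inverse.
    ψ : ℕ → A
    ψ k with k ℕ.≟ p
    ... | yes _ = 1#
    ... | no _ = P * ι k

    ψ-p : ψ p ≡ 1#
    ψ-p with p ℕ.≟ p
    ... | yes _ = refl
    ... | no p≢p = ⊥-elim (p≢p refl)

    ψ-other : ∀ k → k ≢ p → ψ k ≡ P * ι k
    ψ-other k k≢p with k ℕ.≟ p
    ... | yes k≡p = ⊥-elim (k≢p k≡p)
    ... | no _ = refl

    ψ-spec : ∀ i → p ≤ i → i ≤ p ℕ.+ N → ⌊ i ⌋ * ψ i ≡ P
    ψ-spec i p≤i i≤ with i ℕ.≟ p
    ... | yes refl = *-identityʳ P
    ... | no i≢p = trans (solve 3 (λ i P u → i :* (P :* u) := P :* (i :* u)) refl ⌊ i ⌋ P (ι i))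
        (trans (cong (P *_) (ι-inverse i (p∤between i (ℕ.≤∧≢⇒< p≤i (λ p≡i → i≢p (sym p≡i))) i≤))) (*-identityʳ P))

    module _ (j : ℕ) (1≤j : 1 ≤ j) (j≤N : j ≤ N) where
      p<2p∸j : p < p ℕ.+ p ∸ j
      p<2p∸j = subst (p <_) (sym (ℕ.+-∸-assoc p (ℕ.m≤n⇒m≤1+n j≤N))) (ℕ.≤-trans (ℕ.≤-reflexive (ℕ.+-comm 1 p)) (ℕ.+-monoʳ-≤ p (1≤p∸ j≤N)))

      2p∸j≤ : p ℕ.+ p ∸ j ≤ p ℕ.+ N
      2p∸j≤ = subst (_≤ p ℕ.+ N) (sym (ℕ.+-∸-assoc p (ℕ.m≤n⇒m≤1+n j≤N))) (ℕ.+-monoʳ-≤ p (p∸≤ 1≤j))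

      ι-2p∸j : ι (p ℕ.+ p ∸ j) ≈[ 4 ] - (ι j + ⌊ 2 ⌋ * P * ι j ^ 2 + ⌊ 4 ⌋ * P ^ 2 * ι j ^ 3 + ⌊ 8 ⌋ * P ^ 3 * ι j ^ 4)
      ι-2p∸j = (⌊ 16 ⌋ * (ι j ^ 4 * v)) by trans (reflected-inverse-expand {⌊ 2 ⌋ * P} (reflected-inverse (ι-inverse′ j 1≤j j≤N)
          (trans (cong (_* v) (trans (cong (_- ⌊ j ⌋) (trans (solve 1 (λ P → # 2 :* P := P :+ P) refl P) (sym (⌊+⌋ p p))))
              (sym (⌊∸⌋ (p ℕ.+ p) j (ℕ.≤-trans (ℕ.m≤n⇒m≤1+n j≤N) (ℕ.m≤m+n p p))))))
            (ι-inverse (p ℕ.+ p ∸ j) (p∤between _ p<2p∸j 2p∸j≤)))))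
          (solve 3 (λ P u v → (:- (u :+ # 2 :* P :* u :^ 2 :+ (# 2 :* P) :^ 2 :* u :^ 3 :+ (# 2 :* P) :^ 3 :* u :^ 4)) :+ (# 2 :* P) :^ 4 :*
              (u :^ 4 :* v) := (:- (u :+ # 2 :* P :* u :^ 2 :+ # 4 :* P :^ 2 :* u :^ 3 :+ # 8 :* P :^ 3 :* u :^ 4)) :+ P :^ 4 :*
              (# 16 :* (u :^ 4 :* v))) refl P (ι j) v)
        where
        v = ι (p ℕ.+ p ∸ j)

  -- 4^(p-1) is the initial half of the row 2p - 1, whose partial fractions have the denominators 2p
  -- - j for 1 ≤ j ≤ p. The term j = p has denominator p and contributes (-2)^(p-1) = Q without the
  -- factor p of the others.
  Q²-exact : Q ^ 2 ≡ C₂ₚ * (Q + P * ∑ N (λ j → W j * ι (p ℕ.+ p ∸ j)))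
  Q²-exact = trans (trans (sym four) (sym (initial-binomial-sum-half N))) (trans reduced (cong (C₂ₚ *_) J-value))
    where
    m = p ℕ.+ N
    J : A
    J = alternating-2-transform ψ N m
    four : ⌊ 4 ⌋ ^ N ≡ Q ^ 2
    four = trans (cong (_^ N) (solve 0 (# 4 := # 2 :* # 2) refl)) (trans (^-distrib-* ⌊ 2 ⌋ ⌊ 2 ⌋ N) (solve 1 (λ x → x :* x := x :^ 2) refl Q))
    m∸N : m ∸ N ≡ p
    m∸N = ℕ.m+n∸n≡m p N
    fractions : P * initial-binomial-sum N m ≡ P * (C₂ₚ * J)
    fractions = begin
      P * initial-binomial-sum N m
        ≡⟨ initial-binomial-sum-fractions ψ P ι N m ι-inverse′ (s≤s (ℕ.m≤m+n N N)) (λ i lo hi → ψ-spec i (subst (_≤ i) m∸N lo) hi) ⟩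
      (- 1#) ^ N * ((⌊ m ⌋ - ⌊ N ⌋) * C₂ₚ * J)
        ≡⟨ cong₂ (λ x y → x * (y * C₂ₚ * J)) [-1]^N (trans (cong (_- ⌊ N ⌋) (⌊+⌋ p N)) (solve 2 (λ P x → P :+ x :- x := P) refl P ⌊ N ⌋)) ⟩
      1# * (P * C₂ₚ * J)
        ≡⟨ solve 3 (λ P c j → # 1 :* (P :* c :* j) := P :* (c :* j)) refl P C₂ₚ J ⟩
      P * (C₂ₚ * J) ∎
    reduced : initial-binomial-sum N m ≡ C₂ₚ * J
    reduced = begin
      initial-binomial-sum N m
        ≡⟨ solve 2 (λ x y → x := y :+ (x :- y)) refl (initial-binomial-sum N m) (C₂ₚ * J) ⟩
      C₂ₚ * J + (initial-binomial-sum N m - C₂ₚ * J)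
        ≡⟨ cong (C₂ₚ * J +_) (regular (trans (solve 3 (λ P x y → P :* (x :- y) := P :* x :- P :* y) refl P (initial-binomial-sum N m)
            (C₂ₚ * J)) (trans (cong (_- P * (C₂ₚ * J)) fractions) (solve 1 (λ x → x :- x := # 0) refl (P * (C₂ₚ * J)))))) ⟩
      C₂ₚ * J + 0#
        ≡⟨ +-identityʳ _ ⟩
      C₂ₚ * J ∎
    g : ℕ → A
    g j = ⌊ N C (j ∸ 1) ⌋ * ((- ⌊ 2 ⌋) ^ (j ∸ 1) * ψ (m ∸ (j ∸ 1)))
    g-value : ∀ j → 1 ≤ j → j ≤ N → g j ≡ P * (W j * ι (p ℕ.+ p ∸ j))
    g-value (suc j) 1≤j j≤N = trans (cong (λ k → a * (y * ψ k)) index)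
        (trans (cong (λ z → a * (y * z)) (ψ-other (p ℕ.+ p ∸ suc j) (λ eq → ℕ.<⇒≢ (p<2p∸j (suc j) 1≤j j≤N) (sym eq))))
      (solve 4 (λ a y P v → a :* (y :* (P :* v)) := P :* (a :* y :* v)) refl a y P (ι (p ℕ.+ p ∸ suc j))))
      where
      a = ⌊ N C j ⌋
      y = (- ⌊ 2 ⌋) ^ j
      index : m ∸ j ≡ p ℕ.+ p ∸ suc j
      index = cong (_∸ suc j) (sym (ℕ.+-suc p N))
    g-last : g p ≡ Q
    g-last = trans (cong₂ (λ x y → x * ((- ⌊ 2 ⌋) ^ N * y)) (⌊nCn⌋ N) (trans (cong ψ m∸N) ψ-p))
        (trans (solve 1 (λ x → # 1 :* (x :* # 1) := x) refl ((- ⌊ 2 ⌋) ^ N)) [-2]^N)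
    J-value : J ≡ Q + P * ∑ N (λ j → W j * ι (p ℕ.+ p ∸ j))
    J-value = begin
      J
        ≡⟨ alternating-2-transform-expand ψ N m ⟩
      ψ m + ∑ N (λ i → ⌊ N C i ⌋ * ((- ⌊ 2 ⌋) ^ i * ψ (m ∸ i)))
        ≡⟨ cong (_+ ∑ N (λ i → ⌊ N C i ⌋ * ((- ⌊ 2 ⌋) ^ i * ψ (m ∸ i))))
            (sym (trans (cong (_* (1# * ψ m)) (⌊nC0⌋ N)) (solve 1 (λ x → # 1 :* (# 1 :* x) := x) refl (ψ m)))) ⟩
      g 1 + ∑ N (λ i → g (suc i))
        ≡⟨ sym (∑-first N g) ⟩
      ∑ N g + g p
        ≡⟨ cong₂ _+_ (trans (∑-cong N g-value) (∑-*ˡ N P _)) g-last ⟩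
      P * ∑ N (λ j → W j * ι (p ℕ.+ p ∸ j)) + Q
        ≡⟨ +-comm _ _ ⟩
      Q + P * ∑ N (λ j → W j * ι (p ℕ.+ p ∸ j)) ∎

  Q²-value : Q ^ 2 ≈[ 5 ] C₂ₚ * (Q - P * (w 1 + ⌊ 2 ⌋ * P * w 2 + ⌊ 4 ⌋ * P ^ 2 * w 3 + ⌊ 8 ⌋ * P ^ 3 * w 4))
  Q²-value = ≈-trans (≈-reflexive Q²-exact) (≈-*ˡ C₂ₚ (combine (null-P 1 (difference expanded))
    (solve 4 (λ Q P x y → Q :+ P :* x :- (Q :- P :* y) := P :^ 1 :* (x :- (:- y))) refl Q P X Z)))
    where
    X Z : A
    X = ∑ N (λ j → W j * ι (p ℕ.+ p ∸ j))
    Z = w 1 + ⌊ 2 ⌋ * P * w 2 + ⌊ 4 ⌋ * P ^ 2 * w 3 + ⌊ 8 ⌋ * P ^ 3 * w 4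
    expanded : X ≈[ 4 ] - Z
    expanded = ≈-trans (≈-∑ N λ j 1≤j j≤N → ≈-*ˡ (W j) (ι-2p∸j j 1≤j j≤N)) (≈-reflexive (begin
      ∑ N (λ j → W j * - (ι j + ⌊ 2 ⌋ * P * ι j ^ 2 + ⌊ 4 ⌋ * P ^ 2 * ι j ^ 3 + ⌊ 8 ⌋ * P ^ 3 * ι j ^ 4))
        ≡⟨ ∑-cong N (λ j _ _ → solve 3 (λ W P u → W :* (:- (u :+ # 2 :* P :* u :^ 2 :+ # 4 :* P :^ 2 :* u :^ 3 :+ # 8 :* P :^ 3 :* u :^ 4))
            := (:- (# 1 :* (W :* u :^ 1) :+ # 2 :* P :* (W :* u :^ 2) :+ # 4 :* P :^ 2 :* (W :* u :^ 3) :+ # 8 :* P :^ 3 :* (W :* u :^ 4))))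
            refl (W j) P (ι j)) ⟩
      ∑ N (λ j → - (1# * (W j * ι j ^ 1) + ⌊ 2 ⌋ * P * (W j * ι j ^ 2) + ⌊ 4 ⌋ * P ^ 2 * (W j * ι j ^ 3) + ⌊ 8 ⌋ * P ^ 3 * (W j * ι j ^ 4)))
        ≡⟨ trans (∑-neg N _) (cong -_ (trans (∑-+ N _ _) (cong₂ _+_ (∑-linear₃ N 1# (⌊ 2 ⌋ * P) (⌊ 4 ⌋ * P ^ 2) _ _ _) (∑-*ˡ N (⌊ 8 ⌋ * P ^ 3) _)))) ⟩
      - (1# * w 1 + ⌊ 2 ⌋ * P * w 2 + ⌊ 4 ⌋ * P ^ 2 * w 3 + ⌊ 8 ⌋ * P ^ 3 * w 4)
        ≡⟨ cong (λ x → - (x + ⌊ 2 ⌋ * P * w 2 + ⌊ 4 ⌋ * P ^ 2 * w 3 + ⌊ 8 ⌋ * P ^ 3 * w 4)) (*-identityˡ (w 1)) ⟩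
      - Z ∎))

  h₁≈-2q : h 1 + ⌊ 2 ⌋ * q ≈[ 1 ] 0#
  h₁≈-2q = cancel 24 p∤24 (combine (null-+ (≈-drop (≈-drop (≈-drop h₁-value))) (multiple _))
    (solve 4 (λ P h T q → # 24 :* (h :+ # 2 :* q) :- # 0 := # 24 :* h :- # 7 :* P :^ 2 :* T :+ # 48 :* q :- # 24 :* P :* q :^ 2 :+ # 16 :*
        P :^ 2 :* q :^ 3 :- # 12 :* P :^ 3 :* q :^ 4 :+ P :^ 1 :* (# 7 :* P :* T :+ # 24 :* q :^ 2 :- # 16 :* P :* q :^ 3 :+ # 12 :* P :^
        2 :* q :^ 4)) refl P (h 1) T q))

  S₁-null : S 1 ≈[ 1 ] 0#
  S₁-null = cancel 6 p∤6 (combine (null-+ (≈-drop (≈-drop (≈-drop S₁-value))) (multiple _))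
      (solve 3 (λ P S T → # 6 :* S :- # 0 := # 6 :* S :- P :^ 2 :* T :+ P :^ 1 :* (P :* T)) refl P (S 1) T))

  -- `Q²-value` with w_1, w_2, h_1, S_1 and C(2p-1,p-1) inserted. All terms below p³ cancel, and
  -- dividing by p³ leaves the modulus p². Where Y occurs beside h_1 and S_1 there is already a
  -- factor p⁴, so these are needed there only modulo p.
  w₃w₄-value : ⌊ 24 ⌋ * (⌊ 4 ⌋ * w 3 + ⌊ 8 ⌋ * P * w 4) + ⌊ 16 ⌋ * q ^ 3 - ⌊ 7 ⌋ * T - ⌊ 12 ⌋ * P * q ^ 4 - ⌊ 16 ⌋ * P * q * T ≈[ 2 ] 0#
  w₃w₄-value = cancel-P regular 3 (combine
    (null-+ (null-+ (null-+ (null-+ (null-+ (null-+ (null-* ⌊ 24 ⌋ (difference Q²-value′)) (null-P 1 h₁-value))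
        (null-* (- ⌊ 8 ⌋) (null-P 1 S₁-value))) (null-* (⌊ 8 ⌋ * (1# + ⌊ 2 ⌋ * P * q)) (null-P 3 (proj₂ (proj₂ C₂ₚ-value)))))
      (null-* (⌊ 24 ⌋ * Y) (null-P 4 h₁≈-2q))) (null-* (- (⌊ 48 ⌋ * Y)) (null-P 4 S₁-null))) (multiple _))
    (solve 8 (λ P q h S w3 w4 T Y → P :^ 3 :* (# 24 :* (# 4 :* w3 :+ # 8 :* P :* w4) :+ # 16 :* q :^ 3 :- # 7 :* T :- # 12 :* P :* q :^ 4 :-
        # 16 :* P :* q :* T) :- # 0 := # 24 :* ((# 1 :+ P :* q) :^ 2 :- (# 1 :+ P :^ 3 :* Y) :*
        (# 1 :+ P :* q :- P :* ((:- q) :+ (:- (h :- # 2 :* S :+ # 2 :* q)) :+ # 4 :* P :^ 2 :* w3 :+ # 8 :* P :^ 3 :* w4))) :+ P :^ 1 :*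
        (# 24 :* h :- # 7 :* P :^ 2 :* T :+ # 48 :* q :- # 24 :* P :* q :^ 2 :+ # 16 :* P :^ 2 :* q :^ 3 :- # 12 :* P :^ 3 :* q :^ 4) :+
        (:- # 8) :* (P :^ 1 :* (# 6 :* S :- P :^ 2 :* T)) :+ # 8 :* (# 1 :+ # 2 :* P :* q) :* (P :^ 3 :* (# 3 :* Y :- T)) :+ # 24 :* Y :*
        (P :^ 4 :* (h :+ # 2 :* q)) :+ (:- (# 48 :* Y)) :* (P :^ 4 :* S) :+ P :^ 5 :*
        ((:- # 24) :* P :* Y :* (# 4 :* w3 :+ # 8 :* P :* w4))) refl P q (h 1) (S 1) (w 3) (w 4) T Y))
    where
    Y : A
    Y = proj₁ C₂ₚ-value
    Q²-value′ : (1# + P * q) ^ 2 ≈[ 5 ] (1# + P ^ 3 * Y) * ((1# + P * q) - P *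
        (- q + - (h 1 - ⌊ 2 ⌋ * S 1 + ⌊ 2 ⌋ * q) + ⌊ 4 ⌋ * P ^ 2 * w 3 + ⌊ 8 ⌋ * P ^ 3 * w 4))
    Q²-value′ = ≈-trans (≈-reflexive (cong (_^ 2) (sym Q≡1+Pq))) (≈-trans Q²-value (≈-reflexive (cong₂ _*_ (proj₁ (proj₂ C₂ₚ-value))
      (cong₂ (λ x y → x - P * (y + ⌊ 4 ⌋ * P ^ 2 * w 3 + ⌊ 8 ⌋ * P ^ 3 * w 4)) Q≡1+Pq
        (cong₂ _+_ (solve 1 (λ w → w := (:- (:- w))) refl (w 1)) (trans
            (solve 2 (λ P w → # 2 :* P :* w := (:- ((:- # 2) :* P :* w))) refl P (w 2)) (cong -_ w₂-value)))))))

  λ₂ : ℕ → A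
  λ₂ a = ∑ N (λ k → ⌊ 2 ⌋ ^ k * ι k ^ a)

  V : A
  V = ∑ N (λ k → ⌊ 2 ⌋ ^ k * (H 1 (k ∸ 1) * ι k ^ 3))

  excess≈ : ∀ y m → excess y m ≈[ 1 ] ∑ m y
  excess≈ y zero = ≈-refl
  excess≈ y (suc m) = ≈-trans ((excess y m * y (suc m)) by cong (λ x → excess y m + y (suc m) + x * (excess y m * y (suc m)))
      (sym (*-identityʳ P))) (≈-+ (excess≈ y m) ≈-refl)

  -- After the powers of two are taken out, (-1)^(j-1) C(p-1,j-1) is the product of 1 - p/k over k <
  -- j, of which only the first order in p matters.
  2W : ∀ j → 1 ≤ j → j ≤ N → ⌊ 2 ⌋ * W j ≈[ 2 ] ⌊ 2 ⌋ ^ j * (1# - P * H 1 (j ∸ 1))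
  2W (suc j) 1≤j j<N = ≈-trans (≈-reflexive signed) (≈-*ˡ (⌊ 2 ⌋ ^ suc j)
      (≈-trans (≈-reflexive (signed-binomial N 1# (sym (*-identityʳ P)) j (ℕ.<⇒≤ j<N)))
    (combine (null-P 1 (difference (≈-trans (excess≈ _ j) (≈-reflexive
        (trans (∑-neg j _) (cong -_ (∑-cong j λ k _ _ → trans (*-identityˡ (ι k)) (sym (*-identityʳ (ι k))))))))))
        (solve 3 (λ P x y → # 1 :+ P :* x :- (# 1 :- P :* y) := P :^ 1 :* (x :- (:- y))) refl P (excess (λ k → - (1# * ι k)) j) (H 1 j)))))
    where
    signed : ⌊ 2 ⌋ * (⌊ N C j ⌋ * (- ⌊ 2 ⌋) ^ j) ≡ ⌊ 2 ⌋ ^ suc j * ((- 1#) ^ j * ⌊ N C j ⌋)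
    signed = trans (cong (λ x → ⌊ 2 ⌋ * (⌊ N C j ⌋ * x)) (trans (cong (_^ j) (solve 0 (:- # 2 := # 2 :* :- # 1) refl)) (^-distrib-* ⌊ 2 ⌋ (- 1#) j)))
      (solve 3 (λ c x y → # 2 :* (c :* (x :* y)) := # 2 :* x :* (y :* c)) refl ⌊ N C j ⌋ (⌊ 2 ⌋ ^ j) ((- 1#) ^ j))

  2w≈λ₂ : ∀ a → ⌊ 2 ⌋ * w a ≈[ 1 ] λ₂ a
  2w≈λ₂ a = ≈-trans (≈-reflexive (trans (sym (∑-*ˡ N ⌊ 2 ⌋ _)) (∑-cong N λ j _ _ → sym (*-assoc _ _ _))))
      (≈-∑ N λ j 1≤j j≤N → ≈-* (≈-trans (≈-drop (2W j 1≤j j≤N)) (combine (multiple _)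
      (solve 3 (λ P t x → t :* (# 1 :- P :* x) :- t := P :^ 1 :* ((:- t) :* x)) refl P (⌊ 2 ⌋ ^ j) (H 1 (j ∸ 1))))) (≈-refl {a = ι j ^ a}))

  2w₃≈ : ⌊ 2 ⌋ * w 3 ≈[ 2 ] λ₂ 3 - P * V
  2w₃≈ = ≈-trans (≈-reflexive (trans (sym (∑-*ˡ N ⌊ 2 ⌋ _)) (∑-cong N λ j _ _ → sym (*-assoc _ _ _))))
      (≈-trans (≈-∑ N λ j 1≤j j≤N → ≈-* (2W j 1≤j j≤N) (≈-refl {a = ι j ^ 3}))
    (≈-reflexive (trans (∑-cong N λ j _ _ → solve 4 (λ P t x u → t :* (# 1 :- P :* x) :* u :^ 3 := t :* u :^ 3 :- P :* (t :* (x :* u :^ 3)))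
        refl P (⌊ 2 ⌋ ^ j) (H 1 (j ∸ 1)) (ι j)) (trans (∑-minus N _ _) (cong (λ x → λ₂ 3 - x) (∑-*ˡ N P _))))))

  -- Passing from w_3 to λ_3 costs p V, and passing from w_4 to λ_4 costs nothing at this precision.
  -- What remains unknown are V and λ_4 modulo p.
  λ₂3-value : ⌊ 48 ⌋ * λ₂ 3 - ⌊ 48 ⌋ * P * V + ⌊ 96 ⌋ * P * λ₂ 4 + ⌊ 16 ⌋ * q ^ 3 - ⌊ 7 ⌋ * T - ⌊ 12 ⌋ * P * q ^ 4 - ⌊ 16 ⌋ * P * q * T ≈[ 2 ] 0#
  λ₂3-value = combine (null-+ (null-+ w₃w₄-value (null-* (- ⌊ 48 ⌋) (difference 2w₃≈))) (null-* (- ⌊ 96 ⌋) (null-P 1 (difference (2w≈λ₂ 4)))))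
    (solve 8 (λ P q T w3 w4 L3 L4 V → # 48 :* L3 :- # 48 :* P :* V :+ # 96 :* P :* L4 :+ # 16 :* q :^ 3 :- # 7 :* T :- # 12 :* P :* q :^
        4 :- # 16 :* P :* q :* T :- # 0 := # 24 :* (# 4 :* w3 :+ # 8 :* P :* w4) :+ # 16 :* q :^ 3 :- # 7 :* T :- # 12 :* P :* q :^ 4 :- #
        16 :* P :* q :* T :+ (:- # 48) :* (# 2 :* w3 :- (L3 :- P :* V)) :+ (:- # 96) :* (P :^ 1 :* (# 2 :* w4 :- L4))) refl P q T (w 3)
        (w 4) (λ₂ 3) (λ₂ 4) V)

  λ₂3-value₁ : ⌊ 48 ⌋ * λ₂ 3 + ⌊ 16 ⌋ * q ^ 3 - ⌊ 7 ⌋ * T ≈[ 1 ] 0#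
  λ₂3-value₁ = combine (null-+ (≈-drop λ₂3-value) (multiple _))
    (solve 6 (λ P q T L3 L4 V → # 48 :* L3 :+ # 16 :* q :^ 3 :- # 7 :* T :- # 0
        := # 48 :* L3 :- # 48 :* P :* V :+ # 96 :* P :* L4 :+ # 16 :* q :^ 3 :- # 7 :* T :- # 12 :* P :* q :^ 4 :- # 16 :* P :* q :* T :+
        P :^ 1 :* (# 48 :* V :- # 96 :* L4 :+ # 12 :* q :^ 4 :+ # 16 :* q :* T)) refl P q T (λ₂ 3) (λ₂ 4) V)

  λ₂1-value : λ₂ 1 ≈[ 1 ] - (⌊ 2 ⌋ * q)
  λ₂1-value = ≈-trans (≈-sym (2w≈λ₂ 1)) (≈-reflexive (solve 1 (λ w → # 2 :* w := (:- (# 2 :* (:- w)))) refl (w 1)))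

  λ₂2-value : λ₂ 2 ≈[ 1 ] - q ^ 2
  λ₂2-value = ≈-trans (≈-sym (2w≈λ₂ 2)) (combine (cancel 24 p∤24 (cancel-P regular 1 (combine
      (null-+ (null-+ (null-+ (null-* (- 1#) (≈-drop (≈-drop h₁-value))) (null-* ⌊ 8 ⌋ (≈-drop (≈-drop S₁-value)))) (multiple _))
          (null-* (- ⌊ 24 ⌋) (difference (≈-reflexive w₂-value))))
      (solve 6 (λ P q w h S T → P :^ 1 :* (# 24 :* (# 2 :* w :+ q :^ 2)) :- # 0
          := (:- # 1) :* (# 24 :* h :- # 7 :* P :^ 2 :* T :+ # 48 :* q :- # 24 :* P :* q :^ 2 :+ # 16 :* P :^ 2 :* q :^ 3 :- # 12 :* P :^
          3 :* q :^ 4) :+ # 8 :* (# 6 :* S :- P :^ 2 :* T) :+ P :^ 2 :* (T :+ # 16 :* q :^ 3 :- # 12 :* P :* q :^ 4) :+ (:- # 24) :*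
          ((:- # 2) :* P :* w :- (h :- # 2 :* S :+ # 2 :* q))) refl P q (w 2) (h 1) (S 1) T))))
    (solve 2 (λ w q → # 2 :* w :- (:- (q :^ 2)) := # 2 :* w :+ q :^ 2) refl (w 2) q))

-- Reflection modulo p, and a shuffle relation for the fourth power

module WeightFour (n : ℕ) (p-prime : Prime (suc (n ℕ.+ n))) (5<p : 5 < suc (n ℕ.+ n)) (L : LocalRing (suc (n ℕ.+ n))) where
  open PowersOfTwo n p-prime 5<p L public
  module ≈-Reasoning = SetoidReasoning (≈-setoid {1})

  ∑-by-parts : ∀ m a b → ∑ m (λ k → a k * ∑ (k ∸ 1) b) + ∑ m (λ k → b k * ∑ k a) ≡ ∑ m a * ∑ m b
  ∑-by-parts zero a b = solve 0 (# 0 :+ # 0 := # 0 :* # 0) refl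
  ∑-by-parts (suc m) a b = trans
    (solve 6 (λ x y s B b A → x :+ s :* B :+ (y :+ b :* (A :+ s)) := x :+ y :+ (s :* B :+ b :* (A :+ s))) refl
        (∑ m (λ k → a k * ∑ (k ∸ 1) b)) (∑ m (λ k → b k * ∑ k a)) (a (suc m)) (∑ m b) (b (suc m)) (∑ m a))
    (trans (cong (_+ (a (suc m) * ∑ m b + b (suc m) * (∑ m a + a (suc m)))) (∑-by-parts m a b))
    (solve 4 (λ s B b A → A :* B :+ (s :* B :+ b :* (A :+ s)) := (A :+ s) :* (B :+ b)) refl (a (suc m)) (∑ m b) (b (suc m)) (∑ m a)))

  ∑-last : ∀ k f → 1 ≤ k → ∑ k f ≡ ∑ (k ∸ 1) f + f k
  ∑-last (suc k) f _ = refl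

  ∑-∑-* : ∀ m m′ f g → ∑ m (λ k → ∑ m′ (λ l → f k * g l)) ≡ ∑ m f * ∑ m′ g
  ∑-∑-* m m′ f g = trans (∑-cong m λ k _ _ → ∑-*ˡ m′ (f k) g) (∑-*ʳ m (∑ m′ g) f)

  H-last : ∀ a k → 1 ≤ k → H a k ≡ H a (k ∸ 1) + ι k ^ a
  H-last a k = ∑-last k (λ i → ι i ^ a)

  ∑-inner-reverse : ∀ m (f : ℕ → A) → 1 ≤ m → ∑ (m ∸ 1) (λ j → f (m ∸ j)) ≡ ∑ (m ∸ 1) f
  ∑-inner-reverse (suc m) f _ = sym (∑-reverse m f)

  S₂-null : S 2 ≈[ 1 ] 0#
  S₂-null = cancel 3 p∤3 (combine (null-+ (≈-drop (≈-drop S₂-value)) (multiple _))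
      (solve 3 (λ P S T → # 3 :* S :- # 0 := # 3 :* S :+ P :* T :+ P :^ 1 :* (:- T)) refl P (S 2) T))

  h₂-null : h 2 ≈[ 1 ] 0#
  h₂-null = cancel 6 p∤6 (combine (null-+ (≈-drop (≈-drop h₂-value)) (multiple _))
      (solve 3 (λ P S T → # 6 :* S :- # 0 := # 6 :* S :+ # 7 :* P :* T :+ P :^ 1 :* ((:- # 7) :* T)) refl P (h 2) T))

  Q≈1 : Q ≈[ 1 ] 1#
  Q≈1 = q by trans Q≡1+Pq (cong (λ x → 1# + x * q) (sym (*-identityʳ P)))

  ι^-reflect : ∀ a k → 1 ≤ k → k ≤ N → ι (p ∸ k) ^ a ≈[ 1 ] (- 1#) ^ a * ι k ^ a
  ι^-reflect a k 1≤k k≤N = ≈-trans (≈-^ (ι-reflect k 1≤k k≤N) a) (≈-reflexive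
      (trans (cong (_^ a) (solve 1 (λ u → (:- u) := (:- # 1) :* u) refl (ι k))) (^-distrib-* (- 1#) (ι k) a)))

  -- As the full sum vanishes, the sum up to p - 1 - m is minus the last `m` terms, which k ↦ p - k
  -- carries to the first `m`.
  H-reflect : ∀ a m → m ≤ N → S a ≈[ 1 ] 0# → H a (N ∸ m) ≈[ 1 ] - ((- 1#) ^ a * H a m)
  H-reflect a m m≤N null = begin
    H a (N ∸ m)                                             ≡⟨ solve 2 (λ x y → x := x :+ y :- y) refl (H a (N ∸ m)) (∑ m (λ i → ι (p ∸ i) ^ a)) ⟩
    H a (N ∸ m) + ∑ m (λ i → ι (p ∸ i) ^ a) - ∑ m (λ i → ι (p ∸ i) ^ a)  
        ≡⟨ cong (_- ∑ m (λ i → ι (p ∸ i) ^ a)) (sym (∑-upper N m (λ k → ι k ^ a) m≤N)) ⟩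
    S a - ∑ m (λ i → ι (p ∸ i) ^ a)                         ≈⟨ ≈-minus null (≈-∑ m λ i 1≤i i≤m → ι^-reflect a i 1≤i (ℕ.≤-trans i≤m m≤N)) ⟩
    0# - ∑ m (λ i → (- 1#) ^ a * ι i ^ a)                   ≡⟨ cong (λ x → 0# - x) (∑-*ˡ m ((- 1#) ^ a) _) ⟩
    0# - (- 1#) ^ a * H a m                                 ≡⟨ solve 1 (λ x → # 0 :- x := (:- x)) refl ((- 1#) ^ a * H a m) ⟩
    - ((- 1#) ^ a * H a m)                                  ∎
    where open ≈-Reasoning

  H₁-reflect : ∀ m → m ≤ N → H 1 (N ∸ m) ≈[ 1 ] H 1 m
  H₁-reflect m m≤N = ≈-trans (H-reflect 1 m m≤N S₁-null) (≈-reflexive (solve 1 (λ x → (:- ((:- # 1) :^ 1 :* x)) := x) refl (H 1 m)))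

  H₂-reflect : ∀ m → m ≤ N → H 2 (N ∸ m) ≈[ 1 ] - H 2 m
  H₂-reflect m m≤N = ≈-trans (H-reflect 2 m m≤N S₂-null) (≈-reflexive (solve 1 (λ x → (:- ((:- # 1) :^ 2 :* x)) := (:- x)) refl (H 2 m)))

  H₃-reflect : ∀ m → m ≤ N → H 3 (N ∸ m) ≈[ 1 ] H 3 m
  H₃-reflect m m≤N = ≈-trans (H-reflect 3 m m≤N (≈-drop S₃-null)) (≈-reflexive (solve 1 (λ x → (:- ((:- # 1) :^ 3 :* x)) := x) refl (H 3 m)))

  ι-add : ∀ i j → 1 ≤ i → 1 ≤ j → i ℕ.+ j ≤ N → ι i * ι j ≡ ι (i ℕ.+ j) * (ι i + ι j)
  ι-add i j 1≤i 1≤j i+j≤N = begin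
    ι i * ι j                                          ≡⟨ sym (*-identityˡ _) ⟩
    1# * (ι i * ι j)                                   ≡⟨ cong (_* (ι i * ι j))
        (sym (trans (cong (_* w′) (sym (⌊+⌋ i j))) (ι-inverse′ (i ℕ.+ j) (ℕ.≤-trans 1≤i (ℕ.m≤m+n i j)) i+j≤N))) ⟩
    (⌊ i ⌋ + ⌊ j ⌋) * w′ * (ι i * ι j)                 ≡⟨ solve 5 (λ i j w u v → (i :+ j) :* w :* (u :* v)
        := w :* (i :* u :* v :+ j :* v :* u)) refl ⌊ i ⌋ ⌊ j ⌋ w′ (ι i) (ι j) ⟩
    w′ * (⌊ i ⌋ * ι i * ι j + ⌊ j ⌋ * ι j * ι i)       ≡⟨ cong₂ (λ x y → w′ * (x * ι j + y * ι i))
        (ι-inverse′ i 1≤i (ℕ.≤-trans (ℕ.m≤m+n i j) i+j≤N)) (ι-inverse′ j 1≤j (ℕ.≤-trans (ℕ.m≤n+m j i) i+j≤N)) ⟩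
    w′ * (1# * ι j + 1# * ι i)                         ≡⟨ solve 3 (λ w u v → w :* (# 1 :* v :+ # 1 :* u) := w :* (u :+ v)) refl w′ (ι i) (ι j) ⟩
    w′ * (ι i + ι j)                                   ∎
    where
    open ≡-Reasoning
    w′ = ι (i ℕ.+ j)

  ι-add′ : ∀ m j → 1 ≤ j → j ≤ m ∸ 1 → m ≤ N → ι j * ι (m ∸ j) ≡ ι m * (ι j + ι (m ∸ j))
  ι-add′ zero zero ()
  ι-add′ zero (suc _) _ ()
  ι-add′ m@(suc _) j 1≤j j≤m m≤N = trans (ι-add j (m ∸ j) 1≤j (ℕ.m<n⇒0<n∸m (s≤s j≤m)) (subst (_≤ N) (sym j+[m∸j]) m≤N))
      (cong (λ k → ι k * (ι j + ι (m ∸ j))) j+[m∸j])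
    where
    j+[m∸j] : j ℕ.+ (m ∸ j) ≡ m
    j+[m∸j] = ℕ.m+[n∸m]≡n (ℕ.m≤n⇒m≤1+n j≤m)

  -- The mixed sum that stays beside λ_4 when λ_1 λ_3 and λ_2² are multiplied out.
  W₁₃ : A
  W₁₃ = ∑ N (λ k → ⌊ 2 ⌋ ^ k * (ι k * H 3 (k ∸ 1)))

  -- 1/(kl³) + 1/(k³l) - 1/(k²l²) = (1/(k+l)) (1/k³ + 1/l³); the pairs with k + l > p wrap around modulo p.
  λ₂-shuffle : ⌊ 2 ⌋ * (λ₂ 1 * λ₂ 3) - λ₂ 2 * λ₂ 2 ≈[ 1 ] - (⌊ 2 ⌋ * W₁₃) - ⌊ 4 ⌋ * λ₂ 4
  λ₂-shuffle = begin
    ⌊ 2 ⌋ * (λ₂ 1 * λ₂ 3) - λ₂ 2 * λ₂ 2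
      ≡⟨ square ⟩
    ∑ N (λ k → ∑ N (f k))
      ≡⟨ ∑-cong N (λ k 1≤k k≤N → trans (∑-upper N k (f k) k≤N) (cong (∑ (N ∸ k) (f k) +_) (∑-last k _ 1≤k))) ⟩
    ∑ N (λ k → ∑ (N ∸ k) (f k) + (∑ (k ∸ 1) (λ i → f k (p ∸ i)) + f k (p ∸ k)))
      ≡⟨ trans (∑-+ N _ _) (cong (∑ N (λ k → ∑ (N ∸ k) (f k)) +_) (∑-+ N _ _)) ⟩
    ∑ N (λ k → ∑ (N ∸ k) (f k)) + (∑ N (λ k → ∑ (k ∸ 1) (λ i → f k (p ∸ i))) + ∑ N (λ k → f k (p ∸ k)))
      ≈⟨ ≈-+ (≈-reflexive lower) (≈-+ upper diagonal) ⟩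
    ⌊ 2 ⌋ * W₁₃ + (- (⌊ 4 ⌋ * (W₁₃ + λ₂ 4)) + 0#)
      ≡⟨ solve 2 (λ W l → # 2 :* W :+ ((:- (# 4 :* (W :+ l))) :+ # 0) := (:- (# 2 :* W)) :- # 4 :* l) refl W₁₃ (λ₂ 4) ⟩
    - (⌊ 2 ⌋ * W₁₃) - ⌊ 4 ⌋ * λ₂ 4 ∎
    where
    open ≈-Reasoning
    φ : A → A → A
    φ u v = u * v ^ 3 + u ^ 3 * v - u ^ 2 * v ^ 2
    f : ℕ → ℕ → A
    f k l = ⌊ 2 ⌋ ^ (k ℕ.+ l) * φ (ι k) (ι l)
    t : ℕ → ℕ → A
    t a k = ⌊ 2 ⌋ ^ k * ι k ^ a
    square : ⌊ 2 ⌋ * (λ₂ 1 * λ₂ 3) - λ₂ 2 * λ₂ 2 ≡ ∑ N (λ k → ∑ N (f k))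
    square = sym (trans (∑-cong N λ k _ _ → trans (∑-cong N λ l _ _ → trans (cong (_* φ (ι k) (ι l)) (^-homo-* ⌊ 2 ⌋ k l))
        (solve 4 (λ x y u v → x :* y :* (u :* v :^ 3 :+ u :^ 3 :* v :- u :^ 2 :* v :^ 2)
            := x :* u :^ 1 :* (y :* v :^ 3) :+ x :* u :^ 3 :* (y :* v :^ 1) :- x :* u :^ 2 :* (y :* v :^ 2)) refl (⌊ 2 ⌋ ^ k) (⌊ 2 ⌋ ^ l)
            (ι k) (ι l))) (trans (∑-minus N _ _) (cong (_- ∑ N (λ l → t 2 k * t 2 l)) (∑-+ N _ _))))
      (trans (∑-minus N _ _) (trans (cong₂ _-_ (trans (∑-+ N _ _) (cong₂ _+_ (∑-∑-* N N (t 1) (t 3)) (∑-∑-* N N (t 3) (t 1))))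
          (∑-∑-* N N (t 2) (t 2)))
        (solve 3 (λ a b c → a :* c :+ c :* a :- b :* b := # 2 :* (a :* c) :- b :* b) refl (λ₂ 1) (λ₂ 2) (λ₂ 3)))))
    lower : ∑ N (λ k → ∑ (N ∸ k) (f k)) ≡ ⌊ 2 ⌋ * W₁₃
    lower = trans (∑-triangle N f) (trans (∑-cong N inner) (∑-*ˡ N ⌊ 2 ⌋ _))
      where
      inner : ∀ m → 1 ≤ m → m ≤ N → ∑ (m ∸ 1) (λ j → f j (m ∸ j)) ≡ ⌊ 2 ⌋ * (⌊ 2 ⌋ ^ m * (ι m * H 3 (m ∸ 1)))
      inner m 1≤m m≤N = trans (∑-cong (m ∸ 1) term) (trans (∑-*ˡ (m ∸ 1) (⌊ 2 ⌋ ^ m * ι m) _)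
        (trans (cong (⌊ 2 ⌋ ^ m * ι m *_) (trans (∑-+ (m ∸ 1) _ _) (cong (H 3 (m ∸ 1) +_) (∑-inner-reverse m (λ k → ι k ^ 3) 1≤m))))
          (solve 3 (λ x u H → x :* u :* (H :+ H) := # 2 :* (x :* (u :* H))) refl (⌊ 2 ⌋ ^ m) (ι m) (H 3 (m ∸ 1)))))
        where
        term : ∀ j → 1 ≤ j → j ≤ m ∸ 1 → f j (m ∸ j) ≡ ⌊ 2 ⌋ ^ m * ι m * (ι j ^ 3 + ι (m ∸ j) ^ 3)
        term j 1≤j j≤m = trans (cong (λ k → ⌊ 2 ⌋ ^ k * φ u v) (ℕ.m+[n∸m]≡n (ℕ.≤-trans j≤m (ℕ.m∸n≤m m 1))))
          (trans (solve 3 (λ x u v → x :* (u :* v :^ 3 :+ u :^ 3 :* v :- u :^ 2 :* v :^ 2) := x :* (u :* v :* (u :^ 2 :- u :* v :+ v :^ 2)))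
              refl (⌊ 2 ⌋ ^ m) u v)
          (trans (cong (λ y → ⌊ 2 ⌋ ^ m * (y * (u ^ 2 - u * v + v ^ 2))) (ι-add′ m j 1≤j j≤m m≤N))
          (solve 4 (λ x u v w → x :* (w :* (u :+ v) :* (u :^ 2 :- u :* v :+ v :^ 2)) := x :* w :* (u :^ 3 :+ v :^ 3)) refl (⌊ 2 ⌋ ^ m) u v (ι m))))
          where
          u = ι j
          v = ι (m ∸ j)
    -- Pairs with k + l > p are written k = m + i and l = p - i; then 2^(k+l) = 2^m · 2^p ≡ 2 · 2^m
    -- and 1/l ≡ -1/i.
    upper : ∑ N (λ k → ∑ (k ∸ 1) (λ i → f k (p ∸ i))) ≈[ 1 ] - (⌊ 4 ⌋ * (W₁₃ + λ₂ 4))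
    upper = begin
      ∑ N (λ k → ∑ (k ∸ 1) (λ i → f k (p ∸ i)))
        ≡⟨ ∑-cong N (λ k 1≤k k≤N → trans (sym (∑-inner-reverse k (λ i → f k (p ∸ i)) 1≤k))
            (∑-cong (k ∸ 1) λ m _ m≤ → cong (λ j → f j (p ∸ (k ∸ m))) (sym (ℕ.m+[n∸m]≡n (ℕ.≤-trans m≤ (ℕ.m∸n≤m k 1)))))) ⟩
      ∑ N (λ k → ∑ (k ∸ 1) (λ m → g m (k ∸ m)))
        ≡⟨ sym (∑-triangle N g) ⟩
      ∑ N (λ m → ∑ (N ∸ m) (g m))
        ≈⟨ ≈-∑ N (λ m 1≤m m≤N → ≈-trans (≈-∑ (N ∸ m) λ i 1≤i i≤ → term m i 1≤m 1≤i
            (ℕ.≤-trans (ℕ.+-monoʳ-≤ m i≤) (ℕ.≤-reflexive (ℕ.m+[n∸m]≡n m≤N)))) (inner m m≤N)) ⟩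
      ∑ N (λ m → ⌊ 2 ⌋ * (⌊ 2 ⌋ ^ m * ι m) * - (⌊ 2 ⌋ * H 3 m))
        ≡⟨ ∑-cong N (λ m 1≤m _ → trans (cong (λ x → ⌊ 2 ⌋ * (⌊ 2 ⌋ ^ m * ι m) * - (⌊ 2 ⌋ * x)) (H-last 3 m 1≤m))
            (solve 3 (λ x u H → # 2 :* (x :* u) :* (:- (# 2 :* (H :+ u :^ 3))) := (:- (# 4 :* (x :* (u :* H) :+ x :* u :^ 4)))) refl
            (⌊ 2 ⌋ ^ m) (ι m) (H 3 (m ∸ 1)))) ⟩
      ∑ N (λ m → - (⌊ 4 ⌋ * (⌊ 2 ⌋ ^ m * (ι m * H 3 (m ∸ 1)) + ⌊ 2 ⌋ ^ m * ι m ^ 4)))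
        ≡⟨ trans (∑-neg N _) (cong -_ (trans (∑-*ˡ N ⌊ 4 ⌋ _) (cong (⌊ 4 ⌋ *_) (∑-+ N _ _)))) ⟩
      - (⌊ 4 ⌋ * (W₁₃ + λ₂ 4)) ∎
      where
      g : ℕ → ℕ → A
      g m i = f (m ℕ.+ i) (p ∸ i)
      term : ∀ m i → 1 ≤ m → 1 ≤ i → m ℕ.+ i ≤ N → g m i ≈[ 1 ] ⌊ 2 ⌋ * (⌊ 2 ⌋ ^ m * ι m) * (ι (m ℕ.+ i) ^ 3 - ι i ^ 3)
      term m i 1≤m 1≤i m+i≤N = begin
        ⌊ 2 ⌋ ^ (m ℕ.+ i ℕ.+ (p ∸ i)) * φ K (ι (p ∸ i))
          ≡⟨ cong (λ k → ⌊ 2 ⌋ ^ k * φ K (ι (p ∸ i))) (trans (ℕ.+-assoc m i (p ∸ i)) (cong (m ℕ.+_) (ℕ.m+[n∸m]≡n (ℕ.m≤n⇒m≤1+n i≤N)))) ⟩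
        ⌊ 2 ⌋ ^ (m ℕ.+ p) * φ K (ι (p ∸ i))
          ≡⟨ cong (_* φ K (ι (p ∸ i))) (^-homo-* ⌊ 2 ⌋ m p) ⟩
        ⌊ 2 ⌋ ^ m * (⌊ 2 ⌋ * Q) * φ K (ι (p ∸ i))
          ≈⟨ ≈-* (≈-*ˡ (⌊ 2 ⌋ ^ m) (≈-*ˡ ⌊ 2 ⌋ Q≈1)) (≈-minus (≈-+ (≈-*ˡ K (≈-^ r 3)) (≈-*ˡ (K ^ 3) r)) (≈-*ˡ (K ^ 2) (≈-^ r 2))) ⟩
        ⌊ 2 ⌋ ^ m * (⌊ 2 ⌋ * 1#) * φ K (- u)
          ≡⟨ solve 3 (λ x K u → x :* (# 2 :* # 1) :* (K :* (:- u) :^ 3 :+ K :^ 3 :* (:- u) :- K :^ 2 :* (:- u) :^ 2)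
              := # 2 :* x :* (:- (K :* u :* (K :^ 2 :+ K :* u :+ u :^ 2)))) refl (⌊ 2 ⌋ ^ m) K u ⟩
        ⌊ 2 ⌋ * ⌊ 2 ⌋ ^ m * - (K * u * (K ^ 2 + K * u + u ^ 2))
          ≡⟨ cong (λ y → ⌊ 2 ⌋ * ⌊ 2 ⌋ ^ m * - (y * (K ^ 2 + K * u + u ^ 2))) Ku ⟩
        ⌊ 2 ⌋ * ⌊ 2 ⌋ ^ m * - (M * (u - K) * (K ^ 2 + K * u + u ^ 2))
          ≡⟨ solve 4 (λ x K u M → # 2 :* x :* (:- (M :* (u :- K) :* (K :^ 2 :+ K :* u :+ u :^ 2))) := # 2 :* (x :* M) :* (K :^ 3 :- u :^ 3))
              refl (⌊ 2 ⌋ ^ m) K u M ⟩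
        ⌊ 2 ⌋ * (⌊ 2 ⌋ ^ m * M) * (K ^ 3 - u ^ 3) ∎
        where
        M = ι m
        K = ι (m ℕ.+ i)
        u = ι i
        i≤N = ℕ.≤-trans (ℕ.m≤n+m i m) m+i≤N
        r : ι (p ∸ i) ≈[ 1 ] - u
        r = ι-reflect i 1≤i i≤N
        Ku : K * u ≡ M * (u - K)
        Ku = trans (solve 3 (λ K u M → K :* u := K :* (M :+ u) :- M :* K) refl K u M)
            (trans (cong (_- M * K) (sym (ι-add m i 1≤m 1≤i m+i≤N))) (solve 3 (λ K u M → M :* u :- M :* K := M :* (u :- K)) refl K u M))
      inner : ∀ m → m ≤ N → ∑ (N ∸ m) (λ i → ⌊ 2 ⌋ * (⌊ 2 ⌋ ^ m * ι m) * (ι (m ℕ.+ i) ^ 3 - ι i ^ 3)) ≈[ 1 ] ⌊ 2 ⌋ * (⌊ 2 ⌋ ^ m * ι m) * -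
          (⌊ 2 ⌋ * H 3 m)
      inner m m≤N = begin
        ∑ (N ∸ m) (λ i → c * (ι (m ℕ.+ i) ^ 3 - ι i ^ 3))
          ≡⟨ trans (∑-*ˡ (N ∸ m) c _) (cong (c *_) (∑-minus (N ∸ m) _ _)) ⟩
        c * (∑ (N ∸ m) (λ i → ι (m ℕ.+ i) ^ 3) - H 3 (N ∸ m))
          ≡⟨ cong (λ x → c * (x - H 3 (N ∸ m))) (trans (solve 2 (λ x y → x := y :+ x :- y) refl (∑ (N ∸ m) (λ i → ι (m ℕ.+ i) ^ 3)) (H 3 m))
              (cong (_- H 3 m) (trans (sym (∑-split m (N ∸ m) (λ k → ι k ^ 3))) (cong (H 3) (ℕ.m+[n∸m]≡n m≤N))))) ⟩
        c * (S 3 - H 3 m - H 3 (N ∸ m))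
          ≈⟨ ≈-*ˡ c (≈-minus (≈-minus (≈-drop S₃-null) ≈-refl) (H₃-reflect m m≤N)) ⟩
        c * (0# - H 3 m - H 3 m)
          ≡⟨ solve 2 (λ c H → c :* (# 0 :- H :- H) := c :* (:- (# 2 :* H))) refl c (H 3 m) ⟩
        c * - (⌊ 2 ⌋ * H 3 m) ∎
        where
        c = ⌊ 2 ⌋ * (⌊ 2 ⌋ ^ m * ι m)
    -- The pairs with k + l = p contribute a multiple of S_4.
    diagonal : ∑ N (λ k → f k (p ∸ k)) ≈[ 1 ] 0#
    diagonal = begin
      ∑ N (λ k → f k (p ∸ k))               ≈⟨ ≈-∑ N (λ k 1≤k k≤N → ≈-*
          (≈-trans (≈-reflexive (cong (⌊ 2 ⌋ ^_) (ℕ.m+[n∸m]≡n (ℕ.m≤n⇒m≤1+n k≤N)))) (≈-*ˡ ⌊ 2 ⌋ Q≈1))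
          (≈-minus (≈-+ (≈-*ˡ (ι k) (≈-^ (ι-reflect k 1≤k k≤N) 3)) (≈-*ˡ (ι k ^ 3) (ι-reflect k 1≤k k≤N)))
          (≈-*ˡ (ι k ^ 2) (≈-^ (ι-reflect k 1≤k k≤N) 2)))) ⟩
      ∑ N (λ k → ⌊ 2 ⌋ * 1# * φ (ι k) (- ι k))   ≡⟨ trans (∑-cong N λ k _ _ → solve 1
          (λ u → # 2 :* # 1 :* (u :* (:- u) :^ 3 :+ u :^ 3 :* (:- u) :- u :^ 2 :* (:- u) :^ 2) := (:- # 6) :* u :^ 4) refl (ι k))
          (∑-*ˡ N (- ⌊ 6 ⌋) _) ⟩
      - ⌊ 6 ⌋ * S 4                         ≈⟨ null-* (- ⌊ 6 ⌋) S₄-null ⟩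
      0#                                    ∎

-- Binomial duality: from powers of two to alternating signs

module BinomialDuality (n : ℕ) (p-prime : Prime (suc (n ℕ.+ n))) (5<p : 5 < suc (n ℕ.+ n)) (L : LocalRing (suc (n ℕ.+ n))) where
  open WeightFour n p-prime 5<p L public

  hockey-stick : ∀ M m → 1 ≤ m → ∑ M (λ j → ⌊ (j ∸ 1) C (m ∸ 1) ⌋) ≡ ⌊ M C m ⌋
  hockey-stick zero (suc m) _ = cong ⌊_⌋ (sym (k>n⇒nCk≡0 (s≤s (z≤n {m}))))
  hockey-stick (suc M) (suc m) 1≤m = trans (cong (_+ ⌊ M C m ⌋) (hockey-stick M (suc m) 1≤m)) (trans (+-comm _ _) (sym (pascal M m)))

  -- The transposed binomial transform, with both indices lowered by one because C(k,m)/k =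
  -- C(k-1,m-1)/m.
  γ : (ℕ → A) → ℕ → A
  γ c m = ∑ N (λ j → ⌊ (j ∸ 1) C (m ∸ 1) ⌋ * c j)

  -- The sign is chosen so that the constant sequence 1 is mapped to 1 modulo p, as (-1)^m C(p-1,m)
  -- ≡ 1.
  Γ : (ℕ → A) → ℕ → A
  Γ c m = (- 1#) ^ m * γ c m

  -- The reason is C(j-1,m)/j = C(j-1,m-1) (1/m - 1/j).
  γ-step : ∀ c m → 1 ≤ m → m ≤ N → γ (λ j → ι j * c j) (suc m) ≡ ι m * γ c m - γ (λ j → ι j * c j) m
  γ-step c (suc m) 1≤m m≤N = trans (∑-cong N term) (trans (∑-minus N _ _) (cong (_- γ (λ j → ι j * c j) (suc m)) (∑-*ˡ N (ι (suc m)) _)))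
    where
    open ≡-Reasoning
    term : ∀ j → 1 ≤ j → j ≤ N → ⌊ (j ∸ 1) C suc m ⌋ * (ι j * c j) ≡ ι (suc m) * (⌊ (j ∸ 1) C m ⌋ * c j) - ⌊ (j ∸ 1) C m ⌋ * (ι j * c j)
    term (suc j) 1≤j j≤N = begin
      b′ * (u * x)                              ≡⟨ solve 3 (λ b u x → b :* (u :* x) := # 1 :* (b :* (u :* x))) refl b′ u x ⟩
      1# * (b′ * (u * x))                       ≡⟨ cong (_* (b′ * (u * x))) (sym mv) ⟩
      ⌊ suc m ⌋ * v * (b′ * (u * x))            ≡⟨ solve 5 (λ m v b u x → m :* v :* (b :* (u :* x)) := v :* (m :* b) :* (u :* x)) refl ⌊ suc
          m ⌋ v b′ u x ⟩
      v * (⌊ suc m ⌋ * b′) * (u * x)            ≡⟨ cong (λ y → v * y * (u * x)) (next-binomial j m) ⟩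
      v * ((⌊ j ⌋ - ⌊ m ⌋) * b) * (u * x)       ≡⟨ solve 6 (λ v j m b u x → v :* ((j :- m) :* b) :* (u :* x)
          := v :* ((# 1 :+ j) :* u :* (b :* x)) :- (# 1 :+ m) :* v :* (b :* (u :* x))) refl v ⌊ j ⌋ ⌊ m ⌋ b u x ⟩
      v * ((1# + ⌊ j ⌋) * u * (b * x)) - (1# + ⌊ m ⌋) * v * (b * (u * x))  
          ≡⟨ cong₂ (λ y z → v * (y * (b * x)) - z * (b * (u * x))) (trans (cong (_* u) (sym (⌊suc⌋ j))) (ι-inverse′ (suc j) 1≤j j≤N))
          (trans (cong (_* v) (sym (⌊suc⌋ m))) mv) ⟩
      v * (1# * (b * x)) - 1# * (b * (u * x))   ≡⟨ solve 4 (λ v b u x → v :* (# 1 :* (b :* x)) :- # 1 :* (b :* (u :* x))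
          := v :* (b :* x) :- b :* (u :* x)) refl v b u x ⟩
      v * (b * x) - b * (u * x)                 ∎
      where
      b = ⌊ j C m ⌋
      b′ = ⌊ j C suc m ⌋
      u = ι (suc j)
      v = ι (suc m)
      x = c (suc j)
      mv : ⌊ suc m ⌋ * v ≡ 1#
      mv = ι-inverse′ (suc m) 1≤m m≤N

  Γ-first : ∀ c → Γ c 1 ≡ - ∑ N c
  Γ-first c = trans (cong ((- 1#) ^ 1 *_) (∑-cong N λ j _ _ → trans (cong (_* c j) (⌊nC0⌋ (j ∸ 1))) (*-identityˡ _)))
      (solve 1 (λ x → (:- # 1) :^ 1 :* x := (:- x)) refl (∑ N c))

  -- `γ-step` telescopes down to m = 1, where `Γ` is minus the full sum. A factor 1/j thus becomes a
  -- partial sum over the smaller indices.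
  Γ-sum : ∀ (c d : ℕ → A) → (∀ m → 1 ≤ m → m ≤ N → Γ c m ≈[ 1 ] d m) → ∀ m → 1 ≤ m → m ≤ N → Γ (λ j → ι j * c j) m ≈[ 1 ] - ∑ N
      (λ j → ι j * c j) - ∑ (m ∸ 1) (λ i → ι i * d i)
  Γ-sum c d h (suc zero) _ _ = ≈-reflexive (trans (Γ-first _) (solve 1 (λ x → (:- x) := (:- x) :- # 0) refl (∑ N (λ j → ι j * c j))))
  Γ-sum c d h (suc (suc m)) _ m≤N = begin
    Γ ιc (suc (suc m))
      ≡⟨ trans (cong ((- 1#) ^ suc (suc m) *_) (γ-step c (suc m) (s≤s z≤n) (ℕ.<⇒≤ m≤N)))
          (solve 4 (λ s v x y → (:- # 1) :* s :* (v :* x :- y) := s :* y :- v :* (s :* x)) refl ((- 1#) ^ suc m) (ι (suc m)) (γ c (suc m))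
          (γ ιc (suc m))) ⟩
    Γ ιc (suc m) - ι (suc m) * Γ c (suc m)
      ≈⟨ ≈-minus (Γ-sum c d h (suc m) (s≤s z≤n) (ℕ.<⇒≤ m≤N)) (≈-*ˡ (ι (suc m)) (h (suc m) (s≤s z≤n) (ℕ.<⇒≤ m≤N))) ⟩
    - ∑ N ιc - ∑ m (λ i → ι i * d i) - ι (suc m) * d (suc m)
      ≡⟨ solve 3 (λ x y z → (:- x) :- y :- z := (:- x) :- (y :+ z)) refl (∑ N ιc) (∑ m (λ i → ι i * d i)) (ι (suc m) * d (suc m)) ⟩
    - ∑ N ιc - (∑ m (λ i → ι i * d i) + ι (suc m) * d (suc m)) ∎
    where
    open ≈-Reasoning
    ιc : ℕ → A
    ιc j = ι j * c j

  signed-binomial≈1 : ∀ m → m ≤ N → (- 1#) ^ m * ⌊ N C m ⌋ ≈[ 1 ] 1#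
  signed-binomial≈1 m m≤N = _ by trans (signed-binomial N 1# (sym (*-identityʳ P)) m m≤N)
      (cong (λ x → 1# + x * excess (λ k → - (1# * ι k)) m) (sym (*-identityʳ P)))

  Γ-one : ∀ m → 1 ≤ m → m ≤ N → Γ (λ _ → 1#) m ≈[ 1 ] 1#
  Γ-one m 1≤m m≤N = ≈-trans (≈-reflexive (cong ((- 1#) ^ m *_) (trans (∑-cong N λ j _ _ → *-identityʳ _) (hockey-stick N m 1≤m))))
      (signed-binomial≈1 m m≤N)

  ∑-extend : ∀ k (f : ℕ → A) → k ≤ N → (∀ i → k < i → f i ≡ 0#) → ∑ k f ≡ ∑ N f
  ∑-extend k f k≤N vanish = sym (trans (cong (λ m → ∑ m f) (sym (ℕ.m+[n∸m]≡n k≤N))) (trans (∑-split k (N ∸ k) f)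
    (trans (cong (∑ k f +_) (∑-zero (N ∸ k) λ i 1≤i _ → vanish (k ℕ.+ i) (ℕ.≤-trans (ℕ.≤-reflexive (ℕ.+-comm 1 k)) (ℕ.+-monoʳ-≤ k 1≤i))))
        (+-identityʳ _))))

  binomial-ι : ∀ k m → 1 ≤ k → 1 ≤ m → k ≤ N → m ≤ N → ⌊ k C m ⌋ * ι k ≡ ι m * ⌊ (k ∸ 1) C (m ∸ 1) ⌋
  binomial-ι (suc k) (suc m) 1≤k 1≤m k≤N m≤N = begin
    b * u                                ≡⟨ solve 2 (λ b u → b :* u := # 1 :* b :* u) refl b u ⟩
    1# * b * u                           ≡⟨ cong (λ x → x * b * u) (sym (ι-inverse′ (suc m) 1≤m m≤N)) ⟩
    ⌊ suc m ⌋ * v * b * u                ≡⟨ solve 4 (λ m v b u → m :* v :* b :* u := v :* (m :* b) :* u) refl ⌊ suc m ⌋ v b u ⟩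
    v * (⌊ suc m ⌋ * b) * u              ≡⟨ cong (λ x → v * x * u) (absorb k m) ⟩
    v * (⌊ suc k ⌋ * b′) * u             ≡⟨ solve 4 (λ v k b u → v :* (k :* b) :* u := v :* b :* (k :* u)) refl v ⌊ suc k ⌋ b′ u ⟩
    v * b′ * (⌊ suc k ⌋ * u)             ≡⟨ trans (cong (v * b′ *_) (ι-inverse′ (suc k) 1≤k k≤N)) (*-identityʳ _) ⟩
    v * b′                               ∎
    where
    open ≡-Reasoning
    b = ⌊ suc k C suc m ⌋
    b′ = ⌊ k C m ⌋
    u = ι (suc k)
    v = ι (suc m)

  -- For constant `d` = 1 the inner sum is 2^k - 1. The powers of two are thus traded for `γ`, which
  -- modulo p is (-1)^m times a nested harmonic sum.
  binomial-exchange : ∀ (c d : ℕ → A) → ∑ N (λ k → ∑ k (λ m → ⌊ k C m ⌋ * d m) * (ι k * c k)) ≡ ∑ N (λ m → d m * (ι m * γ c m))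
  binomial-exchange c d = begin
    ∑ N (λ k → ∑ k (λ m → ⌊ k C m ⌋ * d m) * (ι k * c k))
      ≡⟨ ∑-cong N (λ k _ k≤N → trans (cong (_* (ι k * c k)) (∑-extend k _ k≤N λ i k<i → trans (cong (λ x → ⌊ x ⌋ * d i) (k>n⇒nCk≡0 k<i))
          (zeroˡ (d i)))) (sym (∑-*ʳ N (ι k * c k) _))) ⟩
    ∑ N (λ k → ∑ N (λ m → ⌊ k C m ⌋ * d m * (ι k * c k)))
      ≡⟨ ∑-swap N N (λ k m → ⌊ k C m ⌋ * d m * (ι k * c k)) ⟩
    ∑ N (λ m → ∑ N (λ k → ⌊ k C m ⌋ * d m * (ι k * c k)))
      ≡⟨ ∑-cong N (λ m 1≤m m≤N → trans (∑-cong N λ k 1≤k k≤N → term k m 1≤k 1≤m k≤N m≤N) (trans (∑-*ˡ N (d m * ι m) _) (*-assoc _ _ _))) ⟩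
    ∑ N (λ m → d m * (ι m * γ c m)) ∎
    where
    open ≡-Reasoning
    term : ∀ k m → 1 ≤ k → 1 ≤ m → k ≤ N → m ≤ N → ⌊ k C m ⌋ * d m * (ι k * c k) ≡ d m * ι m * (⌊ (k ∸ 1) C (m ∸ 1) ⌋ * c k)
    term k m 1≤k 1≤m k≤N m≤N = trans (solve 4 (λ b d u c → b :* d :* (u :* c) := d :* (b :* u) :* c) refl ⌊ k C m ⌋ (d m) (ι k) (c k))
      (trans (cong (λ x → d m * x * c k) (binomial-ι k m 1≤k 1≤m k≤N m≤N))
          (solve 4 (λ d v b c → d :* (v :* b) :* c := d :* v :* (b :* c)) refl (d m) (ι m) ⌊ (k ∸ 1) C (m ∸ 1) ⌋ (c k)))

  p∸k∸1 : ∀ k → k ≤ N → p ∸ k ∸ 1 ≡ N ∸ k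
  p∸k∸1 k k≤N = cong (_∸ 1) (ℕ.+-∸-assoc 1 k≤N)

  -- Under k ↦ p - k the cube changes sign while H_(k-1) becomes H_k modulo p, so the sum is minus
  -- itself up to S_4.
  ι³H₁-null : ∑ N (λ k → ι k ^ 3 * H 1 (k ∸ 1)) ≈[ 1 ] 0#
  ι³H₁-null = cancel 2 p∤2 (combine (null-+ (difference reflected) (null-* (- 1#) S₄-null))
      (solve 2 (λ X S → # 2 :* X :- # 0 := X :- (:- (X :+ S)) :+ (:- # 1) :* S) refl X (S 4)))
    where
    open ≈-Reasoning
    X = ∑ N (λ k → ι k ^ 3 * H 1 (k ∸ 1))
    reflected : X ≈[ 1 ] - (X + S 4)
    reflected = begin
      X                                                             ≡⟨ ∑-reverse N _ ⟩
      ∑ N (λ k → ι (p ∸ k) ^ 3 * H 1 (p ∸ k ∸ 1))                   ≈⟨ ≈-∑ N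
          (λ k 1≤k k≤N → ≈-* (ι^-reflect 3 k 1≤k k≤N) (≈-trans (≈-reflexive (cong (H 1) (p∸k∸1 k k≤N))) (H₁-reflect k k≤N))) ⟩
      ∑ N (λ k → (- 1#) ^ 3 * ι k ^ 3 * H 1 k)                      ≡⟨ ∑-cong N
          (λ k 1≤k _ → trans (cong ((- 1#) ^ 3 * ι k ^ 3 *_) (H-last 1 k 1≤k))
          (solve 2 (λ u x → (:- # 1) :^ 3 :* u :^ 3 :* (x :+ u :^ 1) := (:- (u :^ 3 :* x :+ u :^ 4))) refl (ι k) (H 1 (k ∸ 1)))) ⟩
      ∑ N (λ k → - (ι k ^ 3 * H 1 (k ∸ 1) + ι k ^ 4))               ≡⟨ trans (∑-neg N _) (cong -_ (∑-+ N _ _)) ⟩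
      - (X + S 4)                                                   ∎

  -- The second elementary symmetric function of 1, 1/2, ..., 1/m.
  e₂ : ℕ → A
  e₂ m = ∑ m (λ i → ι i * H 1 (i ∸ 1))

  e₂-square : ⌊ 2 ⌋ * e₂ N + S 2 - S 1 * S 1 ≡ 0#
  e₂-square = begin
    ⌊ 2 ⌋ * e₂ N + S 2 - S 1 * S 1
      ≡⟨ cong (λ x → ⌊ 2 ⌋ * e₂ N + S 2 - x) (sym (∑-by-parts N (λ k → ι k ^ 1) (λ k → ι k ^ 1))) ⟩
    ⌊ 2 ⌋ * e₂ N + S 2 - (∑ N (λ k → ι k ^ 1 * H 1 (k ∸ 1)) + ∑ N (λ k → ι k ^ 1 * H 1 k))
      ≡⟨ cong₂ (λ x y → ⌊ 2 ⌋ * e₂ N + S 2 - (x + y)) (∑-cong N λ k _ _ → cong (_* H 1 (k ∸ 1)) (*-identityʳ (ι k)))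
           (trans (∑-cong N λ k 1≤k _ → trans (cong (ι k ^ 1 *_) (H-last 1 k 1≤k))
               (solve 2 (λ u x → u :^ 1 :* (x :+ u :^ 1) := u :* x :+ u :^ 2) refl (ι k) (H 1 (k ∸ 1)))) (∑-+ N _ _)) ⟩
    ⌊ 2 ⌋ * e₂ N + S 2 - (e₂ N + (e₂ N + S 2))
      ≡⟨ solve 2 (λ e T → # 2 :* e :+ T :- (e :+ (e :+ T)) := # 0) refl (e₂ N) (S 2) ⟩
    0# ∎
    where open ≡-Reasoning

  e₂-null : e₂ N ≈[ 1 ] 0#
  e₂-null = cancel 2 p∤2 (combine (null-+ (null-+ (≈-reflexive e₂-square) (null-*ʳ (S 1) S₁-null)) (null-* (- 1#) S₂-null))
      (solve 3 (λ e S T → # 2 :* e :- # 0 := # 2 :* e :+ T :- S :* S :+ S :* S :+ (:- # 1) :* T) refl (e₂ N) (S 1) (S 2)))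

  Γ-ι : ∀ m → 1 ≤ m → m ≤ N → Γ (λ j → ι j * 1#) m ≈[ 1 ] - H 1 (m ∸ 1)
  Γ-ι m 1≤m m≤N = ≈-trans (Γ-sum (λ _ → 1#) (λ _ → 1#) Γ-one m 1≤m m≤N)
      (≈-trans (≈-minus (≈-neg S₁-null) (≈-refl {a = H 1 (m ∸ 1)})) (≈-reflexive (solve 1 (λ x → (:- # 0) :- x := (:- x)) refl (H 1 (m ∸ 1)))))

  Γ-ι² : ∀ m → 1 ≤ m → m ≤ N → Γ (λ j → ι j * (ι j * 1#)) m ≈[ 1 ] e₂ (m ∸ 1)
  Γ-ι² m 1≤m m≤N = ≈-trans (Γ-sum (λ j → ι j * 1#) (λ i → - H 1 (i ∸ 1)) Γ-ι m 1≤m m≤N)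
      (≈-trans (≈-minus (≈-neg S₂-null) (≈-reflexive (trans (∑-cong (m ∸ 1) λ i _ _ → solve 2 (λ u x → u :* (:- x) := (:- (u :* x))) refl
      (ι i) (H 1 (i ∸ 1))) (∑-neg (m ∸ 1) _)))) (≈-reflexive (solve 1 (λ x → (:- # 0) :- (:- x) := x) refl (e₂ (m ∸ 1)))))

  γ-from-Γ : ∀ c m → γ c m ≡ (- 1#) ^ m * Γ c m
  γ-from-Γ c m = sym (trans (sym (*-assoc _ _ _)) (trans (cong (_* γ c m) (trans (sym (^-homo-* (- 1#) m m)) ([-1]^double m))) (*-identityˡ _)))

  ∑-binomials : ∀ m → ∑ m (λ k → ⌊ m C k ⌋ * 1#) ≡ ⌊ 2 ⌋ ^ m - 1#
  ∑-binomials m = trans (∑-cong m λ k _ _ → cong (⌊ m C k ⌋ *_) (sym (1^ k))) (transform-one 1# m)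

  Y : A
  Y = ∑ N (λ k → (- 1#) ^ k * (ι k ^ 2 * e₂ (k ∸ 1)))

  -- Summation by parts moves the powers of two into Λ_k, the sum of 2^i/i for i ≤ k, which equals
  -- H_k plus the sum of C(k,m)/m. The boundary term and the part with H_k vanish, and
  -- `binomial-exchange` with `Γ-ι²` treats the rest.
  W₁₃≈-Y : W₁₃ ≈[ 1 ] - Y
  W₁₃≈-Y = begin
    W₁₃
      ≡⟨ trans (∑-cong N λ k _ _ → sym (*-assoc _ _ _)) (solve 2 (λ x y → x := x :+ y :- y) refl (∑ N (λ k → ⌊ 2 ⌋ ^ k * ι k * H 3 (k ∸ 1)))
          (∑ N (λ k → ι k ^ 3 * Λ k))) ⟩
    ∑ N (λ k → ⌊ 2 ⌋ ^ k * ι k * H 3 (k ∸ 1)) + ∑ N (λ k → ι k ^ 3 * Λ k) - ∑ N (λ k → ι k ^ 3 * Λ k)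
      ≡⟨ cong₂ _-_ (∑-by-parts N (λ k → ⌊ 2 ⌋ ^ k * ι k) (λ k → ι k ^ 3)) split ⟩
    Λ N * S 3 - (Y′ + (∑ N (λ k → ι k ^ 3 * H 1 (k ∸ 1)) + S 4))
      ≈⟨ ≈-minus (null-* (Λ N) (≈-drop S₃-null)) (≈-+ Y′≈Y (null-+ ι³H₁-null S₄-null)) ⟩
    0# - (Y + 0#)
      ≡⟨ solve 1 (λ Y → # 0 :- (Y :+ # 0) := (:- Y)) refl Y ⟩
    - Y ∎
    where
    open ≈-Reasoning
    Λ : ℕ → A
    Λ k = ∑ k (λ i → ⌊ 2 ⌋ ^ i * ι i)
    Y′ = ∑ N (λ m → ι m * (ι m * γ (λ j → ι j * (ι j * 1#)) m))
    Λ-value : ∀ k → k ≤ N → Λ k ≡ ∑ k (λ m → ⌊ k C m ⌋ * ι m) + H 1 k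
    Λ-value k k≤N = sym (trans (cong (_+ H 1 k) (trans (∑-cong k λ m _ _ → cong (⌊ k C m ⌋ *_)
        (trans (sym (trans (*-identityˡ _) (*-identityʳ (ι m)))) (cong (_* (ι m * 1#)) (sym (1^ m)))))
        (trans (transform-ι ι 1# (λ _ → 1#) k λ i 1≤i i≤k → ι-inverse′ i 1≤i (ℕ.≤-trans i≤k k≤N))
            (∑-cong k λ m _ _ → cong (ι m *_) (trans (∑-cong m λ i _ _ → cong (⌊ m C i ⌋ *_) (trans (*-identityʳ _) (1^ i))) (∑-binomials m))))))
      (trans (sym (∑-+ k _ _)) (∑-cong k λ m _ _ → solve 2 (λ u t → u :* (t :- # 1) :+ u :^ 1 := t :* u) refl (ι m) (⌊ 2 ⌋ ^ m))))
    split : ∑ N (λ k → ι k ^ 3 * Λ k) ≡ Y′ + (∑ N (λ k → ι k ^ 3 * H 1 (k ∸ 1)) + S 4)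
    split = trans (∑-cong N λ k 1≤k k≤N → trans (cong (ι k ^ 3 *_) (trans (Λ-value k k≤N) (cong (∑ k (λ m → ⌊ k C m ⌋ * ι m) +_) (H-last 1 k 1≤k))))
        (solve 3 (λ u b x → u :^ 3 :* (b :+ (x :+ u :^ 1)) := b :* (u :* (u :* (u :* # 1))) :+ (u :^ 3 :* x :+ u :^ 4)) refl (ι k)
            (∑ k (λ m → ⌊ k C m ⌋ * ι m)) (H 1 (k ∸ 1))))
      (trans (∑-+ N _ _) (cong₂ _+_ (binomial-exchange (λ j → ι j * (ι j * 1#)) ι) (∑-+ N _ _)))
    Y′≈Y : Y′ ≈[ 1 ] Y
    Y′≈Y = ≈-∑ N λ m 1≤m m≤N → ≈-trans (≈-reflexive (trans (cong (λ x → ι m * (ι m * x)) (γ-from-Γ (λ j → ι j * (ι j * 1#)) m))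
        (solve 3 (λ u s x → u :* (u :* (s :* x)) := s :* (u :^ 2 :* x)) refl (ι m) ((- 1#) ^ m) (Γ (λ j → ι j * (ι j * 1#)) m))))
      (≈-*ˡ ((- 1#) ^ m) (≈-*ˡ (ι m ^ 2) (Γ-ι² m 1≤m m≤N)))

  alternating : ℕ → ℕ → A
  alternating a b = ∑ N (λ k → (- 1#) ^ k * (ι k ^ a * H b k))

  alternating-ι⁴ : ∑ N (λ k → (- 1#) ^ k * ι k ^ 4) ≈[ 1 ] 0#
  alternating-ι⁴ = ≈-trans (≈-reflexive (∑-alternating (λ k → ι k ^ 4)))
      (difference (≈-∑ n λ j 1≤j j≤n → ≈-sym (ι⁴-reflect (j ℕ.+ j) (1≤double 1≤j) (double≤ j≤n))))

  ∑-alternating-reflect : ∀ (f : ℕ → A) → ∑ N (λ k → (- 1#) ^ k * f k) ≡ ∑ N (λ k → - ((- 1#) ^ k * f (p ∸ k)))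
  ∑-alternating-reflect f = trans (∑-reverse N _) (∑-cong N λ k _ k≤N → trans (cong (_* f (p ∸ k)) ([-1]^p∸ k (ℕ.m≤n⇒m≤1+n k≤N)))
      (solve 2 (λ s x → (:- s) :* x := (:- (s :* x))) refl ((- 1#) ^ k) (f (p ∸ k))))

  e₂-reflect : ∀ m → m ≤ N → e₂ (N ∸ m) ≈[ 1 ] ∑ m (λ i → ι i * H 1 i)
  e₂-reflect m m≤N = begin
    e₂ (N ∸ m)                        ≡⟨ solve 2 (λ x y → x := x :+ y :- y) refl (e₂ (N ∸ m)) E ⟩
    e₂ (N ∸ m) + E - E                ≡⟨ cong (_- E) (sym (∑-upper N m (λ i → ι i * H 1 (i ∸ 1)) m≤N)) ⟩
    e₂ N - E                          ≈⟨ ≈-minus e₂-null (≈-∑ m λ i 1≤i i≤m → ≈-* (ι-reflect i 1≤i (ℕ.≤-trans i≤m m≤N))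
        (≈-trans (≈-reflexive (cong (H 1) (p∸k∸1 i (ℕ.≤-trans i≤m m≤N)))) (H₁-reflect i (ℕ.≤-trans i≤m m≤N)))) ⟩
    0# - ∑ m (λ i → - ι i * H 1 i)    ≡⟨ cong (λ x → 0# - x) (trans (∑-cong m λ i _ _ → solve 2 (λ u x → (:- u) :* x := (:- (u :* x))) refl
        (ι i) (H 1 i)) (∑-neg m _)) ⟩
    0# - - ∑ m (λ i → ι i * H 1 i)    ≡⟨ solve 1 (λ x → # 0 :- (:- x) := x) refl (∑ m (λ i → ι i * H 1 i)) ⟩
    ∑ m (λ i → ι i * H 1 i)           ∎
    where
    open ≈-Reasoning
    E = ∑ m (λ i → ι (p ∸ i) * H 1 (p ∸ i ∸ 1))

  -- Reflection reverses the sign (-1)^k and sends e₂(k-1) to e₂(k-1) + H_(k-1)/k plus the sum of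
  -- 1/i² for i ≤ k. Hence Y is minus itself plus two simpler alternating sums.
  Y-value : ⌊ 2 ⌋ * Y + (alternating 3 1 + alternating 2 2) ≈[ 1 ] 0#
  Y-value = combine (null-+ (difference reflected) alternating-ι⁴) (solve 4
      (λ Y a b c → # 2 :* Y :+ (a :+ b) :- # 0 := Y :- (:- (Y :+ (a :- c :+ b))) :+ c) refl Y (alternating 3 1) (alternating 2 2)
      (∑ N (λ k → (- 1#) ^ k * ι k ^ 4)))
    where
    open ≈-Reasoning
    k₂ : ∀ m → 1 ≤ m → ∑ m (λ i → ι i * H 1 i) ≡ e₂ (m ∸ 1) + ι m * H 1 (m ∸ 1) + H 2 m
    k₂ m@(suc m′) _ = trans (∑-cong m λ i 1≤i _ → trans (cong (ι i *_) (H-last 1 i 1≤i))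
        (solve 2 (λ u x → u :* (x :+ u :^ 1) := u :* x :+ u :^ 2) refl (ι i) (H 1 (i ∸ 1)))) (∑-+ m _ _)
    reflected : Y ≈[ 1 ] - (Y + ((alternating 3 1 - ∑ N (λ k → (- 1#) ^ k * ι k ^ 4)) + alternating 2 2))
    reflected = begin
      Y
        ≡⟨ ∑-alternating-reflect (λ k → ι k ^ 2 * e₂ (k ∸ 1)) ⟩
      ∑ N (λ k → - ((- 1#) ^ k * (ι (p ∸ k) ^ 2 * e₂ (p ∸ k ∸ 1))))
        ≈⟨ ≈-∑ N (λ k 1≤k k≤N → ≈-neg (≈-*ˡ ((- 1#) ^ k) (≈-* (ι^-reflect 2 k 1≤k k≤N)
            (≈-trans (≈-reflexive (cong e₂ (p∸k∸1 k k≤N))) (≈-trans (e₂-reflect k k≤N) (≈-reflexive (k₂ k 1≤k))))))) ⟩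
      ∑ N (λ k → - ((- 1#) ^ k * ((- 1#) ^ 2 * ι k ^ 2 * (e₂ (k ∸ 1) + ι k * H 1 (k ∸ 1) + H 2 k))))
        ≡⟨ ∑-cong N (λ k 1≤k _ → trans (solve 5 (λ s u e x y → (:- (s :* ((:- # 1) :^ 2 :* u :^ 2 :* (e :+ u :* x :+ y))))
            := (:- (s :* (u :^ 2 :* e) :+ (s :* (u :^ 3 :* (x :+ u :^ 1)) :- s :* u :^ 4 :+ s :* (u :^ 2 :* y))))) refl ((- 1#) ^ k) (ι k)
            (e₂ (k ∸ 1)) (H 1 (k ∸ 1)) (H 2 k)) (cong (λ x → - ((- 1#) ^ k * (ι k ^ 2 * e₂ (k ∸ 1)) +
            (((- 1#) ^ k * (ι k ^ 3 * x) - (- 1#) ^ k * ι k ^ 4) + (- 1#) ^ k * (ι k ^ 2 * H 2 k)))) (sym (H-last 1 k 1≤k)))) ⟩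
      ∑ N (λ k → - ((- 1#) ^ k * (ι k ^ 2 * e₂ (k ∸ 1)) + (((- 1#) ^ k * (ι k ^ 3 * H 1 k) - (- 1#) ^ k * ι k ^ 4) + (- 1#) ^ k * (ι k ^ 2 * H 2 k))))
        ≡⟨ trans (∑-neg N _) (cong -_ (trans (∑-+ N _ _) (cong (Y +_) (trans (∑-+ N _ _) (cong (_+ alternating 2 2) (∑-minus N _ _)))))) ⟩
      - (Y + ((alternating 3 1 - ∑ N (λ k → (- 1#) ^ k * ι k ^ 4)) + alternating 2 2)) ∎

  U : A
  U = ∑ N (λ k → ι k * (ι k * H 1 (k ∸ 1)))

  ρ : ℕ → A
  ρ m = ∑ m (λ i → ι i * H 2 (i ∸ 1))

  -- Summation by parts against the hockey-stick sums gives C(p-1,m) (S_1 - 1/m) exactly, and S_1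
  -- vanishes modulo p.
  Γ-H₁ : ∀ m → 1 ≤ m → m ≤ N → Γ (λ k → H 1 (k ∸ 1)) m ≈[ 1 ] - ι m
  Γ-H₁ m 1≤m m≤N = begin
    Γ (λ k → H 1 (k ∸ 1)) m
      ≡⟨ cong ((- 1#) ^ m *_) parts ⟩
    (- 1#) ^ m * (⌊ N C m ⌋ * S 1 - ι m * ⌊ N C m ⌋)
      ≡⟨ solve 4 (λ s b S u → s :* (b :* S :- u :* b) := s :* b :* (S :- u)) refl ((- 1#) ^ m) ⌊ N C m ⌋ (S 1) (ι m) ⟩
    (- 1#) ^ m * ⌊ N C m ⌋ * (S 1 - ι m)
      ≈⟨ ≈-* (signed-binomial≈1 m m≤N) (≈-minus S₁-null ≈-refl) ⟩
    1# * (0# - ι m)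
      ≡⟨ solve 1 (λ u → # 1 :* (# 0 :- u) := (:- u)) refl (ι m) ⟩
    - ι m ∎
    where
    open ≈-Reasoning
    a : ℕ → A
    a j = ⌊ (j ∸ 1) C (m ∸ 1) ⌋
    parts : γ (λ k → H 1 (k ∸ 1)) m ≡ ⌊ N C m ⌋ * S 1 - ι m * ⌊ N C m ⌋
    parts = trans (solve 2 (λ x y → x := x :+ y :- y) refl (γ (λ k → H 1 (k ∸ 1)) m) (∑ N (λ k → ι k ^ 1 * ∑ k a)))
      (cong₂ _-_ (trans (∑-by-parts N a (λ k → ι k ^ 1)) (cong (_* S 1) (hockey-stick N m 1≤m)))
        (trans (∑-cong N λ k 1≤k k≤N → trans (cong (ι k ^ 1 *_) (hockey-stick k m 1≤m))
            (trans (solve 2 (λ u b → u :^ 1 :* b := b :* u) refl (ι k) ⌊ k C m ⌋) (binomial-ι k m 1≤k 1≤m k≤N m≤N)))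
            (trans (∑-*ˡ N (ι m) _) (cong (ι m *_) (hockey-stick N m 1≤m)))))

  Γ-ιH₁ : ∀ m → 1 ≤ m → m ≤ N → Γ (λ k → ι k * H 1 (k ∸ 1)) m ≈[ 1 ] H 2 (m ∸ 1)
  Γ-ιH₁ m 1≤m m≤N = ≈-trans (Γ-sum _ (λ i → - ι i) Γ-H₁ m 1≤m m≤N) (≈-trans
      (≈-minus (≈-neg e₂-null) (≈-reflexive (trans (∑-cong (m ∸ 1) λ i _ _ → solve 1 (λ u → u :* (:- u) := (:- (u :^ 2))) refl (ι i))
      (∑-neg (m ∸ 1) _)))) (≈-reflexive (solve 1 (λ x → (:- # 0) :- (:- x) := x) refl (H 2 (m ∸ 1)))))

  Γ-ι²H₁ : ∀ m → 1 ≤ m → m ≤ N → Γ (λ k → ι k * (ι k * H 1 (k ∸ 1))) m ≈[ 1 ] - U - ρ (m ∸ 1)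
  Γ-ι²H₁ m 1≤m m≤N = Γ-sum _ (λ i → H 2 (i ∸ 1)) Γ-ιH₁ m 1≤m m≤N

  alternating-ι : ∑ N (λ k → (- 1#) ^ k * ι k ^ 1) ≈[ 1 ] h 1
  alternating-ι = ≈-trans (≈-reflexive ∑-alternating-ι) (combine (null-* (- 1#) S₁-null)
      (solve 2 (λ h S → h :- S :- h := (:- # 1) :* S) refl (h 1) (S 1)))

  Z : A
  Z = ∑ N (λ k → (- 1#) ^ k * (ι k ^ 1 * ρ (k ∸ 1)))

  -- 2^k is 1 plus the sum of the C(k,m). The 1 contributes `ι³H₁-null`; the binomials are exchanged
  -- and evaluated by `Γ-ι²H₁`.
  V≈ : V ≈[ 1 ] - U * h 1 - Z
  V≈ = begin
    V
      ≡⟨ ∑-cong N (λ k _ _ → trans (solve 3 (λ t x u → t :* (x :* u :^ 3) := (t :- # 1) :* (u :* (u :* (u :* x))) :+ u :^ 3 :* x) refl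
          (⌊ 2 ⌋ ^ k) (H 1 (k ∸ 1)) (ι k)) (cong (λ y → y * (ι k * (ι k * (ι k * H 1 (k ∸ 1)))) + ι k ^ 3 * H 1 (k ∸ 1)) (sym (∑-binomials k)))) ⟩
    ∑ N (λ k → ∑ k (λ m → ⌊ k C m ⌋ * 1#) * (ι k * (ι k * (ι k * H 1 (k ∸ 1)))) + ι k ^ 3 * H 1 (k ∸ 1))
      ≡⟨ trans (∑-+ N _ _) (cong (_+ ∑ N (λ k → ι k ^ 3 * H 1 (k ∸ 1))) (binomial-exchange (λ k → ι k * (ι k * H 1 (k ∸ 1))) (λ _ → 1#))) ⟩
    ∑ N (λ m → 1# * (ι m * γ (λ k → ι k * (ι k * H 1 (k ∸ 1))) m)) + ∑ N (λ k → ι k ^ 3 * H 1 (k ∸ 1))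
      ≈⟨ ≈-+ (≈-∑ N λ m 1≤m m≤N → ≈-trans (≈-reflexive (trans (cong (λ x → 1# * (ι m * x)) (γ-from-Γ (λ k → ι k * (ι k * H 1 (k ∸ 1))) m))
          (solve 3 (λ u s x → # 1 :* (u :* (s :* x)) := s :* u :^ 1 :* x) refl (ι m) ((- 1#) ^ m) (Γ (λ k → ι k * (ι k * H 1 (k ∸ 1))) m))))
          (≈-*ˡ ((- 1#) ^ m * ι m ^ 1) (Γ-ι²H₁ m 1≤m m≤N))) ι³H₁-null ⟩
    ∑ N (λ m → (- 1#) ^ m * ι m ^ 1 * (- U - ρ (m ∸ 1))) + 0#
      ≡⟨ cong (_+ 0#) (trans (∑-cong N λ m _ _ → solve 4 (λ s u U R → s :* u :^ 1 :* ((:- U) :- R)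
          := (:- U) :* (s :* u :^ 1) :- s :* (u :^ 1 :* R)) refl ((- 1#) ^ m) (ι m) U (ρ (m ∸ 1)))
          (trans (∑-minus N _ _) (cong (_- Z) (∑-*ˡ N (- U) _)))) ⟩
    - U * ∑ N (λ k → (- 1#) ^ k * ι k ^ 1) - Z + 0#
      ≈⟨ ≈-+ (≈-minus (≈-*ˡ (- U) alternating-ι) ≈-refl) ≈-refl ⟩
    - U * h 1 - Z + 0#
      ≡⟨ +-identityʳ _ ⟩
    - U * h 1 - Z ∎
    where open ≈-Reasoning

  ρ≈-U : ρ N ≈[ 1 ] - U
  ρ≈-U = combine (null-+ (null-+ (≈-reflexive (trans (cong (_- S 1 * S 2) parts) (solve 1 (λ x → x :- x := # 0) refl (S 1 * S 2))))
      (null-*ʳ (S 2) S₁-null)) (null-* (- 1#) (≈-drop S₃-null)))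
    (solve 5 (λ R U T a b → R :- (:- U) := R :+ (U :+ T) :- a :* b :+ a :* b :+ (:- # 1) :* T) refl (ρ N) U (S 3) (S 1) (S 2))
    where
    parts : ρ N + (U + S 3) ≡ S 1 * S 2
    parts = trans (cong₂ _+_ (∑-cong N λ k _ _ → cong (_* H 2 (k ∸ 1)) (sym (*-identityʳ (ι k))))
        (trans (sym (∑-+ N _ _)) (∑-cong N λ k 1≤k _ → trans (solve 2 (λ u x → u :* (u :* x) :+ u :^ 3 := u :^ 2 :* (x :+ u :^ 1)) refl
        (ι k) (H 1 (k ∸ 1))) (cong (ι k ^ 2 *_) (sym (H-last 1 k 1≤k))))))
      (∑-by-parts N (λ k → ι k ^ 1) (λ k → ι k ^ 2))

  -- The same reflection as for `Y`. Here the full sum ρ(p-1) is -U and not zero, which accounts for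
  -- the additional term with U.
  Z-value : ⌊ 2 ⌋ * Z + U * h 1 + (alternating 2 2 + alternating 1 3) ≈[ 1 ] 0#
  Z-value = combine (null-+ (null-+ (difference reflected) (null-* (- U) (difference alternating-ι))) alternating-ι⁴)
    (solve 7 (λ Z U h e a b c → # 2 :* Z :+ U :* h :+ (a :+ b) :- # 0 := Z :- ((:- U) :* e :- (Z :+ (a :- c :+ b))) :+ (:- U) :*
        (e :- h) :+ c) refl Z U (h 1) (∑ N (λ k → (- 1#) ^ k * ι k ^ 1)) (alternating 2 2) (alternating 1 3) (∑ N (λ k → (- 1#) ^ k * ι k ^ 4)))
    where
    open ≈-Reasoning
    ρ-reflect : ∀ m → 1 ≤ m → m ≤ N → ρ (N ∸ m) ≈[ 1 ] - U - (ρ (m ∸ 1) + ι m * H 2 (m ∸ 1) + H 3 m)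
    ρ-reflect m@(suc m′) 1≤m m≤N = begin
      ρ (N ∸ m)                         ≡⟨ solve 2 (λ x y → x := x :+ y :- y) refl (ρ (N ∸ m)) E ⟩
      ρ (N ∸ m) + E - E                 ≡⟨ cong (_- E) (sym (∑-upper N m (λ i → ι i * H 2 (i ∸ 1)) m≤N)) ⟩
      ρ N - E                           ≈⟨ ≈-minus ρ≈-U (≈-∑ m λ i 1≤i i≤m → ≈-* (ι-reflect i 1≤i (ℕ.≤-trans i≤m m≤N))
          (≈-trans (≈-reflexive (cong (H 2) (p∸k∸1 i (ℕ.≤-trans i≤m m≤N)))) (H₂-reflect i (ℕ.≤-trans i≤m m≤N)))) ⟩
      - U - ∑ m (λ i → - ι i * - H 2 i)   ≡⟨ cong (λ x → - U - x) (trans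
          (∑-cong m λ i 1≤i _ → trans (cong (λ y → - ι i * - y) (H-last 2 i 1≤i))
          (solve 2 (λ u x → (:- u) :* (:- (x :+ u :^ 2)) := u :* x :+ u :^ 3) refl (ι i) (H 2 (i ∸ 1)))) (∑-+ m _ _)) ⟩
      - U - (ρ m + H 3 m)               ∎
      where
      E = ∑ m (λ i → ι (p ∸ i) * H 2 (p ∸ i ∸ 1))
    reflected : Z ≈[ 1 ] - U * ∑ N (λ k → (- 1#) ^ k * ι k ^ 1) - (Z + ((alternating 2 2 - ∑ N (λ k → (- 1#) ^ k * ι k ^ 4)) + alternating 1 3))
    reflected = begin
      Z
        ≡⟨ ∑-alternating-reflect (λ k → ι k ^ 1 * ρ (k ∸ 1)) ⟩
      ∑ N (λ k → - ((- 1#) ^ k * (ι (p ∸ k) ^ 1 * ρ (p ∸ k ∸ 1))))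
        ≈⟨ ≈-∑ N (λ k 1≤k k≤N → ≈-neg (≈-*ˡ ((- 1#) ^ k) (≈-* (ι^-reflect 1 k 1≤k k≤N)
            (≈-trans (≈-reflexive (cong ρ (p∸k∸1 k k≤N))) (ρ-reflect k 1≤k k≤N))))) ⟩
      ∑ N (λ k → - ((- 1#) ^ k * ((- 1#) ^ 1 * ι k ^ 1 * (- U - (ρ (k ∸ 1) + ι k * H 2 (k ∸ 1) + H 3 k)))))
        ≡⟨ ∑-cong N (λ k 1≤k _ → trans (solve 6 (λ s u U r x y → (:- (s :* ((:- # 1) :^ 1 :* u :^ 1 :* ((:- U) :- (r :+ u :* x :+ y)))))
            := (:- U) :* (s :* u :^ 1) :- (s :* (u :^ 1 :* r) :+ (s :* (u :^ 2 :* (x :+ u :^ 2)) :- s :* u :^ 4 :+ s :* (u :^ 1 :* y))))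
            refl ((- 1#) ^ k) (ι k) U (ρ (k ∸ 1)) (H 2 (k ∸ 1)) (H 3 k))
            (cong (λ x → - U * ((- 1#) ^ k * ι k ^ 1) - ((- 1#) ^ k * (ι k ^ 1 * ρ (k ∸ 1)) +
            (((- 1#) ^ k * (ι k ^ 2 * x) - (- 1#) ^ k * ι k ^ 4) + (- 1#) ^ k * (ι k ^ 1 * H 3 k)))) (sym (H-last 2 k 1≤k)))) ⟩
      ∑ N (λ k → - U * ((- 1#) ^ k * ι k ^ 1) - ((- 1#) ^ k * (ι k ^ 1 * ρ (k ∸ 1)) +
          (((- 1#) ^ k * (ι k ^ 2 * H 2 k) - (- 1#) ^ k * ι k ^ 4) + (- 1#) ^ k * (ι k ^ 1 * H 3 k))))
        ≡⟨ trans (∑-minus N _ _) (cong₂ _-_ (∑-*ˡ N (- U) _) (trans (∑-+ N _ _)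
            (cong (Z +_) (trans (∑-+ N _ _) (cong (_+ alternating 1 3) (∑-minus N _ _)))))) ⟩
      - U * ∑ N (λ k → (- 1#) ^ k * ι k ^ 1) - (Z + ((alternating 2 2 - ∑ N (λ k → (- 1#) ^ k * ι k ^ 4)) + alternating 1 3)) ∎

-- Alternating sums reduced to k ≤ (p-1)/2

module HalfRange (n : ℕ) (p-prime : Prime (suc (n ℕ.+ n))) (5<p : 5 < suc (n ℕ.+ n)) (L : LocalRing (suc (n ℕ.+ n))) where
  open BinomialDuality n p-prime 5<p L public

  -- The odd denominators 2j + 1 - 2i equal p - 2(n-j+i), so modulo p they are minus the even
  -- numbers 2(n-j+i), and everything is a power of ½ times sums over the half range.
  H-even : ∀ b j → j ≤ n → H b (j ℕ.+ j) ≈[ 1 ] ½ ^ b * (H b j + (- 1#) ^ b * (h b - H b (n ∸ j)))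
  H-even b j j≤n = begin
    H b (j ℕ.+ j)
      ≡⟨ ∑-even-odd j (λ k → ι k ^ b) ⟩
    ∑ j (λ i → ι (i ℕ.+ i) ^ b) + ∑ j (λ i → ι (suc (j ℕ.+ j) ∸ (i ℕ.+ i)) ^ b)
      ≈⟨ ≈-+ (≈-reflexive (∑-cong j λ i 1≤i i≤j → power i 1≤i (ℕ.≤-trans i≤j j≤n))) (≈-∑ j odd) ⟩
    ∑ j (λ i → ½ ^ b * ι i ^ b) + ∑ j (λ i → (- 1#) ^ b * ½ ^ b * ι (d ℕ.+ i) ^ b)
      ≡⟨ cong₂ _+_ (∑-*ˡ j (½ ^ b) _) (trans (∑-*ˡ j ((- 1#) ^ b * ½ ^ b) _) (cong ((- 1#) ^ b * ½ ^ b *_) upper)) ⟩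
    ½ ^ b * H b j + (- 1#) ^ b * ½ ^ b * (h b - H b d)
      ≡⟨ solve 4 (λ t s x y → t :* x :+ s :* t :* y := t :* (x :+ s :* y)) refl (½ ^ b) ((- 1#) ^ b) (H b j) (h b - H b d) ⟩
    ½ ^ b * (H b j + (- 1#) ^ b * (h b - H b d)) ∎
    where
    open ≈-Reasoning
    d = n ∸ j
    power : ∀ i → 1 ≤ i → i ≤ n → ι (i ℕ.+ i) ^ b ≡ ½ ^ b * ι i ^ b
    power i 1≤i i≤n = trans (cong (_^ b) (ι-double i 1≤i i≤n)) (^-distrib-* ½ (ι i) b)
    d+j : d ℕ.+ j ≡ n
    d+j = ℕ.m∸n+n≡m j≤n
    upper : ∑ j (λ i → ι (d ℕ.+ i) ^ b) ≡ h b - H b d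
    upper = trans (solve 2 (λ x y → x := y :+ x :- y) refl (∑ j (λ i → ι (d ℕ.+ i) ^ b)) (H b d))
        (cong (_- H b d) (trans (sym (∑-split d j (λ k → ι k ^ b))) (cong (H b) d+j)))
    odd : ∀ i → 1 ≤ i → i ≤ j → ι (suc (j ℕ.+ j) ∸ (i ℕ.+ i)) ^ b ≈[ 1 ] (- 1#) ^ b * ½ ^ b * ι (d ℕ.+ i) ^ b
    odd i 1≤i i≤j = begin
      ι (suc (j ℕ.+ j) ∸ (i ℕ.+ i)) ^ b     ≡⟨ cong (λ k → ι k ^ b) index ⟩
      ι (p ∸ ((d ℕ.+ i) ℕ.+ (d ℕ.+ i))) ^ b ≈⟨ ι^-reflect b _ (1≤double 1≤d+i) (double≤ d+i≤n) ⟩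
      (- 1#) ^ b * ι ((d ℕ.+ i) ℕ.+ (d ℕ.+ i)) ^ b   ≡⟨ trans (cong ((- 1#) ^ b *_) (power (d ℕ.+ i) 1≤d+i d+i≤n)) (sym (*-assoc _ _ _)) ⟩
      (- 1#) ^ b * ½ ^ b * ι (d ℕ.+ i) ^ b  ∎
      where
      1≤d+i = ℕ.≤-trans 1≤i (ℕ.m≤n+m i d)
      d+i≤n = ℕ.≤-trans (ℕ.+-monoʳ-≤ d i≤j) (ℕ.≤-reflexive d+j)
      index : suc (j ℕ.+ j) ∸ (i ℕ.+ i) ≡ p ∸ ((d ℕ.+ i) ℕ.+ (d ℕ.+ i))
      index = trans (sym (ℕ.[m+n]∸[m+o]≡n∸o (d ℕ.+ d) (suc (j ℕ.+ j)) (i ℕ.+ i))) (cong₂ _∸_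
        (trans (ℕ.+-suc (d ℕ.+ d) (j ℕ.+ j)) (cong suc (trans (interchange ℕ.+-commutativeSemigroup d d j j) (cong (λ k → k ℕ.+ k) d+j))))
            (interchange ℕ.+-commutativeSemigroup d d i i))

  half-convolution : ℕ → ℕ → A
  half-convolution a b = ∑ n (λ j → ι j ^ a * H b (n ∸ j))

  -- Each even k = 2j is paired with the odd p - 2j. As a + b is even, reflection makes both
  -- contribute alike, up to 1/k⁴, whose sum vanishes. The factor ½⁴ of `H-even` and this doubling
  -- combine to 8.
  alternating-value : ∀ a b → a ℕ.+ b ≡ 4 → S b ≈[ 1 ] 0# →
    ⌊ 8 ⌋ * alternating a b ≈[ 1 ] ∑ n (λ j → ι j ^ a * H b j) + (- 1#) ^ b * (h a * h b - half-convolution a b)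
  alternating-value a b a+b≡4 null = combine (cancel 2 p∤2 (combine (null-+ (null-* ⌊ 16 ⌋ (difference folded))
      (null-+ (≈-reflexive scaled) (null-* (- 1#) h₄-null)))
      (solve 5 (λ x X c z h → # 2 :* (# 8 :* x :- X) :- # 0 := # 16 :* (x :- c :* (# 2 :* X :- h)) :+
          (# 16 :* c :* (# 2 :* X :- h) :- (# 2 :* X :- h) :+ (:- # 1) :* h)) refl (alternating a b) X (½ ^ 4) X (h 4))))
          (solve 2 (λ x y → x :- y := x :- y) refl (⌊ 8 ⌋ * alternating a b) X)
    where
    open ≈-Reasoning
    X = ∑ n (λ j → ι j ^ a * H b j) + (- 1#) ^ b * (h a * h b - half-convolution a b)
    signs : (- 1#) ^ a * (- 1#) ^ b ≡ 1#
    signs = trans (sym (^-homo-* (- 1#) a b)) (trans (cong ((- 1#) ^_) a+b≡4) (solve 0 ((:- # 1) :^ 4 := # 1) refl))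
    powers : ∀ x → x ^ a * x ^ b ≡ x ^ 4
    powers x = trans (sym (^-homo-* x a b)) (cong (x ^_) a+b≡4)
    scaled : ⌊ 16 ⌋ * ½ ^ 4 * (⌊ 2 ⌋ * X - h 4) - (⌊ 2 ⌋ * X - h 4) ≡ 0#
    scaled = trans (cong (_- (⌊ 2 ⌋ * X - h 4)) (trans (*-assoc _ _ _) (scale-½ 16 4 1 (solve 0 (# 16 := # 1 :* # 2 :^ 4) refl))))
        (solve 1 (λ x → # 1 :* x :- x := # 0) refl (⌊ 2 ⌋ * X - h 4))
    G : ℕ → A
    G j = H b j + (- 1#) ^ b * (h b - H b (n ∸ j))
    term : ∀ j → 1 ≤ j → j ≤ n → ι (j ℕ.+ j) ^ a * H b (j ℕ.+ j) - ι (p ∸ (j ℕ.+ j)) ^ a * H b (p ∸ (j ℕ.+ j)) ≈[ 1 ] ½ ^ 4 *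
        (⌊ 2 ⌋ * (ι j ^ a * G j) - ι j ^ 4)
    term j 1≤j j≤n = begin
      u ^ a * H b k - ι (p ∸ k) ^ a * H b (p ∸ k)
        ≈⟨ ≈-minus ≈-refl (≈-* (ι^-reflect a k 1≤k k≤N) (≈-trans (≈-reflexive (cong (H b) (p∸ k 1≤k)))
            (H-reflect b (k ∸ 1) (ℕ.≤-trans (ℕ.m∸n≤m k 1) k≤N) null))) ⟩
      u ^ a * H b k - (- 1#) ^ a * u ^ a * - ((- 1#) ^ b * H b (k ∸ 1))
        ≡⟨ solve 5 (λ x y s t z → x :* y :- s :* x :* (:- (t :* z)) := x :* y :+ s :* t :* (x :* z)) refl (u ^ a) (H b k) ((- 1#) ^ a)
            ((- 1#) ^ b) (H b (k ∸ 1)) ⟩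
      u ^ a * H b k + (- 1#) ^ a * (- 1#) ^ b * (u ^ a * H b (k ∸ 1))
        ≡⟨ cong₂ (λ x y → u ^ a * H b k + x * (u ^ a * y)) signs (trans (solve 2 (λ x y → x := x :+ y :- y) refl (H b (k ∸ 1)) (u ^ b))
            (cong (_- u ^ b) (sym (H-last b k 1≤k)))) ⟩
      u ^ a * H b k + 1# * (u ^ a * (H b k - u ^ b))
        ≡⟨ solve 3 (λ x y z → x :* y :+ # 1 :* (x :* (y :- z)) := # 2 :* (x :* y) :- x :* z) refl (u ^ a) (H b k) (u ^ b) ⟩
      ⌊ 2 ⌋ * (u ^ a * H b k) - u ^ a * u ^ b
        ≈⟨ ≈-minus (≈-*ˡ ⌊ 2 ⌋ (≈-*ˡ (u ^ a) (H-even b j j≤n))) (≈-reflexive (powers u)) ⟩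
      ⌊ 2 ⌋ * (u ^ a * (½ ^ b * G j)) - u ^ 4
        ≡⟨ cong (λ x → ⌊ 2 ⌋ * (x ^ a * (½ ^ b * G j)) - x ^ 4) (ι-double j 1≤j j≤n) ⟩
      ⌊ 2 ⌋ * ((½ * ι j) ^ a * (½ ^ b * G j)) - (½ * ι j) ^ 4
        ≡⟨ cong₂ (λ x y → ⌊ 2 ⌋ * (x * (½ ^ b * G j)) - y) (^-distrib-* ½ (ι j) a) (^-distrib-* ½ (ι j) 4) ⟩
      ⌊ 2 ⌋ * (½ ^ a * ι j ^ a * (½ ^ b * G j)) - ½ ^ 4 * ι j ^ 4
        ≡⟨ solve 5 (λ x y z g w → # 2 :* (x :* y :* (z :* g)) :- w := x :* z :* (# 2 :* (y :* g)) :- w) refl (½ ^ a) (ι j ^ a) (½ ^ b) (G j)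
            (½ ^ 4 * ι j ^ 4) ⟩
      ½ ^ a * ½ ^ b * (⌊ 2 ⌋ * (ι j ^ a * G j)) - ½ ^ 4 * ι j ^ 4
        ≡⟨ cong (λ x → x * (⌊ 2 ⌋ * (ι j ^ a * G j)) - ½ ^ 4 * ι j ^ 4) (powers ½) ⟩
      ½ ^ 4 * (⌊ 2 ⌋ * (ι j ^ a * G j)) - ½ ^ 4 * ι j ^ 4
        ≡⟨ solve 3 (λ x y z → x :* y :- x :* z := x :* (y :- z)) refl (½ ^ 4) (⌊ 2 ⌋ * (ι j ^ a * G j)) (ι j ^ 4) ⟩
      ½ ^ 4 * (⌊ 2 ⌋ * (ι j ^ a * G j) - ι j ^ 4) ∎
      where
      k = j ℕ.+ j
      u = ι k
      1≤k = 1≤double 1≤j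
      k≤N = double≤ j≤n
      p∸ : ∀ k → 1 ≤ k → p ∸ k ≡ N ∸ (k ∸ 1)
      p∸ (suc k) _ = refl
    folded : alternating a b ≈[ 1 ] ½ ^ 4 * (⌊ 2 ⌋ * X - h 4)
    folded = begin
      alternating a b
        ≡⟨ trans (∑-alternating (λ k → ι k ^ a * H b k)) (sym (∑-minus n _ _)) ⟩
      ∑ n (λ j → ι (j ℕ.+ j) ^ a * H b (j ℕ.+ j) - ι (p ∸ (j ℕ.+ j)) ^ a * H b (p ∸ (j ℕ.+ j)))
        ≈⟨ ≈-∑ n term ⟩
      ∑ n (λ j → ½ ^ 4 * (⌊ 2 ⌋ * (ι j ^ a * G j) - ι j ^ 4))
        ≡⟨ trans (∑-*ˡ n (½ ^ 4) _) (cong (½ ^ 4 *_) (trans (∑-minus n _ _) (cong (_- h 4) (trans (∑-*ˡ n ⌊ 2 ⌋ _) (cong (⌊ 2 ⌋ *_) G-sum))))) ⟩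
      ½ ^ 4 * (⌊ 2 ⌋ * X - h 4) ∎
      where
      G-sum : ∑ n (λ j → ι j ^ a * G j) ≡ X
      G-sum = trans (∑-cong n λ j _ _ → solve 5 (λ u x s y z → u :* (x :+ s :* (y :- z)) := u :* x :+ s :* (u :* y :- u :* z)) refl
          (ι j ^ a) (H b j) ((- 1#) ^ b) (h b) (H b (n ∸ j)))
        (trans (∑-+ n _ _) (cong (∑ n (λ j → ι j ^ a * H b j) +_) (trans (∑-*ˡ n ((- 1#) ^ b) _)
            (cong ((- 1#) ^ b *_) (trans (∑-minus n _ _) (cong (_- half-convolution a b) (∑-*ʳ n (h b) _)))))))

  Σ₃₁ Σ₁₃ Σ₂₂ Ω : A
  Σ₃₁ = ∑ n (λ m → ι m ^ 3 * H 1 (m ∸ 1))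
  Σ₁₃ = ∑ n (λ m → ι m ^ 1 * H 3 (m ∸ 1))
  Σ₂₂ = ∑ n (λ m → ι m ^ 2 * H 2 (m ∸ 1))
  Ω = ∑ n (λ k → ι k ^ 3 * H 1 k)

  Σ-last : ∀ a b c → a ℕ.+ b ≡ c → ∑ n (λ k → ι k ^ a * H b k) ≡ ∑ n (λ k → ι k ^ a * H b (k ∸ 1)) + h c
  Σ-last a b .(a ℕ.+ b) refl = trans (∑-cong n λ k 1≤k _ → trans (cong (ι k ^ a *_) (H-last b k 1≤k))
      (trans (distribˡ _ _ _) (cong (ι k ^ a * H b (k ∸ 1) +_) (sym (^-homo-* (ι k) a b))))) (∑-+ n _ _)

  Σ₃₁≈ : Σ₃₁ ≈[ 1 ] Ω
  Σ₃₁≈ = combine (null-* (- 1#) h₄-null) (trans (cong (λ x → Σ₃₁ - x) (Σ-last 3 1 4 refl))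
      (solve 2 (λ x y → x :- (x :+ y) := (:- # 1) :* y) refl Σ₃₁ (h 4)))

  Σ₁₃≡ : Σ₁₃ ≡ h 1 * T - Ω
  Σ₁₃≡ = trans (solve 2 (λ x y → x := x :+ y :- y) refl Σ₁₃ Ω) (cong (_- Ω) (∑-by-parts n (λ k → ι k ^ 1) (λ k → ι k ^ 3)))

  Σ₂₂-null : Σ₂₂ ≈[ 1 ] 0#
  Σ₂₂-null = cancel 2 p∤2 (combine (null-+ (≈-reflexive parts) (null-+ (null-*ʳ (h 2) h₂-null) (null-* (- 1#) h₄-null)))
      (solve 3 (λ s a c → # 2 :* s :- # 0 := s :+ (s :+ c) :- a :* a :+ (a :* a :+ (:- # 1) :* c)) refl Σ₂₂ (h 2) (h 4)))
    where
    parts : Σ₂₂ + (Σ₂₂ + h 4) - h 2 * h 2 ≡ 0#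
    parts = trans (cong (_- h 2 * h 2) (trans (cong (Σ₂₂ +_) (sym (Σ-last 2 2 4 refl))) (∑-by-parts n (λ k → ι k ^ 2) (λ k → ι k ^ 2))))
        (solve 1 (λ x → x :- x := # 0) refl (h 2 * h 2))

  half-convolution-triangle : ∀ a b → half-convolution a b ≡ ∑ n (λ m → ∑ (m ∸ 1) (λ j → ι j ^ a * ι (m ∸ j) ^ b))
  half-convolution-triangle a b = trans (∑-cong n λ j _ _ → sym (∑-*ˡ (n ∸ j) (ι j ^ a) _)) (∑-triangle n (λ j i → ι j ^ a * ι i ^ b))

  vanish : ∀ {x y} t c → x ≡ y → t + (x - y) * c ≡ t
  vanish {x} {y} t c eq = trans (cong (λ z → t + (z - y) * c) eq) (solve 3 (λ t y c → t :+ (y :- y) :* c := t) refl t y c)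

  -- The expansion of `F` is required only on the curve u v = w (u + v) with w = 1/m, which contains
  -- all pairs (1/j, 1/(m-j)).
  inner : ∀ m → 1 ≤ m → m ≤ n → ∀ a b c (F : A → A → A) → (∀ u v → u * v ≡ ι m * (u + v) → F u v ≡ a * u ^ 3 + b * u ^ 2 + c * (u + v)) →
    ∑ (m ∸ 1) (λ j → F (ι j) (ι (m ∸ j))) ≡ a * H 3 (m ∸ 1) + b * H 2 (m ∸ 1) + c * (⌊ 2 ⌋ * H 1 (m ∸ 1))
  inner m 1≤m m≤n a b c F eq = trans (∑-cong (m ∸ 1) λ j 1≤j j≤m → trans (eq (ι j) (ι (m ∸ j)) (ι-add′ m j 1≤j j≤m (ℕ.≤-trans m≤n n≤N)))
      (cong (λ x → a * ι j ^ 3 + b * ι j ^ 2 + c * x) (cong₂ _+_ (sym (*-identityʳ (ι j))) (sym (*-identityʳ (ι (m ∸ j)))))))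
    (trans (∑-linear₃ (m ∸ 1) a b c _ _ _) (cong (λ x → a * H 3 (m ∸ 1) + b * H 2 (m ∸ 1) + c * x)
        (trans (∑-+ (m ∸ 1) _ _) (trans (cong (H 1 (m ∸ 1) +_) (∑-inner-reverse m (λ k → ι k ^ 1) 1≤m))
        (solve 1 (λ x → x :+ x := # 2 :* x) refl (H 1 (m ∸ 1)))))))

  half-convolution-31 : half-convolution 3 1 ≡ Σ₁₃ + Σ₂₂ + ⌊ 2 ⌋ * Σ₃₁
  half-convolution-31 = trans (half-convolution-triangle 3 1) (trans (∑-cong n λ m 1≤m m≤n → trans
      (inner m 1≤m m≤n (ι m) (ι m ^ 2) (ι m ^ 3) (λ u v → u ^ 3 * v ^ 1) (λ u v eq →
      -- The two sides differ by u v - w (u + v) times u² + w u + w², so the hypothesis on u v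
      -- removes the difference.
      trans (solve 3 (λ u v w → u :^ 3 :* v :^ 1 := w :* u :^ 3 :+ w :^ 2 :* u :^ 2 :+ w :^ 3 :* (u :+ v) :+ (u :* v :- w :* (u :+ v)) :*
          (u :^ 2 :+ w :* u :+ w :^ 2)) refl u v (ι m)) (vanish _ _ eq)))
      (solve 4 (λ w x y z → w :* x :+ w :^ 2 :* y :+ w :^ 3 :* (# 2 :* z)
          := # 1 :* (w :^ 1 :* x) :+ # 1 :* (w :^ 2 :* y) :+ # 2 :* (w :^ 3 :* z)) refl (ι m) (H 3 (m ∸ 1)) (H 2 (m ∸ 1)) (H 1 (m ∸ 1))))
    (trans (∑-linear₃ n 1# 1# ⌊ 2 ⌋ _ _ _) (solve 3 (λ x y z → # 1 :* x :+ # 1 :* y :+ # 2 :* z := x :+ y :+ # 2 :* z) refl Σ₁₃ Σ₂₂ Σ₃₁)))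

  half-convolution-13 : half-convolution 1 3 ≡ half-convolution 3 1
  half-convolution-13 = trans (half-convolution-triangle 1 3) (trans (∑-cong n λ m 1≤m _ → swap m 1≤m) (sym (half-convolution-triangle 3 1)))
    where
    swap : ∀ m → 1 ≤ m → ∑ (m ∸ 1) (λ j → ι j ^ 1 * ι (m ∸ j) ^ 3) ≡ ∑ (m ∸ 1) (λ j → ι j ^ 3 * ι (m ∸ j) ^ 1)
    swap m@(suc m′) _ = trans (∑-reverse m′ _) (∑-cong m′ λ j _ j≤m′ → trans
        (cong (λ k → ι (m ∸ j) ^ 1 * ι k ^ 3) (ℕ.m∸[m∸n]≡n (ℕ.m≤n⇒m≤1+n j≤m′))) (*-comm _ _))

  half-convolution-22 : half-convolution 2 2 ≡ ⌊ 2 ⌋ * Σ₂₂ + ⌊ 4 ⌋ * Σ₃₁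
  half-convolution-22 = trans (half-convolution-triangle 2 2) (trans (∑-cong n λ m 1≤m m≤n → trans
      (∑-cong (m ∸ 1) λ j 1≤j j≤m → term m j 1≤j j≤m (ℕ.≤-trans m≤n n≤N))
      (trans (∑-linear₃ (m ∸ 1) (ι m ^ 2) (ι m ^ 2) (⌊ 2 ⌋ * ι m ^ 3) (λ j → ι j ^ 2) (λ j → ι (m ∸ j) ^ 2) _)
          (trans (cong₂ (λ x y → ι m ^ 2 * H 2 (m ∸ 1) + ι m ^ 2 * x + ⌊ 2 ⌋ * ι m ^ 3 * y) (∑-inner-reverse m (λ k → ι k ^ 2) 1≤m)
          (trans (∑-+ (m ∸ 1) _ _) (cong (H 1 (m ∸ 1) +_) (∑-inner-reverse m (λ k → ι k ^ 1) 1≤m))))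
        (solve 3 (λ w x y → w :^ 2 :* x :+ w :^ 2 :* x :+ # 2 :* w :^ 3 :* (y :+ y) := # 2 :* (w :^ 2 :* x) :+ # 4 :* (w :^ 3 :* y)) refl
            (ι m) (H 2 (m ∸ 1)) (H 1 (m ∸ 1)))))) (∑-linear₂ n ⌊ 2 ⌋ ⌊ 4 ⌋ _ _))
    where
    term : ∀ m j → 1 ≤ j → j ≤ m ∸ 1 → m ≤ N → ι j ^ 2 * ι (m ∸ j) ^ 2 ≡ ι m ^ 2 * ι j ^ 2 + ι m ^ 2 * ι (m ∸ j) ^ 2 + ⌊ 2 ⌋ * ι m ^ 3 *
        (ι j ^ 1 + ι (m ∸ j) ^ 1)
    term m j 1≤j j≤m m≤N = trans (solve 3 (λ u v w → u :^ 2 :* v :^ 2 := w :^ 2 :* u :^ 2 :+ w :^ 2 :* v :^ 2 :+ # 2 :* w :^ 3 :*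
        (u :^ 1 :+ v :^ 1) :+ (u :* v :- w :* (u :+ v)) :* (u :* v :+ w :* (u :+ v) :+ # 2 :* w :^ 2)) refl (ι j) (ι (m ∸ j)) (ι m))
        (vanish _ _ (ι-add′ m j 1≤j j≤m m≤N))

  half-convolution-31≈ : half-convolution 3 1 ≈[ 1 ] h 1 * T + Ω
  half-convolution-31≈ = ≈-trans (≈-reflexive (trans half-convolution-31 (cong (λ x → x + Σ₂₂ + ⌊ 2 ⌋ * Σ₃₁) Σ₁₃≡)))
    (≈-trans (≈-+ (≈-+ ≈-refl Σ₂₂-null) (≈-*ˡ ⌊ 2 ⌋ Σ₃₁≈)) (≈-reflexive (solve 2 (λ x s → x :- s :+ # 0 :+ # 2 :* s := x :+ s) refl (h 1 * T) Ω)))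

  -- The product h_1 T cancels against the one in the convolution, so that 8 times the alternating
  -- sum is 2Ω.
  alternating-31 : ⌊ 4 ⌋ * alternating 3 1 - Ω ≈[ 1 ] 0#
  alternating-31 = cancel 2 p∤2 (combine (null-+ (difference (alternating-value 3 1 refl S₁-null)) (difference half-convolution-31≈))
    (solve 5 (λ x s h T D → # 2 :* (# 4 :* x :- s) :- # 0 := # 8 :* x :- (s :+ (:- # 1) :^ 1 :* (T :* h :- D)) :+ (D :- (h :* T :+ s))) refl
        (alternating 3 1) Ω (h 1) T (half-convolution 3 1)))

  -- Everything symmetric in the two squares vanishes modulo p; only the 4Ω of the convolution
  -- survives, with a minus sign.
  alternating-22 : ⌊ 2 ⌋ * alternating 2 2 + Ω ≈[ 1 ] 0#
  alternating-22 = cancel 4 p∤4 (combine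
    (null-+ (null-+ (null-+ (null-+ (null-+ (difference (alternating-value 2 2 refl S₂-null))
        (difference (≈-reflexive (Σ-last 2 2 4 refl)))) (null-* (- 1#) (difference (≈-reflexive half-convolution-22))))
        (null-* (- 1#) Σ₂₂-null)) (null-+ h₄-null (null-*ʳ (h 2) h₂-null))) (null-* (- ⌊ 4 ⌋) (difference Σ₃₁≈)))
    (solve 8 (λ x X D a b c h k → # 4 :* (# 2 :* x :+ c) :- # 0 := # 8 :* x :- (X :+ (:- # 1) :^ 2 :* (h :* h :- D)) :+ (X :- (a :+ k)) :+
        (:- # 1) :* (D :- (# 2 :* a :+ # 4 :* b)) :+ (:- # 1) :* a :+ (k :+ h :* h) :+ (:- # 4) :* (b :- c)) refl (alternating 2 2)
        (∑ n (λ j → ι j ^ 2 * H 2 j)) (half-convolution 2 2) Σ₂₂ Σ₃₁ Ω (h 2) (h 4)))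

  alternating-13 : ⌊ 8 ⌋ * alternating 1 3 - h 1 * T ≈[ 1 ] 0#
  alternating-13 = combine
    (null-+ (null-+ (null-+ (null-+ (difference (alternating-value 1 3 refl (≈-drop S₃-null)))
        (difference (≈-reflexive (Σ-last 1 3 4 refl)))) h₄-null) (difference (≈-reflexive Σ₁₃≡)))
        (difference (≈-trans (≈-reflexive half-convolution-13) half-convolution-31≈)))
    (solve 8 (λ x X D a c h T k → # 8 :* x :- h :* T :- # 0 := # 8 :* x :- (X :+ (:- # 1) :^ 3 :* (h :* T :- D)) :+ (X :- (a :+ k)) :+ k :+
        (a :- (h :* T :- c)) :+ (D :- (h :* T :+ c))) refl (alternating 1 3) (∑ n (λ j → ι j ^ 1 * H 3 j)) (half-convolution 1 3) Σ₁₃ Ω (h 1) T (h 4))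

  S₁-null₂ : S 1 ≈[ 2 ] 0#
  S₁-null₂ = cancel 6 p∤6 (combine (null-+ (≈-drop (≈-drop S₁-value)) (multiple T))
      (solve 3 (λ P S T → # 6 :* S :- # 0 := # 6 :* S :- P :^ 2 :* T :+ P :^ 2 :* T) refl P (S 1) T))

  -- Σ (-1)ᵏ C(p-1,k)/k² evaluated exactly and by C(p-1,k) (-1)ᵏ ≈ 1 - p Hₖ.
  U-value : ⌊ 2 ⌋ * U + T ≈[ 1 ] 0#
  U-value = cancel-P regular 1 (combine
    (null-+ (null-+ (null-+ (null-+ (null-* (- ⌊ 2 ⌋) (difference binomials)) (≈-drop S₂-value))
        (null-* (⌊ 2 ⌋ * P) (null-* (- 1#) S₃-null))) (null-*ʳ (S 1) S₁-null₂)) (≈-reflexive e₂-square))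
    (solve 8 (λ P U T a b c e X → P :^ 1 :* (# 2 :* U :+ T) :- # 0 := (:- # 2) :* (b :- P :* (U :+ c) :- (:- (e :+ b))) :+
        (# 3 :* b :+ P :* T) :+ # 2 :* P :* ((:- # 1) :* c) :+ a :* a :+ (# 2 :* e :+ b :- a :* a)) refl P U T (S 1) (S 2) (S 3) (e₂ N) T))
    where
    open ≡-Reasoning
    exact : binomial-transform (- 1#) (λ k → ι k * (ι k * 1#)) N ≡ - (e₂ N + S 2)
    exact = begin
      binomial-transform (- 1#) (λ k → ι k * (ι k * 1#)) N
        ≡⟨ transform-ι ι (- 1#) (λ k → ι k * 1#) N ι-inverse′ ⟩
      ∑ N (λ m → ι m * binomial-transform (- 1#) (λ k → ι k * 1#) m)
        ≡⟨ ∑-cong N (λ m 1≤m m≤N → trans (cong (ι m *_) (trans (transform-ι ι (- 1#) (λ _ → 1#) m λ k 1≤k k≤m → ι-inverse′ k 1≤k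
            (ℕ.≤-trans k≤m m≤N)) (trans (∑-cong m λ { (suc i) _ _ → ones i }) (∑-neg m _))))
             (trans (cong (λ x → ι m * - x) (H-last 1 m 1≤m)) (solve 2 (λ u x → u :* (:- (x :+ u :^ 1)) := (:- (u :* x :+ u :^ 2))) refl
                 (ι m) (H 1 (m ∸ 1))))) ⟩
      ∑ N (λ m → - (ι m * H 1 (m ∸ 1) + ι m ^ 2))
        ≡⟨ trans (∑-neg N _) (cong -_ (∑-+ N _ _)) ⟩
      - (e₂ N + S 2) ∎
      where
      ones : ∀ i → ι (suc i) * binomial-transform (- 1#) (λ _ → 1#) (suc i) ≡ - ι (suc i) ^ 1
      ones i = trans (cong (ι (suc i) *_) (trans (∑-cong (suc i) λ k _ _ → cong (⌊ suc i C k ⌋ *_) (*-identityʳ _)) (transform-one (- 1#) (suc i))))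
        (solve 2 (λ u x → u :* ((# 1 :+ (:- # 1)) :* x :- # 1) := (:- (u :^ 1))) refl (ι (suc i)) ((1# + - 1#) ^ i))
    binomials : S 2 - P * (U + S 3) ≈[ 2 ] - (e₂ N + S 2)
    binomials = ≈-trans (≈-sym expanded) (≈-reflexive exact)
      where
      expanded : binomial-transform (- 1#) (λ k → ι k * (ι k * 1#)) N ≈[ 2 ] S 2 - P * (U + S 3)
      expanded = ≈-trans (≈-∑ N term) (≈-reflexive (trans (∑-minus N _ _) (cong (λ x → S 2 - x) (trans (∑-*ˡ N P _) (cong (P *_) (∑-+ N _ _))))))
        where
        term : ∀ k → 1 ≤ k → k ≤ N → ⌊ N C k ⌋ * ((- 1#) ^ k * (ι k * (ι k * 1#))) ≈[ 2 ] ι k ^ 2 - P * (ι k * (ι k * H 1 (k ∸ 1)) + ι k ^ 3)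
        term k 1≤k k≤N = ≈-trans (≈-reflexive (trans (solve 3 (λ b s u → b :* (s :* (u :* (u :* # 1))) := s :* b :* u :^ 2) refl ⌊ N C k ⌋
            ((- 1#) ^ k) (ι k)) (cong (_* ι k ^ 2) (signed-binomial N 1# (sym (*-identityʳ P)) k k≤N))))
          (combine (null-* (ι k ^ 2) (null-P 1 (difference (≈-trans (excess≈ y k)
              (≈-reflexive (trans (∑-neg k _) (cong -_ (trans (∑-cong k λ i _ _ → trans (*-identityˡ (ι i)) (sym (*-identityʳ (ι i))))
              (H-last 1 k 1≤k)))))))))
            (solve 4 (λ P x u z → (# 1 :+ P :* x) :* u :^ 2 :- (u :^ 2 :- P :* (u :* (u :* z) :+ u :^ 3))
                := u :^ 2 :* (P :^ 1 :* (x :- (:- (z :+ u :^ 1))))) refl P (excess y k) (ι k) (H 1 (k ∸ 1))))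
          where
          y : ℕ → A
          y i = - (1# * ι i)

  -- Eliminating Z leaves 8V ≡ -4 U h_1 plus four times two alternating sums; then 2U ≡ -T and h_1 ≡
  -- -2q.
  V-value : ⌊ 8 ⌋ * V + ⌊ 5 ⌋ * q * T + ⌊ 2 ⌋ * Ω ≈[ 1 ] 0#
  V-value = cancel 4 p∤4 (combine
    (null-+ (null-+ (null-+ (null-+ (null-+ (null-* ⌊ 32 ⌋ (difference V≈)) (null-* (- ⌊ 16 ⌋) Z-value)) (null-* (- ⌊ 8 ⌋ * h 1) U-value))
        (null-* ⌊ 8 ⌋ alternating-22)) (null-* ⌊ 2 ⌋ alternating-13)) (null-* (⌊ 10 ⌋ * T) h₁≈-2q))
    (solve 9 (λ V q T O U h Z a b → # 4 :* (# 8 :* V :+ # 5 :* q :* T :+ # 2 :* O) :- # 0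
        := # 32 :* (V :- ((:- U) :* h :- Z)) :+ (:- # 16) :* (# 2 :* Z :+ U :* h :+ (a :+ b)) :+ (:- # 8) :* h :* (# 2 :* U :+ T) :+ # 8 :*
        (# 2 :* a :+ O) :+ # 2 :* (# 8 :* b :- h :* T) :+ # 10 :* T :* (h :+ # 2 :* q)) refl V q T Ω U (h 1) Z (alternating 2 2) (alternating 1 3)))

  W₁₃-value : ⌊ 8 ⌋ * W₁₃ + Ω ≈[ 1 ] 0#
  W₁₃-value = combine (null-+ (null-+ (null-+ (null-* ⌊ 8 ⌋ (difference W₁₃≈-Y)) (null-* (- ⌊ 4 ⌋) Y-value)) alternating-31)
      (null-* ⌊ 2 ⌋ alternating-22))
    (solve 5 (λ W O Y a b → # 8 :* W :+ O :- # 0 := # 8 :* (W :- (:- Y)) :+ (:- # 4) :* (# 2 :* Y :+ (a :+ b)) :+ (# 4 :* a :- O) :+ # 2 :*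
        (# 2 :* b :+ O)) refl W₁₃ Ω Y (alternating 3 1) (alternating 2 2))

  -- The shuffle relation solved for λ_4, with λ_1 ≡ -2q, λ_2 ≡ -q² and the value of λ_3 modulo p.
  λ₂4-value : ⌊ 48 ⌋ * λ₂ 4 + ⌊ 4 ⌋ * q ^ 4 - ⌊ 7 ⌋ * q * T - ⌊ 3 ⌋ * Ω ≈[ 1 ] 0#
  λ₂4-value = combine
    (null-+ (null-+ (null-+ (null-+ (null-* ⌊ 12 ⌋ (difference λ₂-shuffle)) (null-* (- ⌊ 24 ⌋ * λ₂ 3) (difference λ₂1-value)))
        (null-* (⌊ 12 ⌋ * (λ₂ 2 - q ^ 2)) (difference λ₂2-value))) (null-* q λ₂3-value₁)) (null-* (- ⌊ 3 ⌋) W₁₃-value))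
    (solve 8 (λ a b c d q T O W → # 48 :* d :+ # 4 :* q :^ 4 :- # 7 :* q :* T :- # 3 :* O :- # 0
        := # 12 :* (# 2 :* (a :* c) :- b :* b :- ((:- (# 2 :* W)) :- # 4 :* d)) :+ (:- # 24) :* c :* (a :- (:- (# 2 :* q))) :+ # 12 :*
        (b :- q :^ 2) :* (b :- (:- (q :^ 2))) :+ q :* (# 48 :* c :+ # 16 :* q :^ 3 :- # 7 :* T) :+ (:- # 3) :* (# 8 :* W :+ O)) refl (λ₂ 1)
        (λ₂ 2) (λ₂ 3) (λ₂ 4) q T Ω W₁₃)

  -- This is 48 times the final congruence with T still in place of the Bernoulli numbers.
  λ₂3-congruence : ⌊ 48 ⌋ * λ₂ 3 + ⌊ 16 ⌋ * q ^ 3 - ⌊ 7 ⌋ * T - ⌊ 20 ⌋ * P * q ^ 4 + ⌊ 28 ⌋ * P * q * T + ⌊ 18 ⌋ * P * Ω ≈[ 2 ] 0#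
  λ₂3-congruence = combine (null-+ (null-+ λ₂3-value (null-* ⌊ 6 ⌋ (null-P 1 V-value))) (null-* (- ⌊ 2 ⌋) (null-P 1 λ₂4-value)))
    (solve 7 (λ P L V M q T O → # 48 :* L :+ # 16 :* q :^ 3 :- # 7 :* T :- # 20 :* P :* q :^ 4 :+ # 28 :* P :* q :* T :+ # 18 :* P :* O :- #
        0 := # 48 :* L :- # 48 :* P :* V :+ # 96 :* P :* M :+ # 16 :* q :^ 3 :- # 7 :* T :- # 12 :* P :* q :^ 4 :- # 16 :* P :* q :* T :+ #
        6 :* (P :^ 1 :* (# 8 :* V :+ # 5 :* q :* T :+ # 2 :* O)) :+ (:- # 2) :*
        (P :^ 1 :* (# 48 :* M :+ # 4 :* q :^ 4 :- # 7 :* q :* T :- # 3 :* O))) refl P (λ₂ 3) V (λ₂ 4) q T Ω)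

-- Bernoulli numbers and sums of powers

module PowerSums (n : ℕ) (p-prime : Prime (suc (n ℕ.+ n))) (5<p : 5 < suc (n ℕ.+ n)) (L : LocalRing (suc (n ℕ.+ n))) where
  open HalfRange n p-prime 5<p L public

  6≤N : 6 ≤ N
  6≤N = ℕ.+-mono-≤ (3≤half n 5<p) (3≤half n 5<p)

  null-product : ∀ {i j x y} → x ≈[ i ] 0# → y ≈[ j ] 0# → x * y ≈[ i ℕ.+ j ] 0#
  null-product {i} {j} {x} {y} (c by eq) (d by eq′) = (c * d) by trans (cong₂ _*_ eq eq′) (trans
    (solve 4 (λ a b c d → (# 0 :+ a :* c) :* (# 0 :+ b :* d) := # 0 :+ a :* b :* (c :* d)) refl (P ^ i) (P ^ j) c d)
        (cong (λ x → 0# + x * (c * d)) (sym (^-homo-* P i j))))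

  -- κ j = pʲ/(j+1), for j + 1 < 2p.
  κ : ℕ → A
  κ j with suc j ℕ.≟ p
  ... | yes _ = P ^ (j ∸ 1)
  ... | no _ = P ^ j * ι (suc j)

  private
    p∤suc : ∀ j → suc j < p ℕ.+ p → suc j ≢ p → ¬ p ∣ suc j
    p∤suc j j<2p j≢p with ℕ.<-cmp (suc j) p
    ... | tri< j<p _ _ = p∤ (suc j) (s≤s z≤n) (ℕ.≤-pred j<p)
    ... | tri≈ _ j≡p _ = ⊥-elim (j≢p j≡p)
    ... | tri> _ _ p<j = p∤between (suc j) p<j (ℕ.≤-pred (subst (suc (suc j) ≤_) (ℕ.+-suc p N) j<2p))

  κ-spec : ∀ j → suc j < p ℕ.+ p → ⌊ suc j ⌋ * κ j ≡ P ^ j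
  κ-spec j j<2p with suc j ℕ.≟ p
  ... | yes refl = P-step N (ℕ.≤-trans (s≤s z≤n) 6≤N)
    where
    P-step : ∀ m → 1 ≤ m → P * P ^ (m ∸ 1) ≡ P ^ m
    P-step (suc m) _ = refl
  ... | no j≢p = trans (solve 3 (λ a x y → a :* (x :* y) := x :* (a :* y)) refl ⌊ suc j ⌋ (P ^ j) (ι (suc j)))
      (trans (cong (P ^ j *_) (ι-inverse (suc j) (p∤suc j j<2p j≢p))) (*-identityʳ _))

  null-^ : ∀ i j → i ≤ j → P ^ j ≈[ i ] 0#
  null-^ i j i≤j = (P ^ (j ∸ i)) by trans (cong (P ^_) (sym (ℕ.m+[n∸m]≡n i≤j))) (trans (^-homo-* P i (j ∸ i)) (sym (+-identityˡ _)))

  -- Here and for the two higher powers below: the division by j + 1 costs a factor p only at j = p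
  -- - 1, where p^(p-2) is still divisible by p³.
  κ-null₁ : ∀ j → 1 ≤ j → κ j ≈[ 1 ] 0#
  κ-null₁ j 1≤j with suc j ℕ.≟ p
  ... | yes refl = null-^ 1 (N ∸ 1) (ℕ.∸-monoˡ-≤ 1 (ℕ.≤-trans (s≤s (s≤s z≤n)) 6≤N))
  ... | no _ = null-*ʳ (ι (suc j)) (null-^ 1 j 1≤j)

  κ-null₂ : ∀ j → 2 ≤ j → κ j ≈[ 2 ] 0#
  κ-null₂ j 2≤j with suc j ℕ.≟ p
  ... | yes refl = null-^ 2 (N ∸ 1) (ℕ.∸-monoˡ-≤ 1 (ℕ.≤-trans (s≤s (s≤s (s≤s z≤n))) 6≤N))
  ... | no _ = null-*ʳ (ι (suc j)) (null-^ 2 j 2≤j)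

  κ-null₃ : ∀ j → 3 ≤ j → κ j ≈[ 3 ] 0#
  κ-null₃ j 3≤j with suc j ℕ.≟ p
  ... | yes refl = null-^ 3 (N ∸ 1) (ℕ.∸-monoˡ-≤ 1 (ℕ.≤-trans (s≤s (s≤s (s≤s (s≤s z≤n)))) 6≤N))
  ... | no _ = null-*ʳ (ι (suc j)) (null-^ 3 j 3≤j)

  κ-0 : κ 0 ≡ 1#
  κ-0 = trans (sym (*-identityˡ _)) (κ-spec 0 (s≤s (ℕ.≤-trans (ℕ.≤-trans (s≤s z≤n) 6≤N) (ℕ.m≤m+n N p))))

  PS G : ℕ → A
  PS a = ∑ N (λ k → ⌊ k ⌋ ^ a)
  G a = ∑ n (λ j → ⌊ j ⌋ ^ a)

  power-sum-PS : ∀ m → 1 ≤ m → power-sum p m ≡ PS m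
  power-sum-PS (suc m) _ = shifted N
    where
    shifted : ∀ M → power-sum (suc M) (suc m) ≡ ∑ M (λ k → ⌊ k ⌋ ^ suc m)
    shifted zero = trans (+-identityˡ _) (zeroˡ _)
    shifted (suc M) = cong (_+ ⌊ suc M ⌋ ^ suc m) (shifted M)

  frobenius : ∀ x → (1# + x) ^ p ≈[ 1 ] 1# + x ^ p
  frobenius x = ≈-trans (≈-reflexive (trans (solve 1 (λ y → y := # 1 :+ (y :- # 1)) refl ((1# + x) ^ p)) (cong (1# +_) (sym (transform-one x p)))))
    (≈-+ ≈-refl (≈-trans (≈-+ (null-∑ N λ { (suc j) 1≤j j≤N → null-*ʳ (x ^ suc j) (binomial-null j 1≤j j≤N) })
        (≈-reflexive (trans (cong (_* x ^ p) (⌊nCn⌋ p)) (*-identityˡ _)))) (≈-reflexive (+-identityˡ _))))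
    where
    binomial-null : ∀ j → 1 ≤ suc j → suc j ≤ N → ⌊ p C suc j ⌋ ≈[ 1 ] 0#
    binomial-null j 1≤j j≤N = (⌊ N C j ⌋ * ι (suc j)) by trans (trans (sym (*-identityʳ _))
        (trans (cong (⌊ p C suc j ⌋ *_) (sym (ι-inverse′ (suc j) 1≤j j≤N)))
      (solve 3 (λ c j u → c :* (j :* u) := j :* c :* u) refl ⌊ p C suc j ⌋ ⌊ suc j ⌋ (ι (suc j)))))
          (trans (cong (_* ι (suc j)) (absorb N j)) (solve 3 (λ P c u → P :* c :* u := # 0 :+ P :^ 1 :* (c :* u)) refl P ⌊ N C j ⌋ (ι (suc j))))

  fermat-p : ∀ k → ⌊ k ⌋ ^ p ≈[ 1 ] ⌊ k ⌋
  fermat-p zero = ≈-reflexive (zeroˡ _)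
  fermat-p (suc k) = ≈-trans (≈-reflexive (cong (_^ p) (⌊suc⌋ k))) (≈-trans (frobenius ⌊ k ⌋)
      (≈-trans (≈-+ ≈-refl (fermat-p k)) (≈-reflexive (sym (⌊suc⌋ k)))))

  fermat : ∀ k → 1 ≤ k → k ≤ N → ⌊ k ⌋ ^ N ≈[ 1 ] 1#
  fermat k 1≤k k≤N = ≈-trans (≈-reflexive (trans (sym (*-identityˡ _))
      (trans (cong (_* ⌊ k ⌋ ^ N) (sym (ι-inverse′ k 1≤k k≤N))) (solve 3 (λ k u x → k :* u :* x := u :* (k :* x)) refl ⌊ k ⌋ (ι k) (⌊ k ⌋ ^ N)))))
    (≈-trans (≈-*ˡ (ι k) (fermat-p k)) (≈-reflexive (trans (*-comm _ _) (ι-inverse′ k 1≤k k≤N))))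

  -- The binomial coefficient C(s+2,2), which is the coefficient of y^s P² in (y - P)^(s+2).
  triangular : ℕ → A
  triangular zero = 1#
  triangular (suc s) = triangular s + ⌊ suc (suc s) ⌋

  shift-expand₂ : ∀ y s → (y - P) ^ suc s ≈[ 2 ] y ^ suc s - ⌊ suc s ⌋ * P * y ^ s
  shift-expand₂ y zero = ≈-reflexive (solve 2 (λ y P → (y :- P) :^ 1 := y :^ 1 :- # 1 :* P :* # 1) refl y P)
  shift-expand₂ y (suc s) = ≈-trans (≈-*ˡ (y - P) (shift-expand₂ y s))
      (combine (multiple (⌊ suc s ⌋ * y ^ s)) (trans (cong (λ x → (y - P) * (y ^ suc s - ⌊ suc s ⌋ * P * y ^ s) -
      (y ^ suc (suc s) - x * P * y ^ suc s)) (⌊suc⌋ (suc s)))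
    (solve 4 (λ y P z c → (y :- P) :* (y :* z :- c :* P :* z) :- (y :* (y :* z) :- (# 1 :+ c) :* P :* (y :* z)) := P :^ 2 :* (c :* z)) refl
        y P (y ^ s) ⌊ suc s ⌋)))

  shift-expand₃ : ∀ y s → (y - P) ^ suc (suc s) ≈[ 3 ] y ^ suc (suc s) - ⌊ suc (suc s) ⌋ * P * y ^ suc s + triangular s * P ^ 2 * y ^ s
  shift-expand₃ y zero = ≈-reflexive (solve 2 (λ y P → (y :- P) :^ 2 := y :^ 2 :- # 2 :* P :* y :^ 1 :+ # 1 :* P :^ 2 :* # 1) refl y P)
  shift-expand₃ y (suc s) = ≈-trans (≈-*ˡ (y - P) (shift-expand₃ y s)) (combine (multiple (- (triangular s * y ^ s)))
    (solve 5 (λ y P z c t → (y :- P) :* (y :* (y :* z) :- c :* P :* (y :* z) :+ t :* P :^ 2 :* z) :-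
        (y :* (y :* (y :* z)) :- (# 1 :+ c) :* P :* (y :* (y :* z)) :+ (t :+ c) :* P :^ 2 :* (y :* z)) := P :^ 3 :* (:- (t :* z))) refl y P
        (y ^ s) ⌊ suc (suc s) ⌋ (triangular s)))

  -- Here b_m stands for p B_m, and `b-spec` is Faulhaber's formula for the sum of k^m over k < p.
  -- The argument uses nothing else about Bernoulli numbers.
  module BernoulliNumbers (b : ℕ → A) (m₀ : ℕ) (b-spec : ∀ m → m ≤ m₀ → power-sum p m ≡ (κ ⋆ b) m) where

    b-expand : ∀ m → 1 ≤ m → m ≤ m₀ → PS m ≡ b m + ∑ m (λ j → ⌊ m C j ⌋ * (κ j * b (m ∸ j)))
    b-expand m 1≤m m≤ = trans (sym (power-sum-PS m 1≤m)) (trans (b-spec m m≤)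
        (trans (⋆-expand κ b m) (cong (_+ ∑ m (λ j → ⌊ m C j ⌋ * (κ j * b (m ∸ j)))) (trans (cong (_* b m) κ-0) (*-identityˡ _)))))

    from-expand : ∀ {k} m → 1 ≤ m → m ≤ m₀ → ∑ m (λ j → ⌊ m C j ⌋ * (κ j * b (m ∸ j))) ≈[ k ] 0# → b m ≈[ k ] PS m
    from-expand m 1≤m m≤ null = ≈-sym (≈-trans (≈-reflexive (b-expand m 1≤m m≤)) (≈-trans (≈-+ ≈-refl null) (≈-reflexive (+-identityʳ _))))

    b≈PS₁ : ∀ m → 1 ≤ m → m ≤ m₀ → b m ≈[ 1 ] PS m
    b≈PS₁ m 1≤m m≤ = from-expand m 1≤m m≤ (null-∑ m λ j 1≤j _ → null-* ⌊ m C j ⌋ (null-*ʳ (b (m ∸ j)) (κ-null₁ j 1≤j)))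

    -- Since k^M ≡ 1, the exponents s, s + 1, s + 2 act modulo p like -4, -3, -2. The Bernoulli
    -- number concerned has index s + 2 = M - 2, for M = p - 1 and M = 2(p - 1).
    module Voronoi (s M : ℕ) (1≤s : 1 ≤ s) (s+4≡M : s ℕ.+ 4 ≡ M) (s+2≤m₀ : suc (suc s) ≤ m₀)
             (even : (- 1#) ^ M ≡ 1#) (unit : ¬ p ∣ suc (suc s)) (fermat-M : ∀ k → 1 ≤ k → k ≤ N → ⌊ k ⌋ ^ M ≈[ 1 ] 1#) where

      power-ι : ∀ k a c → a ℕ.+ c ≡ M → 1 ≤ k → k ≤ N → ⌊ k ⌋ ^ a ≡ ι k ^ c * ⌊ k ⌋ ^ M
      power-ι k a c a+c≡M 1≤k k≤N = begin
        x ^ a                         ≡⟨ sym (*-identityʳ _) ⟩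
        x ^ a * 1#                    ≡⟨ cong (x ^ a *_) (sym (trans (sym (^-distrib-* x (ι k) c))
            (trans (cong (_^ c) (ι-inverse′ k 1≤k k≤N)) (1^ c)))) ⟩
        x ^ a * (x ^ c * ι k ^ c)     ≡⟨ solve 3 (λ a c u → a :* (c :* u) := u :* (a :* c)) refl (x ^ a) (x ^ c) (ι k ^ c) ⟩
        ι k ^ c * (x ^ a * x ^ c)     ≡⟨ cong (ι k ^ c *_) (trans (sym (^-homo-* x a c)) (cong (x ^_) a+c≡M)) ⟩
        ι k ^ c * x ^ M               ∎
        where
        open ≡-Reasoning
        x = ⌊ k ⌋

      power≈ι : ∀ a c → a ℕ.+ c ≡ M → ∀ k → 1 ≤ k → k ≤ N → ⌊ k ⌋ ^ a ≈[ 1 ] ι k ^ c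
      power≈ι a c eq k 1≤k k≤N = ≈-trans (≈-reflexive (power-ι k a c eq 1≤k k≤N))
          (≈-trans (≈-*ˡ (ι k ^ c) (fermat-M k 1≤k k≤N)) (≈-reflexive (*-identityʳ _)))

      s+3 : suc s ℕ.+ 3 ≡ M
      s+3 = trans (sym (ℕ.+-suc s 3)) s+4≡M

      s+2 : suc (suc s) ℕ.+ 2 ≡ M
      s+2 = trans (sym (ℕ.+-suc (suc s) 2)) s+3

      PS-s-null : PS s ≈[ 1 ] 0#
      PS-s-null = ≈-trans (≈-∑ N (power≈ι s 4 s+4≡M)) S₄-null

      G-s-null : G s ≈[ 1 ] 0#
      G-s-null = ≈-trans (≈-∑ n λ j 1≤j j≤n → power≈ι s 4 s+4≡M j 1≤j (ℕ.≤-trans j≤n n≤N)) h₄-null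

      PS-s+2-null : PS (suc (suc s)) ≈[ 1 ] 0#
      PS-s+2-null = ≈-trans (≈-∑ N (power≈ι (suc (suc s)) 2 s+2)) S₂-null

      even-s : (- 1#) ^ s ≡ 1#
      even-s = trans (trans (solve 1 (λ x → x := x :* (:- # 1) :^ 4) refl ((- 1#) ^ s))
          (trans (sym (^-homo-* (- 1#) s 4)) (cong ((- 1#) ^_) s+4≡M))) even

      negate : ∀ y a → (P - y) ^ a ≡ (- 1#) ^ a * (y - P) ^ a
      negate y a = trans (cong (_^ a) (solve 2 (λ P y → P :- y := (:- # 1) :* (y :- P)) refl P y)) (^-distrib-* (- 1#) (y - P) a)

      reflect₂ : ∀ y → (P - y) ^ suc s ≈[ 2 ] - y ^ suc s + ⌊ suc s ⌋ * P * y ^ s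
      reflect₂ y = ≈-trans (≈-reflexive (trans (negate y (suc s)) (cong (λ x → - 1# * x * (y - P) ^ suc s) even-s)))
          (≈-trans (≈-*ˡ (- 1# * 1#) (shift-expand₂ y s)) (≈-reflexive
          (solve 2 (λ x z → (:- # 1) :* # 1 :* (x :- z) := (:- x) :+ z) refl (y ^ suc s) (⌊ suc s ⌋ * P * y ^ s))))

      reflect₃ : ∀ y → (P - y) ^ suc (suc s) ≈[ 3 ] 1# * y ^ suc (suc s) + (- (⌊ suc (suc s) ⌋ * P)) * y ^ suc s + triangular s * P ^ 2 * y ^ s
      reflect₃ y = ≈-trans (≈-reflexive (trans (negate y (suc (suc s))) (cong (λ x → - 1# * (- 1# * x) * (y - P) ^ suc (suc s)) even-s)))
          (≈-trans (≈-*ˡ (- 1# * (- 1# * 1#)) (shift-expand₃ y s))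
        (≈-reflexive (solve 4 (λ x c z w → (:- # 1) :* ((:- # 1) :* # 1) :* (x :- c :* z :+ w) := # 1 :* x :+ (:- c) :* z :+ w) refl
            (y ^ suc (suc s)) (⌊ suc (suc s) ⌋ * P) (y ^ suc s) (triangular s * P ^ 2 * y ^ s))))

      PS-s+1-null : PS (suc s) ≈[ 2 ] 0#
      PS-s+1-null = cancel 2 p∤2 (combine (null-+ (difference reflected) (null-* ⌊ suc s ⌋ (null-P 1 PS-s-null)))
          (solve 4 (λ P c x y → # 2 :* x :- # 0 := x :- ((:- x) :+ c :* P :* y) :+ c :* (P :^ 1 :* y)) refl P ⌊ suc s ⌋ (PS (suc s)) (PS s)))
        where
        reflected : PS (suc s) ≈[ 2 ] - PS (suc s) + ⌊ suc s ⌋ * P * PS s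
        reflected = ≈-trans (≈-reflexive (trans (∑-reverse N _) (∑-cong N λ k _ k≤N → cong (_^ suc s) (⌊∸⌋ p k (ℕ.m≤n⇒m≤1+n k≤N)))))
            (≈-trans (≈-∑ N λ k _ _ → reflect₂ ⌊ k ⌋)
          (≈-reflexive (trans (∑-+ N _ _) (cong₂ _+_ (∑-neg N _) (∑-*ˡ N (⌊ suc s ⌋ * P) _)))))

      b-s-null : b s ≈[ 1 ] 0#
      b-s-null = ≈-trans (b≈PS₁ s 1≤s (ℕ.≤-trans (ℕ.m≤n⇒m≤1+n (ℕ.n≤1+n s)) s+2≤m₀)) PS-s-null

      b-s+1-null : b (suc s) ≈[ 2 ] 0#
      b-s+1-null = ≈-trans (from-expand (suc s) (s≤s z≤n) (ℕ.≤-trans (ℕ.n≤1+n (suc s)) s+2≤m₀) (≈-trans (≈-reflexive (∑-first s _)) (null-+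
        (null-* ⌊ suc s C 1 ⌋ (null-product (κ-null₁ 1 ℕ.≤-refl) b-s-null))
        (null-∑ s λ j 1≤j _ → null-* ⌊ suc s C suc j ⌋ (null-*ʳ (b (s ∸ j)) (κ-null₂ (suc j) (s≤s 1≤j))))))) PS-s+1-null

      -- In Faulhaber's formula the corrections are κ_1 b_(s+1), κ_2 b_s and terms with κ_j for j ≥
      -- 3. They vanish modulo p · p², p² · p and p³ respectively.
      b≈PS₃ : b (suc (suc s)) ≈[ 3 ] PS (suc (suc s))
      b≈PS₃ = from-expand (suc (suc s)) (s≤s z≤n) s+2≤m₀ (≈-trans (≈-reflexive
          (trans (∑-first (suc s) _) (cong (⌊ suc (suc s) C 1 ⌋ * (κ 1 * b (suc s)) +_) (∑-first s _)))) (null-+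
        (null-* ⌊ suc (suc s) C 1 ⌋ (null-product (κ-null₁ 1 ℕ.≤-refl) b-s+1-null)) (null-+
        (null-* ⌊ suc (suc s) C 2 ⌋ (null-product (κ-null₂ 2 ℕ.≤-refl) b-s-null))
        (null-∑ s λ j 1≤j _ → null-* ⌊ suc (suc s) C suc (suc j) ⌋ (null-*ʳ (b (s ∸ j)) (κ-null₃ (suc (suc j)) (s≤s (s≤s 1≤j))))))))

      private
        c t : A
        c = triangular s
        t = ⌊ 2 ⌋ ^ s

      PS-fold : PS (suc (suc s)) ≈[ 3 ] G (suc (suc s)) + (1# * G (suc (suc s)) + (- (⌊ suc (suc s) ⌋ * P)) * G (suc s) + c * P ^ 2 * G s)
      PS-fold = ≈-trans (≈-reflexive (trans (∑-fold _) (cong (G (suc (suc s)) +_)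
          (∑-cong n λ j _ j≤n → cong (_^ suc (suc s)) (⌊∸⌋ p j (ℕ.≤-trans j≤n (ℕ.m≤n⇒m≤1+n n≤N)))))))
        (≈-+ ≈-refl (≈-trans (≈-∑ n λ j _ _ → reflect₃ ⌊ j ⌋) (≈-reflexive (∑-linear₃ n 1# (- (⌊ suc (suc s) ⌋ * P)) (c * P ^ 2) _ _ _))))

      PS-even-odd : PS (suc (suc s)) ≈[ 3 ] ⌊ 2 ⌋ * (⌊ 2 ⌋ * t) * G (suc (suc s)) +
          (1# * (⌊ 2 ⌋ * (⌊ 2 ⌋ * t) * G (suc (suc s))) + (- (⌊ suc (suc s) ⌋ * P)) * (⌊ 2 ⌋ * t * G (suc s)) + c * P ^ 2 * (t * G s))
      PS-even-odd = ≈-trans (≈-reflexive (trans (∑-even-odd n _) (cong₂ _+_ (doubled (suc (suc s)))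
          (∑-cong n λ j _ j≤n → cong (_^ suc (suc s)) (⌊∸⌋ p (j ℕ.+ j) (ℕ.m≤n⇒m≤1+n (double≤ j≤n)))))))
        (≈-+ ≈-refl (≈-trans (≈-∑ n λ j _ _ → reflect₃ ⌊ j ℕ.+ j ⌋) (≈-reflexive
            (trans (∑-linear₃ n 1# (- (⌊ suc (suc s) ⌋ * P)) (c * P ^ 2) (λ j → ⌊ j ℕ.+ j ⌋ ^ suc (suc s)) (λ j → ⌊ j ℕ.+ j ⌋ ^ suc s)
            (λ j → ⌊ j ℕ.+ j ⌋ ^ s))
          (cong₂ _+_ (cong₂ (λ x y → 1# * x + (- (⌊ suc (suc s) ⌋ * P)) * y) (doubled (suc (suc s))) (doubled (suc s)))
              (cong (c * P ^ 2 *_) (doubled s)))))))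
        where
        doubled : ∀ a → ∑ n (λ j → ⌊ j ℕ.+ j ⌋ ^ a) ≡ ⌊ 2 ⌋ ^ a * G a
        doubled a = trans (∑-cong n λ j _ _ → trans (cong (_^ a) (trans (⌊+⌋ j j) (solve 1 (λ x → x :+ x := # 2 :* x) refl ⌊ j ⌋)))
            (^-distrib-* ⌊ 2 ⌋ ⌊ j ⌋ a)) (∑-*ˡ n (⌊ 2 ⌋ ^ a) _)

      b-quotient : b (suc (suc s)) ≈[ 1 ] 0#
      b-quotient = ≈-trans (≈-drop (≈-drop b≈PS₃)) PS-s+2-null

      -- B_(s+2) and B_(s+2)/(s+2): the first is obtained as the quotient of p B_(s+2) by p, which
      -- shows its integrality as well.
      β f : A
      β = quotient b-quotient
      f = β * ι (suc (suc s))

      b≡Pβ : b (suc (suc s)) ≡ P * β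
      b≡Pβ = trans (equation b-quotient) (solve 2 (λ P x → # 0 :+ P :^ 1 :* x := P :* x) refl P β)

      β≡ : β ≡ ⌊ suc (suc s) ⌋ * f
      β≡ = sym (trans (solve 3 (λ a x u → a :* (x :* u) := x :* (a :* u)) refl ⌊ suc (suc s) ⌋ β (ι (suc (suc s))))
          (trans (cong (β *_) (ι-inverse (suc (suc s)) unit)) (*-identityʳ _)))

      -- Subtracting the even-odd splitting from 2^(s+2) times the folded sum eliminates G(s+2),
      -- while G(s) comes with p² and is itself divisible by p. One factor p and the unit s + 2 are
      -- then cancelled; the factor 8 only turns 2^(s+1) into 2^M.
      voronoi : (⌊ 2 ⌋ * ⌊ 2 ⌋ ^ M - ⌊ 8 ⌋) * f + ⌊ 2 ⌋ ^ M * G (suc s) ≈[ 2 ] 0#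
      voronoi = cancel (suc (suc s)) unit (combine (null-* ⌊ 8 ⌋ (cancel-P regular 1 reduced))
          (trans (cong (λ x → ⌊ suc (suc s) ⌋ * ((⌊ 2 ⌋ * x - ⌊ 8 ⌋) * f + x * G (suc s)) - 0#) 2^M)
          (solve 4 (λ m t f g → m :* ((# 2 :* (# 8 :* (# 2 :* t)) :- # 8) :* f :+ # 8 :* (# 2 :* t) :* g) :- # 0
              := # 8 :* ((# 2 :* (# 2 :* t) :- # 1) :* (m :* f) :+ m :* (# 2 :* t) :* g)) refl ⌊ suc (suc s) ⌋ t f (G (suc s)))))
        where
        2^M : ⌊ 2 ⌋ ^ M ≡ ⌊ 8 ⌋ * (⌊ 2 ⌋ * t)
        2^M = trans (cong (⌊ 2 ⌋ ^_) (sym s+4≡M)) (trans (^-homo-* ⌊ 2 ⌋ s 4) (solve 1 (λ t → t :* # 2 :^ 4 := # 8 :* (# 2 :* t)) refl t))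
        reduced : P ^ 1 * ((⌊ 2 ⌋ * (⌊ 2 ⌋ * t) - 1#) * (⌊ suc (suc s) ⌋ * f) + ⌊ suc (suc s) ⌋ * (⌊ 2 ⌋ * t) * G (suc s)) ≈[ 3 ] 0#
        reduced = combine (null-+ (null-+ (null-+ (null-+ (null-* (⌊ 4 ⌋ * t - 1#) (difference b≈PS₃))
            (null-* (⌊ 4 ⌋ * t) (difference PS-fold))) (null-* (- 1#) (difference PS-even-odd)))
            (null-* (⌊ 3 ⌋ * t * c) (null-P 2 G-s-null))) (≈-reflexive β-terms))
          (solve 10 (λ P t m f g G2 G0 S b c → P :^ 1 :* ((# 2 :* (# 2 :* t) :- # 1) :* (m :* f) :+ m :* (# 2 :* t) :* g) :- # 0
              := (# 4 :* t :- # 1) :* (b :- S) :+ # 4 :* t :* (S :- (G2 :+ (# 1 :* G2 :+ (:- (m :* P)) :* g :+ c :* P :^ 2 :* G0))) :+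
              (:- # 1) :* (S :- (# 2 :* (# 2 :* t) :* G2 :+ (# 1 :* (# 2 :* (# 2 :* t) :* G2) :+ (:- (m :* P)) :*
              (# 2 :* t :* g) :+ c :* P :^ 2 :* (t :* G0)))) :+ # 3 :* t :* c :* (P :^ 2 :* G0) :+ (# 4 :* t :- # 1) :*
              (P :* (m :* f) :- b)) refl P t ⌊ suc (suc s) ⌋ f (G (suc s)) (G (suc (suc s))) (G s) (PS (suc (suc s))) (b (suc (suc s))) c)
          where
          β-terms : (⌊ 4 ⌋ * t - 1#) * (P * (⌊ suc (suc s) ⌋ * f) - b (suc (suc s))) ≡ 0#
          β-terms = trans (cong ((⌊ 4 ⌋ * t - 1#) *_) (trans (cong₂ (λ x y → P * x - y) (sym β≡) b≡Pβ)
              (solve 1 (λ x → x :- x := # 0) refl (P * β)))) (zeroʳ _)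

      G-s+1 : G (suc s) ≡ ∑ n (λ j → ι j ^ 3 * ⌊ j ⌋ ^ M)
      G-s+1 = ∑-cong n λ j 1≤j j≤n → power-ι j (suc s) 3 s+3 1≤j (ℕ.≤-trans j≤n n≤N)

2+[m∸4] : ∀ m → 4 ≤ m → suc (suc (m ∸ 4)) ≡ m ∸ 2
2+[m∸4] (suc (suc (suc (suc m)))) _ = refl
2+[m∸4] (suc zero) (s≤s ())
2+[m∸4] (suc (suc zero)) (s≤s (s≤s ()))
2+[m∸4] (suc (suc (suc zero))) (s≤s (s≤s (s≤s ())))

-- The congruence in the local ring

module LocalCongruence (n : ℕ) (p-prime : Prime (suc (n ℕ.+ n))) (5<p : 5 < suc (n ℕ.+ n)) (L : LocalRing (suc (n ℕ.+ n))) where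
  open PowerSums n p-prime 5<p L public

  4≤N : 4 ≤ N
  4≤N = ℕ.≤-trans (s≤s (s≤s (s≤s (s≤s z≤n)))) 6≤N

  4≤2N : 4 ≤ N ℕ.+ N
  4≤2N = ℕ.≤-trans 4≤N (ℕ.m≤m+n N N)

  p∤N∸2 : ¬ p ∣ suc (suc (N ∸ 4))
  p∤N∸2 = p∤ _ (s≤s z≤n) (subst (_≤ N) (sym (2+[m∸4] N 4≤N)) (ℕ.m∸n≤m N 2))

  p∤2N∸2 : ¬ p ∣ suc (suc (N ℕ.+ N ∸ 4))
  p∤2N∸2 = p∤between _ (subst (p <_) (sym (2+[m∸4] (N ℕ.+ N) 4≤2N)) lower)
      (subst (_≤ p ℕ.+ N) (sym (2+[m∸4] (N ℕ.+ N) 4≤2N)) (ℕ.≤-trans (ℕ.m∸n≤m (N ℕ.+ N) 2) (ℕ.n≤1+n _)))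
    where
    lower : p < N ℕ.+ N ∸ 2
    lower = ℕ.≤-trans (ℕ.≤-reflexive (ℕ.+-comm 2 N)) (ℕ.≤-trans (ℕ.+-monoʳ-≤ N (ℕ.∸-monoˡ-≤ 2 4≤N))
        (ℕ.≤-reflexive (sym (ℕ.+-∸-assoc N (ℕ.≤-trans (s≤s (s≤s z≤n)) 6≤N)))))

  fermat² : ∀ k → 1 ≤ k → k ≤ N → ⌊ k ⌋ ^ (N ℕ.+ N) ≈[ 1 ] 1#
  fermat² k 1≤k k≤N = ≈-trans (≈-reflexive (^-homo-* ⌊ k ⌋ N N)) (≈-trans (≈-* (fermat k 1≤k k≤N) (fermat k 1≤k k≤N)) (≈-reflexive (*-identityˡ 1#)))

  module _ (b : ℕ → A) (b-spec : ∀ m → m ≤ N ℕ.+ N ∸ 2 → power-sum p m ≡ (κ ⋆ b) m) where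
    open BernoulliNumbers b (N ℕ.+ N ∸ 2) b-spec

    module V₀ = Voronoi (N ∸ 4) N (ℕ.∸-monoˡ-≤ 4 (ℕ.≤-trans (s≤s (s≤s (s≤s (s≤s (s≤s z≤n))))) 6≤N)) (ℕ.m∸n+n≡m 4≤N)
      (subst (_≤ N ℕ.+ N ∸ 2) (sym (2+[m∸4] N 4≤N)) (ℕ.∸-monoˡ-≤ 2 (ℕ.m≤m+n N N))) [-1]^N p∤N∸2 fermat

    module V₁ = Voronoi (N ℕ.+ N ∸ 4) (N ℕ.+ N) (ℕ.∸-monoˡ-≤ 4 (ℕ.≤-trans (ℕ.≤-trans (s≤s (s≤s (s≤s (s≤s (s≤s z≤n))))) 6≤N) (ℕ.m≤m+n N N))) (ℕ.m∸n+n≡m 4≤2N)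
      (ℕ.≤-reflexive (2+[m∸4] (N ℕ.+ N) 4≤2N)) ([-1]^double N) p∤2N∸2 fermat²

    private
      f₀ f₁ g₁ g₂ : A
      f₀ = V₀.f
      f₁ = V₁.f
      g₁ = ∑ n (λ j → ι j ^ 3 * ⌊ j ⌋ ^ N)
      g₂ = ∑ n (λ j → ι j ^ 3 * ⌊ j ⌋ ^ (N ℕ.+ N))

      g₁≈T : g₁ ≈[ 1 ] T
      g₁≈T = ≈-∑ n λ j 1≤j j≤n → ≈-trans (≈-*ˡ (ι j ^ 3) (fermat j 1≤j (ℕ.≤-trans j≤n n≤N))) (≈-reflexive (*-identityʳ _))

      g₂≈T : g₂ ≈[ 1 ] T
      g₂≈T = ≈-∑ n λ j 1≤j j≤n → ≈-trans (≈-*ˡ (ι j ^ 3) (fermat² j 1≤j (ℕ.≤-trans j≤n n≤N))) (≈-reflexive (*-identityʳ _))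

      -- x = k^{p-1} satisfies 2x - x² ≈ 1 modulo p².
      2g₁-g₂ : ⌊ 2 ⌋ * g₁ - g₂ ≈[ 2 ] T
      2g₁-g₂ = ≈-trans (≈-reflexive (trans (cong (_- g₂) (sym (∑-*ˡ n ⌊ 2 ⌋ _))) (sym (∑-minus n _ _)))) (≈-∑ n term)
        where
        term : ∀ j → 1 ≤ j → j ≤ n → ⌊ 2 ⌋ * (ι j ^ 3 * ⌊ j ⌋ ^ N) - ι j ^ 3 * ⌊ j ⌋ ^ (N ℕ.+ N) ≈[ 2 ] ι j ^ 3
        term j 1≤j j≤n = combine (null-* (- ι j ^ 3) (null-product d d))
            (trans (cong (λ x → ⌊ 2 ⌋ * (ι j ^ 3 * ⌊ j ⌋ ^ N) - ι j ^ 3 * x - ι j ^ 3) (^-homo-* ⌊ j ⌋ N N))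
          (solve 2 (λ u x → # 2 :* (u :* x) :- u :* (x :* x) :- u := (:- u) :* ((x :- # 1) :* (x :- # 1))) refl (ι j ^ 3) (⌊ j ⌋ ^ N)))
          where
          d = difference (fermat j 1≤j (ℕ.≤-trans j≤n n≤N))

      E₀ : (⌊ 2 ⌋ * (1# + P * q) - ⌊ 8 ⌋) * f₀ + (1# + P * q) * g₁ ≈[ 2 ] 0#
      E₀ = subst (λ x → (⌊ 2 ⌋ * x - ⌊ 8 ⌋) * f₀ + x * g₁ ≈[ 2 ] 0#) Q≡1+Pq
          (subst (λ g → (⌊ 2 ⌋ * Q - ⌊ 8 ⌋) * f₀ + Q * g ≈[ 2 ] 0#) V₀.G-s+1 V₀.voronoi)

      E₁ : (⌊ 2 ⌋ * (1# + P * q) ^ 2 - ⌊ 8 ⌋) * f₁ + (1# + P * q) ^ 2 * g₂ ≈[ 2 ] 0#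
      E₁ = subst (λ x → (⌊ 2 ⌋ * x - ⌊ 8 ⌋) * f₁ + x * g₂ ≈[ 2 ] 0#) (trans (^-homo-* ⌊ 2 ⌋ N N)
          (trans (cong (λ x → x * x) Q≡1+Pq) (solve 1 (λ x → x :* x := x :^ 2) refl (1# + P * q))))
        (subst (λ g → (⌊ 2 ⌋ * ⌊ 2 ⌋ ^ (N ℕ.+ N) - ⌊ 8 ⌋) * f₁ + ⌊ 2 ⌋ ^ (N ℕ.+ N) * g ≈[ 2 ] 0#) V₁.G-s+1 V₁.voronoi)

      6f₀ : ⌊ 6 ⌋ * f₀ - T ≈[ 1 ] 0#
      6f₀ = combine (null-+ (null-+ (null-* (- 1#) (≈-drop E₀)) (difference g₁≈T)) (multiple _))
          (solve 5 (λ P q f g T → # 6 :* f :- T :- # 0 := (:- # 1) :* ((# 2 :* (# 1 :+ P :* q) :- # 8) :* f :+ (# 1 :+ P :* q) :* g) :+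
          (g :- T) :+ P :^ 1 :* (# 2 :* q :* f :+ q :* g)) refl P q f₀ g₁ T)

      6f₁ : ⌊ 6 ⌋ * f₁ - T ≈[ 1 ] 0#
      6f₁ = combine (null-+ (null-+ (null-* (- 1#) (≈-drop E₁)) (difference g₂≈T)) (multiple _))
          (solve 5 (λ P q f g T → # 6 :* f :- T :- # 0 := (:- # 1) :* ((# 2 :* (# 1 :+ P :* q) :^ 2 :- # 8) :* f :+
          (# 1 :+ P :* q) :^ 2 :* g) :+ (g :- T) :+ P :^ 1 :* ((# 2 :* q :+ P :* q :^ 2) :* (# 2 :* f :+ g))) refl P q f₁ g₂ T)

      -- In -2 E₀ + E₁ the terms of order pq are multiples of f₀ - f₁ and g₁ - g₂. Both differences
      -- vanish modulo p (the first is an instance of Kummer's congruence), so q disappears modulo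
      -- p².
      12f₀-6f₁ : ⌊ 12 ⌋ * f₀ - ⌊ 6 ⌋ * f₁ - T ≈[ 2 ] 0#
      12f₀-6f₁ = combine (null-+ (null-+ (null-+ (null-+ (null-+ (null-* (- ⌊ 2 ⌋) E₀) E₁) (difference 2g₁-g₂))
          (null-* (⌊ 4 ⌋ * q) (null-P 1 f₀≈f₁))) (null-* (⌊ 2 ⌋ * q) (null-P 1 (difference (≈-trans g₁≈T (≈-sym g₂≈T)))))) (multiple _))
        (solve 7 (λ P q f F g G T → # 12 :* f :- # 6 :* F :- T :- # 0 := (:- # 2) :*
            ((# 2 :* (# 1 :+ P :* q) :- # 8) :* f :+ (# 1 :+ P :* q) :* g) :+
            ((# 2 :* (# 1 :+ P :* q) :^ 2 :- # 8) :* F :+ (# 1 :+ P :* q) :^ 2 :* G) :+ (# 2 :* g :- G :- T) :+ # 4 :* q :*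
            (P :^ 1 :* (f :- F)) :+ # 2 :* q :* (P :^ 1 :* (g :- G)) :+ P :^ 2 :* (:- (q :^ 2 :* (# 2 :* F :+ G)))) refl P q f₀ f₁ g₁ g₂ T)
        where
        f₀≈f₁ : f₀ - f₁ ≈[ 1 ] 0#
        f₀≈f₁ = cancel 6 p∤6 (combine (null-+ 6f₀ (null-* (- 1#) 6f₁))
            (solve 3 (λ f F T → # 6 :* (f :- F) :- # 0 := # 6 :* f :- T :+ (:- # 1) :* (# 6 :* F :- T)) refl f₀ f₁ T))

      2β₀ : ⌊ 2 ⌋ * V₀.β + T ≈[ 1 ] 0#
      2β₀ = combine (null-+ (null-* (- 1#) 6f₀) (multiple _)) (trans (cong (λ x → ⌊ 2 ⌋ * x + T - 0#)
          (trans V₀.β≡ (cong (_* f₀) (trans (cong ⌊_⌋ (2+[m∸4] N 4≤N)) (trans (⌊∸⌋ p 3 (s≤s (ℕ.≤-trans (s≤s (s≤s z≤n)) 6≤N))) refl)))))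
        (solve 3 (λ P f T → # 2 :* ((P :- # 3) :* f) :+ T :- # 0 := (:- # 1) :* (# 6 :* f :- T) :+ P :^ 1 :* (# 2 :* f)) refl P f₀ T))

    -- Multiplication by 48 clears the denominators. The term 84 (f₀ - f₁/2) is 7 (12 f₀ - 6 f₁) ≡
    -- 7T, and 56 p q B_(p-3) ≡ -28 p q T, which leads back to `λ₂3-congruence`.
    congruence : λ₂ 3 ≈[ 2 ] - ι 3 * q ^ 3 + ⌊ 7 ⌋ * ι 4 * (V₀.β * ι (N ∸ 2) - V₁.β * ι (2 ℕ.* (N ℕ.+ N ∸ 2))) + ⌊ 5 ⌋ * ι 12 * P * q ^ 4 +
        ⌊ 7 ⌋ * ι 6 * P * q * V₀.β - ⌊ 3 ⌋ * ι 8 * P * Ω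
    congruence = combine (cancel 48 (p∤* {2} {24} p∤2 p∤24) (combine (null-+ (null-+ λ₂3-congruence (null-* (- ⌊ 7 ⌋) 12f₀-6f₁))
        (null-* (- (⌊ 28 ⌋ * q)) (null-P 1 2β₀)))
        (trans (trans (solve 12 (λ L a b c d e P q x y z o → # 48 :* (L :-
            ((:- a) :* q :^ 3 :+ # 7 :* b :* (z :* x :- y) :+ # 5 :* c :* P :* q :^ 4 :+ # 7 :* d :* P :* q :* z :- # 3 :* e :* P :* o)) :-
            # 0 := # 48 :* L :+ # 16 :* (# 3 :* a) :* q :^ 3 :- # 84 :* (# 4 :* b) :* (z :* x :- y) :- # 20 :*
            (# 12 :* c) :* P :* q :^ 4 :- # 56 :* (# 6 :* d) :* P :* q :* z :+ # 18 :* (# 8 :* e) :* P :* o) refl (λ₂ 3) (ι 3) (ι 4) (ι 12)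
            (ι 6) (ι 8) P q (ι (N ∸ 2)) y z Ω)
          (cong₂ _+_ (cong₂ _-_ (cong₂ _-_ (cong₂ _-_ (cong (λ t → ⌊ 48 ⌋ * λ₂ 3 + ⌊ 16 ⌋ * t * q ^ 3) (ι-inverse 3 p∤3))
              (cong₂ (λ s t → ⌊ 84 ⌋ * s * t) (ι-inverse 4 p∤4) (cong₂ (λ s t → z * ι s - t) (sym (2+[m∸4] N 4≤N)) y-value)))
             (cong (λ t → ⌊ 20 ⌋ * t * P * q ^ 4) (ι-inverse 12 (p∤* {2} {6} p∤2 p∤6))))
                 (cong (λ t → ⌊ 56 ⌋ * t * P * q * z) (ι-inverse 6 p∤6))) (cong (λ t → ⌊ 18 ⌋ * t * P * Ω) (ι-inverse 8 p∤8))))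
         (trans (solve 8 (λ L P q z f F h o → # 48 :* L :+ # 16 :* # 1 :* q :^ 3 :- # 84 :* # 1 :*
             (f :- h :* F) :- # 20 :* # 1 :* P :* q :^ 4 :- # 56 :* # 1 :* P :* q :* z :+ # 18 :* # 1 :* P :* o
             := # 48 :* L :+ # 16 :* q :^ 3 :- # 20 :* P :* q :^ 4 :- # 56 :* P :* q :* z :+ # 18 :* P :* o :- # 84 :* f :+ # 42 :*
             (# 2 :* h) :* F) refl (λ₂ 3) P q z f₀ f₁ ½ Ω)
         (trans (cong (λ t → ⌊ 48 ⌋ * λ₂ 3 + ⌊ 16 ⌋ * q ^ 3 - ⌊ 20 ⌋ * P * q ^ 4 - ⌊ 56 ⌋ * P * q * z + ⌊ 18 ⌋ * P * Ω - ⌊ 84 ⌋ * f₀ + ⌊ 42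
             ⌋ * t * f₁) 2*½)
         (solve 8 (λ L P q z f F o T → # 48 :* L :+ # 16 :* q :^ 3 :- # 20 :* P :* q :^ 4 :- # 56 :* P :* q :* z :+ # 18 :* P :* o :- #
             84 :* f :+ # 42 :* # 1 :* F := # 48 :* L :+ # 16 :* q :^ 3 :- # 7 :* T :- # 20 :* P :* q :^ 4 :+ # 28 :* P :* q :* T :+ # 18 :*
             P :* o :+ (:- # 7) :* (# 12 :* f :- # 6 :* F :- T) :+ (:- (# 28 :* q)) :* (P :^ 1 :* (# 2 :* z :+ T))) refl (λ₂ 3) P q z f₀ f₁ Ω T))))))
      refl
      where
      z y : A
      z = V₀.β
      y = V₁.β * ι (2 ℕ.* (N ℕ.+ N ∸ 2))
      y-value : y ≡ ½ * f₁
      y-value = trans (cong (V₁.β *_) halved) (solve 3 (λ b h u → b :* (h :* u) := h :* (b :* u)) refl V₁.β ½ (ι m))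
        where
        m = suc (suc (N ℕ.+ N ∸ 4))
        halved : ι (2 ℕ.* (N ℕ.+ N ∸ 2)) ≡ ½ * ι m
        halved = trans (cong (λ k → ι (2 ℕ.* k)) (sym (2+[m∸4] (N ℕ.+ N) 4≤2N))) (unique-inverse (ι-inverse (2 ℕ.* m) (p∤* {2} {m} p∤2 p∤2N∸2))
          (trans (cong (_* (½ * ι m)) (⌊*⌋ 2 m)) (trans (solve 3 (λ a h u → # 2 :* a :* (h :* u) := # 2 :* h :* (a :* u)) refl ⌊ m ⌋ ½
              (ι m)) (trans (cong₂ _*_ 2*½ (ι-inverse m p∤2N∸2)) (*-identityˡ 1#)))))

-- Integrality of p B_m and transfer from the field to the local ring

record Embedding (R≡ K≡ : CommutativeRing≡) : Set where
  private
    module R = CommutativeRing≡ R≡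
    module K = CommutativeRing≡ K≡
  field
    val : R.Carrier → K.Carrier
    val-+ : ∀ x y → val (x R.+ y) ≡ val x K.+ val y
    val-* : ∀ x y → val (x R.* y) ≡ val x K.* val y
    val-neg : ∀ x → val (R.- x) ≡ K.- val x
    val-0 : val R.0# ≡ K.0#
    val-1 : val R.1# ≡ K.1#
    val-injective : ∀ {x y} → val x ≡ val y → x ≡ y

module EmbeddingProperties {R≡ K≡ : CommutativeRing≡} (ε : Embedding R≡ K≡) where
  open Embedding ε public
  private
    module R = BinomialConvolution R≡
    module K = BinomialConvolution K≡

  val-⌊⌋ : ∀ m → val R.⌊ m ⌋ ≡ K.⌊ m ⌋
  val-⌊⌋ 0 = val-0
  val-⌊⌋ 1 = val-1
  val-⌊⌋ (suc (suc m)) = trans (val-+ R.1# R.⌊ suc m ⌋) (cong₂ K._+_ val-1 (val-⌊⌋ (suc m)))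

  val-^ : ∀ x m → val (x R.^ m) ≡ val x K.^ m
  val-^ x zero = val-1
  val-^ x (suc m) = trans (val-* x (x R.^ m)) (cong (val x K.*_) (val-^ x m))

  val-∑ : ∀ m f → val (R.∑ m f) ≡ K.∑ m (λ k → val (f k))
  val-∑ zero f = val-0
  val-∑ (suc m) f = trans (val-+ (R.∑ m f) (f (suc m))) (cong (K._+ val (f (suc m))) (val-∑ m f))

  val-power-sum : ∀ M m → val (R.power-sum M m) ≡ K.power-sum M m
  val-power-sum zero m = val-0
  val-power-sum (suc M) m = trans (val-+ (R.power-sum M m) (R.⌊ M ⌋ R.^ m))
      (cong₂ K._+_ (val-power-sum M m) (trans (val-^ R.⌊ M ⌋ m) (cong (K._^ m) (val-⌊⌋ M))))

  Integral : K.A → Set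
  Integral x = Σ R.A λ z → val z ≡ x

  integral-- : ∀ {x y} → Integral x → Integral y → Integral (x K.- y)
  integral-- (z , eq) (w , eq′) = z R.- w , trans (val-+ z (R.- w)) (cong₂ K._+_ eq (trans (val-neg w) (cong K.-_ eq′)))

  integral-* : ∀ {x y} → Integral x → Integral y → Integral (x K.* y)
  integral-* (z , eq) (w , eq′) = z R.* w , trans (val-* z w) (cong₂ K._*_ eq eq′)

  integral-∑ : ∀ m (f : ℕ → K.A) → (∀ k → 1 ≤ k → k ≤ m → Integral (f k)) → Integral (K.∑ m f)
  integral-∑ zero f h = R.0# , val-0
  integral-∑ (suc m) f h with integral-∑ m f (λ k 1≤k k≤m → h k 1≤k (ℕ.m≤n⇒m≤1+n k≤m)) | h (suc m) (s≤s z≤n) ℕ.≤-refl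
  ... | z , eq | w , eq′ = z R.+ w , trans (val-+ z w) (cong₂ K._+_ eq eq′)

-- Bernoulli numbers exist only in the larger ring. Here the multiples p B_m are pulled back to the
-- local ring, and Faulhaber's formula with them.
module BernoulliTransfer (n : ℕ) (p-prime : Prime (suc (n ℕ.+ n))) (5<p : 5 < suc (n ℕ.+ n)) (L : LocalRing (suc (n ℕ.+ n)))
  (K≡ : CommutativeRing≡) (ε : Embedding (LocalRing.ring L) K≡) (inv : ℕ → CommutativeRing≡.Carrier K≡)
  (inv-inverse : ∀ k → CommutativeRing≡._*_ K≡ (RingTheory.⌊_⌋ K≡ (suc k)) (inv (suc k)) ≡ CommutativeRing≡.1# K≡)
  (B : ℕ → CommutativeRing≡.Carrier K≡) (B-spec : ∀ m → BinomialConvolution._⋆_ K≡ B (BinomialConvolution.Δ K≡) m ≡ BinomialConvolution.δ₁ K≡ m) where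

  open LocalCongruence n p-prime 5<p L public
  open EmbeddingProperties ε public
  private
    module K = BinomialConvolution K≡
  open ≡-Reasoning

  K-cancel : ∀ m {x y} → K.⌊ suc m ⌋ K.* x ≡ K.⌊ suc m ⌋ K.* y → x ≡ y
  K-cancel m {x} {y} eq = trans (undo x) (trans (cong (inv (suc m) K.*_) eq) (sym (undo y)))
    where
    undo : ∀ x → x ≡ inv (suc m) K.* (K.⌊ suc m ⌋ K.* x)
    undo x = sym (trans (sym (K.*-assoc _ _ _)) (trans (cong (K._* x) (trans (K.*-comm _ _) (inv-inverse m))) (K.*-identityˡ x)))

  private
    m₀ : ℕ
    m₀ = N ℕ.+ N ∸ 2

    pB : ℕ → K.A
    pB m = K.⌊ p ⌋ K.* B m

    κ′ : ℕ → K.A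
    κ′ j = val (κ j)

    u : ℕ → K.A
    u m = K.⌊ p ⌋ K.^ suc m K.* inv (suc m)

    u-spec : ∀ m → K.⌊ suc m ⌋ K.* u m ≡ K.⌊ p ⌋ K.^ suc m
    u-spec m = trans (K.solve 3 (λ a x y → a K.:* (x K.:* y) K.:= x K.:* (a K.:* y)) refl K.⌊ suc m ⌋ (K.⌊ p ⌋ K.^ suc m) (inv (suc m)))
      (trans (cong (K.⌊ p ⌋ K.^ suc m K.*_) (inv-inverse m)) (K.*-identityʳ _))

    small : ∀ {j m} → j ≤ m → m ≤ m₀ → suc j < p ℕ.+ p
    small {j} {m} j≤m m≤ = s≤s (ℕ.≤-trans (s≤s (ℕ.≤-trans j≤m (ℕ.≤-trans m≤ (ℕ.m∸n≤m (N ℕ.+ N) 2)))) (ℕ.≤-reflexive (sym (ℕ.+-suc N N))))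

    u-κ : ∀ j → suc j < p ℕ.+ p → u j ≡ K.⌊ p ⌋ K.* κ′ j
    u-κ j j<2p = K-cancel j (trans (u-spec j) (sym (trans (K.solve 3 (λ a x y → a K.:* (x K.:* y) K.:= x K.:* (a K.:* y)) refl K.⌊ suc j ⌋
        K.⌊ p ⌋ (κ′ j))
      (cong (K.⌊ p ⌋ K.*_) (trans (cong (K._* κ′ j) (sym (val-⌊⌋ (suc j))))
          (trans (sym (val-* ⌊ suc j ⌋ (κ j))) (trans (cong val (κ-spec j j<2p)) (trans (val-^ P j) (cong (K._^ j) (val-⌊⌋ p))))))))))

    expansion : ∀ m → m ≤ m₀ → K.power-sum p m ≡ κ′ 0 K.* pB m K.+ K.∑ m (λ j → K.⌊ m C j ⌋ K.* (κ′ j K.* pB (m ∸ j)))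
    expansion m m≤ = begin
      K.power-sum p m
        ≡⟨ K-cancel m (K.faulhaber p B u B-spec u-spec m) ⟩
      (B K.⋆ u) m
        ≡⟨ trans (K.⋆-comm B u m) (K.⋆-expand u B m) ⟩
      u 0 K.* B m K.+ K.∑ m (λ j → K.⌊ m C j ⌋ K.* (u j K.* B (m ∸ j)))
        ≡⟨ cong₂ K._+_ (move 0 m z≤n) (K.∑-cong m λ j _ j≤m → cong (K.⌊ m C j ⌋ K.*_) (move j (m ∸ j) j≤m)) ⟩
      κ′ 0 K.* pB m K.+ K.∑ m (λ j → K.⌊ m C j ⌋ K.* (κ′ j K.* pB (m ∸ j))) ∎
      where
      move : ∀ j i → j ≤ m → u j K.* B i ≡ κ′ j K.* pB i
      move j i j≤m = trans (cong (K._* B i) (u-κ j (small j≤m m≤))) (K.solve 3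
          (λ x y z → x K.:* y K.:* z K.:= y K.:* (x K.:* z)) refl K.⌊ p ⌋ (κ′ j) (B i))

    integral-⌊⌋ : ∀ m → Integral K.⌊ m ⌋
    integral-⌊⌋ m = ⌊ m ⌋ , val-⌊⌋ m

    -- Faulhaber's formula is solved for its leading term p B_m. The other terms contain p B_(m-j)
    -- with the coefficient p^j/(j+1), which is integral because j ≥ 1 and j + 1 < 2p, so that j + 1
    -- contains p at most once.
    pB-integral : ∀ m → m ≤ m₀ → Integral (pB m)
    pB-integral = <-rec (λ m → m ≤ m₀ → Integral (pB m)) step
      where
      step : ∀ m → (∀ {k} → k < m → k ≤ m₀ → Integral (pB k)) → m ≤ m₀ → Integral (pB m)
      step m rec m≤ = subst Integral (sym isolated) (integral-- (power-sum p m , val-power-sum p m)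
          (integral-∑ m _ λ { (suc j) _ j≤m → integral-* (integral-⌊⌋ (m C suc j))
              (integral-* (κ (suc j) , refl) (rec (ℕ.∸-monoʳ-< {m} {suc j} {0} (s≤s z≤n) j≤m) (ℕ.≤-trans (ℕ.m∸n≤m m (suc j)) m≤))) }))
        where
        rest : K.A
        rest = K.∑ m (λ j → K.⌊ m C j ⌋ K.* (κ′ j K.* pB (m ∸ j)))
        isolated : pB m ≡ K.power-sum p m K.- rest
        isolated = sym (trans (cong (K._- rest) (trans (expansion m m≤)
            (cong (K._+ rest) (trans (cong (K._* pB m) (trans (cong val κ-0) val-1)) (K.*-identityˡ _)))))
          (K.solve 2 (λ x y → (x K.:+ y) K.:- y K.:= x) refl (pB m) rest))

  -- Integrality is established up to the index 2p - 4, the largest one in the theorem; 0 is a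
  -- default beyond it.
  b : ℕ → A
  b m with m ℕ.≤? m₀
  ... | yes m≤ = proj₁ (pB-integral m m≤)
  ... | no _ = 0#

  val-b : ∀ m → m ≤ m₀ → val (b m) ≡ K.⌊ p ⌋ K.* B m
  val-b m m≤ with m ℕ.≤? m₀
  ... | yes m≤′ = proj₂ (pB-integral m m≤′)
  ... | no m≰ = ⊥-elim (m≰ m≤)

  b-spec : ∀ m → m ≤ N ℕ.+ N ∸ 2 → power-sum p m ≡ (κ ⋆ b) m
  b-spec m m≤ = val-injective (trans (val-power-sum p m) (trans (expansion m m≤)
      (sym (trans (cong val (⋆-expand κ b m)) (trans (val-+ (κ 0 * b m) (∑ m (λ j → ⌊ m C j ⌋ * (κ j * b (m ∸ j)))))
    (cong₂ K._+_ (trans (val-* (κ 0) (b m)) (cong (κ′ 0 K.*_) (val-b m m≤)))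
      (trans (val-∑ m _) (K.∑-cong m λ j _ _ → trans (val-* ⌊ m C j ⌋ (κ j * b (m ∸ j)))
          (cong₂ K._*_ (val-⌊⌋ (m C j)) (trans (val-* (κ j) (b (m ∸ j))) (cong (κ′ j K.*_) (val-b (m ∸ j) (ℕ.≤-trans (ℕ.m∸n≤m m j) m≤)))))))))))))

  val-β : ∀ m β → b m ≡ P * β → m ≤ m₀ → val β ≡ B m
  val-β m β eq m≤ = K-cancel N (trans (cong (K._* val β) (sym (val-⌊⌋ p))) (trans (sym (val-* P β)) (trans (cong val (sym eq)) (val-b m m≤))))

open import Data.Integer using (+_)
open import Defs

-- Rational numbers and the recursively defined Bernoulli numbers

ℚ-ring : CommutativeRing≡
ℚ-ring = record { Carrier = ℚ ; isCommutativeRing = ℚ.+-*-isCommutativeRing }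

module ℚ′ = BinomialConvolution ℚ-ring

fromℕ-suc : ∀ m → fromℕ (suc m) ≡ 1ℚ ℚ.+ fromℕ m
fromℕ-suc m = toℚᵘ-injective (begin
  toℚᵘ (fromℕ (suc m))                 ≈⟨ toℚᵘ-fromℚᵘ (mkℚᵘ (+ suc m) 0) ⟩
  mkℚᵘ (+ suc m) 0                     ≈⟨ *≡* (cong (ℤ._* + 1) (cong (λ i → + 1 ℤ.+ i) (sym (ℤ.*-identityʳ (+ m))))) ⟩
  mkℚᵘ (+ 1) 0 ℚᵘ.+ mkℚᵘ (+ m) 0       ≈⟨ ℚᵘ.+-cong {mkℚᵘ (+ 1) 0} ℚᵘ.≃-refl (ℚᵘ.≃-sym (toℚᵘ-fromℚᵘ (mkℚᵘ (+ m) 0))) ⟩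
  toℚᵘ 1ℚ ℚᵘ.+ toℚᵘ (fromℕ m)          ≈⟨ toℚᵘ-homo-+ 1ℚ (fromℕ m) ⟨
  toℚᵘ (1ℚ ℚ.+ fromℕ m)                ∎)
  where open ℚᵘ.≃-Reasoning

⌊⌋-fromℕ : ∀ m → ℚ′.⌊ m ⌋ ≡ fromℕ m
⌊⌋-fromℕ zero = refl
⌊⌋-fromℕ (suc m) = trans (ℚ′.⌊suc⌋ m) (trans (cong (1ℚ ℚ.+_) (⌊⌋-fromℕ m)) (sym (fromℕ-suc m)))

fromℕ-inv : ∀ k → fromℕ (suc k) ℚ.* inv (suc k) ≡ 1ℚ
fromℕ-inv k = toℚᵘ-injective (begin
  toℚᵘ (fromℕ (suc k) ℚ.* inv (suc k))               ≈⟨ toℚᵘ-homo-* (fromℕ (suc k)) (inv (suc k)) ⟩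
  toℚᵘ (fromℕ (suc k)) ℚᵘ.* toℚᵘ (inv (suc k))       ≈⟨ ℚᵘ.*-cong (toℚᵘ-fromℚᵘ (mkℚᵘ (+ suc k) 0)) (toℚᵘ-fromℚᵘ (mkℚᵘ (+ 1) k)) ⟩
  mkℚᵘ (+ suc k) 0 ℚᵘ.* mkℚᵘ (+ 1) k                 ≈⟨ *≡* (trans (ℤ.*-identityʳ _)
      (trans (ℤ.*-identityʳ (+ suc k)) (sym (trans (ℤ.*-identityˡ _) (cong +_ (ℕ.+-identityʳ (suc k))))))) ⟩
  toℚᵘ 1ℚ                                            ∎)
  where open ℚᵘ.≃-Reasoning

inv-inverse : ∀ k → ℚ′.⌊ suc k ⌋ ℚ.* inv (suc k) ≡ 1ℚ
inv-inverse k = trans (cong (ℚ._* inv (suc k)) (⌊⌋-fromℕ (suc k))) (fromℕ-inv k)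

inv-unique : ∀ k x → fromℕ k ℚ.* x ≡ 1ℚ → x ≡ inv k
inv-unique zero x eq with trans (sym (ℚ.*-zeroˡ x)) eq
... | ()
inv-unique (suc k) x eq = begin
  x                                         ≡⟨ ℚ.*-identityʳ x ⟨
  x ℚ.* 1ℚ                                  ≡⟨ cong (x ℚ.*_) (fromℕ-inv k) ⟨
  x ℚ.* (fromℕ (suc k) ℚ.* inv (suc k))     ≡⟨ ℚ.*-assoc x _ _ ⟨
  x ℚ.* fromℕ (suc k) ℚ.* inv (suc k)       ≡⟨ cong (ℚ._* inv (suc k)) (trans (ℚ.*-comm x _) eq) ⟩
  1ℚ ℚ.* inv (suc k)                        ≡⟨ ℚ.*-identityˡ _ ⟩
  inv (suc k)                               ∎
  where open ≡-Reasoning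

fromℕ-^ : ∀ m k → fromℕ (m ℕ.^ k) ≡ fromℕ m ℚ′.^ k
fromℕ-^ m k = trans (sym (⌊⌋-fromℕ (m ℕ.^ k))) (trans (ℚ′.⌊^⌋ m k) (cong (ℚ′._^ k) (⌊⌋-fromℕ m)))

inv-^ : ∀ k j → inv (suc k) ℚ′.^ j ≡ inv (suc k ℕ.^ j)
inv-^ k j = inv-unique (suc k ℕ.^ j) _ (trans (cong (ℚ._* inv (suc k) ℚ′.^ j) (fromℕ-^ (suc k) j))
    (trans (sym (ℚ′.^-distrib-* (fromℕ (suc k)) (inv (suc k)) j)) (trans (cong (ℚ′._^ j) (fromℕ-inv k)) (ℚ′.1^ j))))

sumTo-∑ : ∀ m f → sumTo m f ≡ ℚ′.∑ m f
sumTo-∑ zero f = refl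
sumTo-∑ (suc m) f = cong (ℚ._+ f (suc m)) (sumTo-∑ m f)

lookup-∷ʳ-inject₁ : ∀ {m} (xs : Vec ℚ m) x i → lookup (xs ∷ʳ x) (Fin.inject₁ i) ≡ lookup xs i
lookup-∷ʳ-inject₁ (y ∷ xs) x Fin.zero = refl
lookup-∷ʳ-inject₁ (y ∷ xs) x (Fin.suc i) = lookup-∷ʳ-inject₁ xs x i

lookup-∷ʳ-fromℕ : ∀ {m} (xs : Vec ℚ m) x → lookup (xs ∷ʳ x) (Fin.fromℕ m) ≡ x
lookup-∷ʳ-fromℕ [] x = refl
lookup-∷ʳ-fromℕ (y ∷ xs) x = lookup-∷ʳ-fromℕ xs x

-- Extending the vector only appends an entry, so earlier entries remain the Bernoulli numbers of
-- their positions.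
lookup-bernoulliVec : ∀ m (i : Fin (suc m)) → lookup (bernoulliVec m) i ≡ B (toℕ i)
lookup-bernoulliVec zero Fin.zero = refl
lookup-bernoulliVec (suc m) i with view i
... | ‵fromℕ = trans (lookup-∷ʳ-fromℕ (bernoulliVec m) _) (sym (trans (cong B (toℕ-fromℕ (suc m))) (last-∷ʳ _ (bernoulliVec m))))
... | ‵inject₁ j = trans (lookup-∷ʳ-inject₁ (bernoulliVec m) _ j) (trans (lookup-bernoulliVec m j) (cong B (sym (toℕ-inject₁ j))))

sumFin-cong : ∀ m {f g : Fin m → ℚ} → (∀ i → f i ≡ g i) → sumFin m f ≡ sumFin m g
sumFin-cong zero eq = refl
sumFin-cong (suc m) eq = cong₂ ℚ._+_ (eq Fin.zero) (sumFin-cong m (λ i → eq (Fin.suc i)))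

sumFin-∑ : ∀ m (g : ℕ → ℚ) → sumFin m (λ i → g (suc (toℕ i))) ≡ ℚ′.∑ m g
sumFin-∑ zero g = refl
sumFin-∑ (suc m) g = trans (cong (g 1 ℚ.+_) (sumFin-∑ m (λ k → g (suc k)))) (sym (ℚ′.∑-first m g))

bernoulli-recurrence : ∀ m → ℚ′.⌊ suc (suc m) ⌋ ℚ.* B (suc m) ≡ ℚ.- (1ℚ ℚ.+ ℚ′.∑ m (λ j → ℚ′.⌊ suc (suc m) C j ⌋ ℚ.* B j))
bernoulli-recurrence m = begin
  ⌊ 2+m ⌋ * B (suc m)                                        ≡⟨ cong (⌊ 2+m ⌋ *_) (last-∷ʳ _ (bernoulliVec m)) ⟩
  ⌊ 2+m ⌋ * - (inv 2+m * Σ₀)                                 ≡⟨ solve 3 (λ a i s → a :* :- (i :* s) := :- (a :* i :* s)) refl ⌊ 2+m ⌋ (inv 2+m) Σ₀ ⟩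
  - (⌊ 2+m ⌋ * inv 2+m * Σ₀)                                 ≡⟨ cong (λ x → - (x * Σ₀)) (inv-inverse (suc m)) ⟩
  - (1# * Σ₀)                                                ≡⟨ cong -_ (trans (*-identityˡ Σ₀) Σ₀-value) ⟩
  - (1# + ∑ m (λ j → ⌊ 2+m C j ⌋ * B j))                     ∎
  where
  open ℚ′
  open ≡-Reasoning
  2+m = suc (suc m)
  Σ₀ = sumFin (suc m) (λ k → fromℕ (2+m C toℕ k) ℚ.* lookup (bernoulliVec m) k)
  Σ₀-value : Σ₀ ≡ 1# + ∑ m (λ j → ⌊ 2+m C j ⌋ * B j)
  Σ₀-value = trans (sumFin-cong (suc m) λ k → cong₂ _*_ (sym (⌊⌋-fromℕ (2+m C toℕ k))) (lookup-bernoulliVec m k))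
    (cong₂ _+_ (trans (cong (_* B 0) (⌊nC0⌋ 2+m)) (*-identityˡ 1#)) (sumFin-∑ m (λ j → ⌊ 2+m C j ⌋ * B j)))

-- The defining recurrence is the coefficientwise form of B(t) (e^t - 1) = t; the unknown of highest
-- index cancels in the difference made by `Δ`.
B-spec : ∀ m → (B ℚ′.⋆ ℚ′.Δ) m ≡ ℚ′.δ₁ m
B-spec zero = refl
B-spec (suc m) = trans (⋆-Δ B (suc m)) (trans (cong (_- B (suc m)) (trans (⋆-expand B (1# ^_) (suc m))
    (cong₂ _+_ (trans (*-identityˡ _) (1^ (suc m))) (∑-cong (suc m) λ j _ _ → cong (⌊ suc m C j ⌋ *_)
    (trans (cong (B j *_) (1^ (suc m ∸ j))) (*-identityʳ _)))))) (recurrence m))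
  where
  open ℚ′
  recurrence : ∀ m → 1# + ∑ (suc m) (λ j → ⌊ suc m C j ⌋ * B j) - B (suc m) ≡ δ₁ (suc m)
  recurrence zero = refl
  recurrence (suc m) = begin
    1# + (∑ m (λ j → ⌊ 2+m C j ⌋ * B j) + ⌊ 2+m C suc m ⌋ * B (suc m) + ⌊ 2+m C 2+m ⌋ * B 2+m) - B 2+m
      ≡⟨ cong₂ (λ x y → 1# + (s + x * B (suc m) + y * B 2+m) - B 2+m) middle (⌊nCn⌋ 2+m) ⟩
    1# + (s + ⌊ 2+m ⌋ * B (suc m) + 1# * B 2+m) - B 2+m
      ≡⟨ cong (λ x → 1# + (s + x + 1# * B 2+m) - B 2+m) (bernoulli-recurrence m) ⟩
    1# + (s + - (1# + s) + 1# * B 2+m) - B 2+m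
      ≡⟨ solve 2 (λ s b → # 1 :+ (s :+ :- (# 1 :+ s) :+ # 1 :* b) :- b := # 0) refl s (B 2+m) ⟩
    0# ∎
    where
    open ≡-Reasoning
    2+m = suc (suc m)
    s = ∑ m (λ j → ⌊ 2+m C j ⌋ * B j)
    middle : ⌊ 2+m C suc m ⌋ ≡ ⌊ 2+m ⌋
    middle = cong ⌊_⌋ (trans (nCk≡nC[n∸k] {suc m} {2+m} (ℕ.n≤1+n (suc m))) (trans (cong (2+m C_) (ℕ.m+n∸n≡m 1 (suc m))) (nC1≡n 2+m)))

-- The integers localised at p inside the rationals

module Localisation (p : ℕ) (p-prime : Prime p) where

  -- The ring of p-integral rationals; integrality is irrelevant, so elements are equal when their values are.
  record ℤₚ : Set where
    constructor mkℤₚ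
    field
      value : ℚ
      .integral : ¬ (p ∣ ↧ₙ value)
  open ℤₚ public

  value-injective : ∀ {x y} → value x ≡ value y → x ≡ y
  value-injective refl = refl

  pIntegral-value : ∀ x → pIntegral p (value x)
  pIntegral-value (mkℤₚ x i) p∣ = ⊥-elim-irr (i p∣)

  1<p : 1 < p
  1<p = ℕ.nonTrivial⇒n>1 p {{prime⇒nonTrivial p-prime}}

  p∤1 : ¬ p ∣ 1
  p∤1 = >⇒∤ 1<p

  coprime-factor : ∀ {d a b} → d ∣ a ℕ.* b → ¬ p ∣ a → ¬ p ∣ b → ¬ p ∣ d
  coprime-factor {a = a} {b} d∣ab p∤a p∤b p∣d with euclidsLemma a b p-prime (∣-trans p∣d d∣ab)
  ... | inj₁ p∣a = p∤a p∣a
  ... | inj₂ p∣b = p∤b p∣b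

  ℤ-factor : ∀ d x c → (+ d) ℤ.* x ≡ + c → d ∣ c
  ℤ-factor d x c eq = divides ℤ.∣ x ∣ (trans (sym (cong ℤ.∣_∣ eq)) (trans (ℤ.abs-* (+ d) x) (ℕ.*-comm d ℤ.∣ x ∣)))

  integral-+ : ∀ x y → ¬ p ∣ ↧ₙ x → ¬ p ∣ ↧ₙ y → ¬ p ∣ ↧ₙ (x ℚ.+ y)
  integral-+ x@record{} y@record{} = coprime-factor {↧ₙ (x ℚ.+ y)} {↧ₙ x} {↧ₙ y} (ℤ-factor _ _ _ (trans (ℚ.↧-+ x y) refl))

  integral-* : ∀ x y → ¬ p ∣ ↧ₙ x → ¬ p ∣ ↧ₙ y → ¬ p ∣ ↧ₙ (x ℚ.* y)
  integral-* x@record{} y@record{} = coprime-factor {↧ₙ (x ℚ.* y)} {↧ₙ x} {↧ₙ y} (ℤ-factor _ _ _ (ℚ.↧-* x y))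

  integral-neg : ∀ x → ¬ p ∣ ↧ₙ x → ¬ p ∣ ↧ₙ (ℚ.- x)
  integral-neg x = subst (λ d → ¬ p ∣ d) (sym (cong ℤ.∣_∣ (ℚ.↧-neg x)))

  integral-inv : ∀ k → ¬ p ∣ k → ¬ p ∣ ↧ₙ inv k
  integral-inv zero _ = p∤1
  integral-inv (suc k) p∤k p∣d = p∤k (∣-trans p∣d (ℤ-factor (↧ₙ inv (suc k)) _ (suc k) (ℚ.↧-/ (+ 1) (suc k))))

  rawRing : RawRing _ _
  rawRing = record
    { Carrier = ℤₚ ; _≈_ = _≡_
    ; _+_ = λ { (mkℤₚ x i) (mkℤₚ y j) → mkℤₚ (x ℚ.+ y) (integral-+ x y i j) }
    ; _*_ = λ { (mkℤₚ x i) (mkℤₚ y j) → mkℤₚ (x ℚ.* y) (integral-* x y i j) }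
    ; -_ = λ { (mkℤₚ x i) → mkℤₚ (ℚ.- x) (integral-neg x i) }
    ; 0# = mkℤₚ 0ℚ p∤1 ; 1# = mkℤₚ 1ℚ p∤1 }

  open RingMorphisms rawRing +-*-rawRing using (IsRingMonomorphism)

  value-monomorphism : IsRingMonomorphism value
  value-monomorphism = record
    { isRingHomomorphism = record
      { isSemiringHomomorphism = record
        { isNearSemiringHomomorphism = record
          { +-isMonoidHomomorphism = record
            { isMagmaHomomorphism = record { isRelHomomorphism = record { cong = cong value } ; homo = λ _ _ → refl }
            ; ε-homo = refl }
          ; *-homo = λ _ _ → refl }
        ; 1#-homo = refl }
      ; -‿homo = λ _ → refl }
    ; injective = value-injective }

  ℤₚ-ring : CommutativeRing≡
  ℤₚ-ring = record { isCommutativeRing = RingMonomorphism.isCommutativeRing value-monomorphism ℚ.+-*-isCommutativeRing }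

  embedding : Embedding ℤₚ-ring ℚ-ring
  embedding = record { val = value ; val-+ = λ _ _ → refl ; val-* = λ _ _ → refl ; val-neg = λ _ → refl ; val-0 = refl ; val-1 = refl ;
      val-injective = value-injective }

  open EmbeddingProperties embedding using (val-⌊⌋)
  private
    module R = RingTheory ℤₚ-ring

  ι : ℕ → ℤₚ
  ι k with p ∣? k
  ... | yes _ = R.0#
  ... | no p∤k = mkℤₚ (inv k) (integral-inv k p∤k)

  value-ι : ∀ k → ¬ p ∣ k → value (ι k) ≡ inv k
  value-ι k p∤k with p ∣? k
  ... | yes p∣k = ⊥-elim (p∤k p∣k)
  ... | no _ = refl

  value-⌊⌋ : ∀ k → value R.⌊ k ⌋ ≡ fromℕ k
  value-⌊⌋ k = trans (val-⌊⌋ k) (⌊⌋-fromℕ k)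

  ι-inverse : ∀ k → ¬ p ∣ k → R.⌊ k ⌋ R.* ι k ≡ R.1#
  ι-inverse zero p∤0 = ⊥-elim (p∤0 (p ∣0))
  ι-inverse (suc k) p∤k = value-injective (trans (cong₂ ℚ._*_ (value-⌊⌋ (suc k)) (value-ι (suc k) p∤k)) (fromℕ-inv k))

  regular : ∀ {x} → R.⌊ p ⌋ R.* x ≡ R.0# → x ≡ R.0#
  regular {x} eq = value-injective (cancelled p (λ p≡0 → ℕ.<⇒≢ (ℕ.<-trans (s≤s z≤n) 1<p) (sym p≡0))
      (trans (cong (ℚ._* value x) (sym (value-⌊⌋ p))) (cong value eq)))
    where
    cancelled : ∀ k → ¬ k ≡ 0 → fromℕ k ℚ.* value x ≡ 0ℚ → value x ≡ 0ℚ
    cancelled zero k≢0 _ = ⊥-elim (k≢0 refl)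
    cancelled (suc k) _ eq′ = begin
      value x                                          ≡⟨ ℚ.*-identityˡ (value x) ⟨
      1ℚ ℚ.* value x                                   ≡⟨ cong (ℚ._* value x) (trans (ℚ.*-comm (inv (suc k)) (fromℕ (suc k))) (fromℕ-inv k)) ⟨
      inv (suc k) ℚ.* fromℕ (suc k) ℚ.* value x        ≡⟨ ℚ.*-assoc (inv (suc k)) _ _ ⟩
      inv (suc k) ℚ.* (fromℕ (suc k) ℚ.* value x)      ≡⟨ cong (inv (suc k) ℚ.*_) eq′ ⟩
      inv (suc k) ℚ.* 0ℚ                               ≡⟨ ℚ.*-zeroʳ (inv (suc k)) ⟩
      0ℚ                                               ∎
      where open ≡-Reasoning

  localRing : LocalRing p
  localRing = record { ring = ℤₚ-ring ; ι = ι ; ι-inverse = ι-inverse ; regular = regular }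

open import Data.Nat as N using (_^_)
open import Data.Nat.DivMod using (_/_)
open import Data.Rational using (_+_; _-_; _*_; -_)
open import Data.Rational as Q using ()

-- Translation of the local congruence into the statement

odd-prime : ∀ p → Prime p → 5 < p → Σ ℕ λ n → p ≡ suc (n N.+ n)
odd-prime p p-prime 5<p with p % 2 in eq | m%n<n p 2 | m≡m%n+[m/n]*n p 2
... | 0 | _ | p≡ = ⊥-elim (even (prime⇒irreducible p-prime (divides (p / 2) p≡)))
  where
  even : ¬ (2 ≡ 1 ⊎ 2 ≡ p)
  even (inj₁ ())
  even (inj₂ 2≡p) = ℕ.<⇒≢ (ℕ.<-trans (s≤s (s≤s (s≤s z≤n))) 5<p) 2≡p
... | 1 | _ | p≡ = p / 2 , trans p≡ (cong suc (trans (ℕ.*-comm (p / 2) 2) (cong (p / 2 N.+_) (ℕ.+-identityʳ (p / 2)))))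
... | suc (suc _) | s≤s (s≤s ()) | _

half-double : ∀ n → (n N.+ n) / 2 ≡ n
half-double n = trans (cong (_/ 2) (trans (cong (n N.+_) (sym (ℕ.+-identityʳ n))) (ℕ.*-comm 2 n))) (m*n/n≡m n 2)

module OddPrime (n : ℕ) (p-prime : Prime (suc (n N.+ n))) (5<p : 5 < suc (n N.+ n)) where
  private
    module Z = Localisation (suc (n N.+ n)) p-prime
    module L = BernoulliTransfer n p-prime 5<p Z.localRing ℚ-ring Z.embedding inv inv-inverse B B-spec
    module C₀ = L.V₀ L.b L.b-spec
    module C₁ = L.V₁ L.b L.b-spec
  open Z using (value; value-ι; value-⌊⌋; pIntegral-value)
  open L using (p)

  value-ι-range : ∀ k → 1 ≤ k → k ≤ L.N → value (Z.ι k) ≡ inv k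
  value-ι-range k 1≤k k≤N = value-ι k (L.p∤ k 1≤k k≤N)

  value-ι^ : ∀ k j → 1 ≤ k → k ≤ L.N → value (Z.ι k L.^ j) ≡ inv (k ^ j)
  value-ι^ k@(suc k′) j 1≤k k≤N = trans (L.val-^ (Z.ι k) j) (trans (cong (ℚ′._^ j) (value-ι-range k 1≤k k≤N)) (inv-^ k′ j))

  value-λ₂ : value (L.λ₂ 3) ≡ sumTo L.N (λ k → fromℕ (2 ^ k) * inv (k ^ 3))
  value-λ₂ = trans (L.val-∑ L.N _) (trans (ℚ′.∑-cong L.N λ k 1≤k k≤N → cong₂ _*_ (trans (cong value (sym (L.⌊^⌋ 2 k))) (value-⌊⌋ (2 ^ k)))
      (value-ι^ k 3 1≤k k≤N)) (sym (sumTo-∑ L.N _)))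

  value-H : ∀ k → k ≤ L.N → value (L.H 1 k) ≡ H k
  value-H k k≤N = trans (L.val-∑ k _) (trans (ℚ′.∑-cong k λ i 1≤i i≤k → trans (value-ι^ i 1 1≤i (ℕ.≤-trans i≤k k≤N))
      (cong inv (ℕ.^-identityʳ i))) (sym (sumTo-∑ k inv)))

  value-Ω : value L.Ω ≡ sumTo ((p ∸ 1) / 2) (λ k → H k * inv (k ^ 3))
  value-Ω = trans (L.val-∑ n _) (trans (ℚ′.∑-cong n λ k 1≤k k≤n → trans
      (cong₂ _*_ (value-ι^ k 3 1≤k (ℕ.≤-trans k≤n L.n≤N)) (value-H k (ℕ.≤-trans k≤n L.n≤N))) (ℚ.*-comm (inv (k ^ 3)) (H k)))
      (trans (sym (sumTo-∑ n _)) (cong (λ m → sumTo m (λ k → H k * inv (k ^ 3))) (sym (half-double n)))))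

  value-q : value L.q ≡ q2 p
  value-q = sym (begin
    (fromℕ (2 ^ L.N) - 1ℚ) * inv p                ≡⟨ cong (λ x → (x - 1ℚ) * inv p)
        (trans (sym (value-⌊⌋ (2 ^ L.N))) (cong value (trans (L.⌊^⌋ 2 L.N) L.Q≡1+Pq))) ⟩
    (1ℚ + value L.P * value L.q - 1ℚ) * inv p     ≡⟨ ℚ′.solve 3 (λ a q i →
        (ℚ′.# 1 ℚ′.:+ a ℚ′.:* q ℚ′.:- ℚ′.# 1) ℚ′.:* i ℚ′.:= a ℚ′.:* i ℚ′.:* q) refl (value L.P) (value L.q) (inv p) ⟩
    value L.P * inv p * value L.q                 ≡⟨ cong (_* value L.q) (trans (cong (_* inv p) (value-⌊⌋ p)) (fromℕ-inv L.N)) ⟩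
    1ℚ * value L.q                                ≡⟨ ℚ.*-identityˡ _ ⟩
    value L.q                                     ∎)
    where open ≡-Reasoning

  2p∸4 : L.N N.+ L.N ∸ 2 ≡ 2 N.* p ∸ 4
  2p∸4 = cong (λ k → suc k ∸ 4) (sym (trans (ℕ.+-suc L.N (L.N N.+ 0)) (cong (λ k → suc (L.N N.+ k)) (ℕ.+-identityʳ L.N))))

  4p∸8 : 2 N.* (L.N N.+ L.N ∸ 2) ≡ 4 N.* p ∸ 8
  4p∸8 = trans (cong (2 N.*_) 2p∸4) (trans (ℕ.*-distribˡ-∸ 2 (2 N.* p) 4) (cong (_∸ 8) (sym (ℕ.*-assoc 2 2 p))))

  value-β₀ : value C₀.β ≡ B (p ∸ 3)
  value-β₀ = trans (L.val-β _ C₀.β C₀.b≡Pβ (subst (_≤ L.N N.+ L.N ∸ 2) (sym (2+[m∸4] L.N L.4≤N)) (ℕ.∸-monoˡ-≤ 2 (ℕ.m≤m+n L.N L.N))))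
      (cong B (2+[m∸4] L.N L.4≤N))

  value-β₁ : value C₁.β ≡ B (2 N.* p ∸ 4)
  value-β₁ = trans (L.val-β _ C₁.β C₁.b≡Pβ (ℕ.≤-reflexive (2+[m∸4] (L.N N.+ L.N) L.4≤2N))) (cong B (trans (2+[m∸4] (L.N N.+ L.N) L.4≤2N) 2p∸4))

  value-ι-4p∸8 : value (Z.ι (2 N.* (L.N N.+ L.N ∸ 2))) ≡ inv (4 N.* p ∸ 8)
  value-ι-4p∸8 = trans (value-ι _ (L.p∤* {2} {L.N N.+ L.N ∸ 2} L.p∤2 (subst (λ k → ¬ p ∣ k) (2+[m∸4] (L.N N.+ L.N) L.4≤2N) L.p∤2N∸2))) (cong inv 4p∸8)

  value-ι-p∸3 : value (Z.ι (L.N ∸ 2)) ≡ inv (p ∸ 3)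
  value-ι-p∸3 = value-ι (L.N ∸ 2) (subst (λ k → ¬ p ∣ k) (2+[m∸4] L.N L.4≤N) L.p∤N∸2)

  -- The rational number that has to be p-integral is the value of the quotient stored in the
  -- congruence, an element of `ℤₚ`.
  from-local : ∀ {x y} → x L.≈[ 2 ] y → value x ≡ value y [mod p ^ 2 ]
  from-local {x} {y} h = subst (pIntegral p) (sym (begin
    (value x - value y) * inv (p ^ 2)                            ≡⟨ cong (λ z → (value z - value y) * inv (p ^ 2)) (L.equation h) ⟩
    (value y + value (L.P L.^ 2) * c - value y) * inv (p ^ 2)    ≡⟨ ℚ′.solve 4
        (λ y a c i → (y ℚ′.:+ a ℚ′.:* c ℚ′.:- y) ℚ′.:* i ℚ′.:= a ℚ′.:* i ℚ′.:* c) refl (value y) (value (L.P L.^ 2)) c (inv (p ^ 2)) ⟩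
    value (L.P L.^ 2) * inv (p ^ 2) * c                          ≡⟨ cong (_* c)
        (trans (cong₂ _*_ (trans (cong value (sym (L.⌊^⌋ p 2))) (value-⌊⌋ (p ^ 2))) refl) (fromℕ-inv (N.pred (p ^ 2)))) ⟩
    1ℚ * c                                                       ≡⟨ ℚ.*-identityˡ c ⟩
    c                                                            ∎)) (pIntegral-value (L.quotient h))
    where
    open ≡-Reasoning
    c = value (L.quotient h)

  theorem : sumTo (p ∸ 1) (λ k → fromℕ (2 ^ k) * inv (k ^ 3))
    ≡ - ((+ 1) Q./ 3) * (q2 p ^ℚ 3)
    + ((+ 7) Q./ 4) * (B (p ∸ 3) * inv (p ∸ 3) - B (2 N.* p ∸ 4) * inv (4 N.* p ∸ 8))
    + ((+ 5) Q./ 12) * fromℕ p * (q2 p ^ℚ 4)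
    + ((+ 7) Q./ 6) * fromℕ p * q2 p * B (p ∸ 3)
    - ((+ 3) Q./ 8) * fromℕ p * sumTo ((p ∸ 1) / 2) (λ k → H k * inv (k ^ 3))
    [mod p ^ 2 ]
  theorem = subst₂ (λ x y → x ≡ y [mod p ^ 2 ]) value-λ₂
    (cong₂ _-_ (cong₂ _+_ (cong₂ _+_ (cong₂ _+_
        (cong₂ (λ c x → - c * (x ^ℚ 3)) (value-ι 3 L.p∤3) value-q)
        -- Closed rationals such as `fromℕ 7 * inv 4` and 7/4 have the same normal form, so the
        -- numerical coefficients agree by evaluation.
        (cong₂ _*_ (cong₂ _*_ (value-⌊⌋ 7) (value-ι 4 L.p∤4)) (cong₂ _-_ (cong₂ _*_ value-β₀ value-ι-p∸3) (cong₂ _*_ value-β₁ value-ι-4p∸8))))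
        (cong₂ _*_ (cong₂ _*_ (cong₂ _*_ (value-⌊⌋ 5) (value-ι 12 (L.p∤* {2} {6} L.p∤2 L.p∤6))) (value-⌊⌋ p)) (cong (_^ℚ 4) value-q)))
        (cong₂ _*_ (cong₂ _*_ (cong₂ _*_ (cong₂ _*_ (value-⌊⌋ 7) (value-ι 6 L.p∤6)) (value-⌊⌋ p)) value-q) value-β₀))
        (cong₂ _*_ (cong₂ _*_ (cong₂ _*_ (value-⌊⌋ 3) (value-ι 8 L.p∤8)) (value-⌊⌋ p)) value-Ω))
    (from-local (L.congruence L.b L.b-spec))

theorem1p2 : (p : ℕ) → Prime p → 5 < p →
    sumTo (p ∸ 1) (λ k → fromℕ (2 ^ k) * inv (k ^ 3))
    ≡ - ((+ 1) Q./ 3) * (q2 p ^ℚ 3)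
    + ((+ 7) Q./ 4) * (B (p ∸ 3) * inv (p ∸ 3) - B (2 N.* p ∸ 4) * inv (4 N.* p ∸ 8))
    + ((+ 5) Q./ 12) * fromℕ p * (q2 p ^ℚ 4)
    + ((+ 7) Q./ 6) * fromℕ p * q2 p * B (p ∸ 3)
    - ((+ 3) Q./ 8) * fromℕ p * sumTo ((p ∸ 1) / 2) (λ k → H k * inv (k ^ 3))
    [mod p ^ 2 ]
theorem1p2 p p-prime 5<p with odd-prime p p-prime 5<p
... | n , refl = OddPrime.theorem n p-prime 5<p
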